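{- For every $\alpha>0$ there is $c_0>0$ such that for every $0<c\leq c_0$ there is $n_0$ such that for all $n\geq n_0$ the following holds. Let $G$ be an $n$-vertex graph with $\delta(G)\geq (1/2+\alpha)n$. Let $T$ be an $n$-vertex tree with $\Delta(T)\leq cn/\log n$. Let $t\in V(T)$ and $v\in V(G)$. Then $G$ contains a copy of $T$ in which $t$ is copied to $v$. -}

module Defs where

open import Data.Nat using (ℕ; zero; suc; _+_; _*_; _^_; _≤_)
open import Data.Bool using (Bool; true; false; if_then_else_)
open import Data.Fin using (Fin; zero; suc; toℕ; fromℕ)
open import Data.List using (List; map; allFin)
open import Data.Nat.ListAction using (sum)
open import Data.Integer using (∣_∣)
open import Data.Rational using (ℚ; ↥_; ↧ₙ_)
open import Data.Product using (Σ; _×_)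
open import Function.Definitions using (Injective)
open import Relation.Binary.PropositionalEquality using (_≡_)
open import Relation.Nullary using (¬_)

record Graph (n : ℕ) : Set where
  field
    adj   : Fin n → Fin n → Bool
    sym   : ∀ u v → adj u v ≡ adj v u
    irrefl : ∀ v → adj v v ≡ false

open Graph public

_∼[_]_ : ∀ {n} → Fin n → Graph n → Fin n → Set
u ∼[ G ] v = adj G u v ≡ true

degree : ∀ {n} → Graph n → Fin n → ℕ
degree {n} G v = sum (map (λ u → if adj G v u then 1 else 0) (allFin n))

data Walk {n} (G : Graph n) : Fin n → Fin n → Set where
  here  : ∀ {u} → Walk G u u
  step  : ∀ {u w v} → u ∼[ G ] w → Walk G w v → Walk G u v

Connected : ∀ {n} → Graph n → Set
Connected G = ∀ u v → Walk G u v

record Cycle {n} (G : Graph n) (k : ℕ) : Set where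
  field
    f      : Fin (suc (suc (suc k))) → Fin n
    inj    : Injective _≡_ _≡_ f
    consec : ∀ i j → suc (toℕ i) ≡ toℕ j → f i ∼[ G ] f j
    close  : f (fromℕ (suc (suc k))) ∼[ G ] f zero

Acyclic : ∀ {n} → Graph n → Set
Acyclic G = ∀ k → ¬ Cycle G k

IsTree : ∀ {n} → Graph n → Set
IsTree G = Connected G × Acyclic G

-- d ≤ c·n / log₂ n, for c = p/q ≥ 0, written exactly as  n^(d·q) ≤ 2^(p·n)
DegBound : ℚ → ℕ → ℕ → Set
DegBound c n d = n ^ (d * ↧ₙ c) ≤ 2 ^ (∣ ↥ c ∣ * n)

record Embedding {n} (T G : Graph n) : Set where
  field
    φ     : Fin n → Fin n
    φ-inj : Injective _≡_ _≡_ φ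
    φ-hom : ∀ x y → x ∼[ T ] y → φ x ∼[ G ] φ y

{-# OPTIONS --safe #-}
-- Bottom-up, T is cut into about n / M rooted pieces of O(Δ(T)) = O(c n / log n) vertices, which are placed
-- greedily, one after another, into the set U of free vertices of G.
--
-- Balance.  The placement keeps more than half of U in every neighbourhood N(v) until |U| is about n / ē.
-- Multiplicative weights reduce this to placing one piece at no more than average cost, for a given cost
-- function on U.  Let A be the cheapest few vertices and B the cheaper half of U.  Every vertex of A has many
-- neighbours in B, so some subgraph of G[A, B] has large minimum degree; the larger colour class of the piece
-- goes to A and the other one to B, and the mean of the two cost thresholds is about the average cost.
-- The potential has n terms and a step has size |piece| / n, whence the condition Δ(T) ≤ c n / log n.
--
-- Absorption.  At least half of the vertices y of T have degree at most 2.  The first pieces are placed such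
-- that for all u, v linearly many such y have their image in N(v) and their neighbours' images in N(u): this is
-- multiplicative weights over the pairs (u, v), where for given weights a random pair (u, v) yields classes N(u)
-- and N(v) into which a piece can be placed so that its y's serve a constant proportion of the weight.
-- At the end, if the parent of an unplaced x sits at v and u is free, then such a y moves to u and x takes the
-- old place of y.

module Submission where

open import Data.Nat hiding (_/_; _%_)
open import Data.Nat.Properties
open import Data.Nat.DivMod using (_/_; m≡m%n+[m/n]*n; m%n<n; m/n*n≤m)
open import Data.Nat.Tactic.RingSolver using (solve-∀)
open import Data.Bool using (Bool; true; false; T; _∧_; _∨_; not; if_then_else_)
open import Data.Bool.Properties using (∧-zeroʳ; ∧-identityʳ; not-involutive)
open import Data.Fin using (Fin)
import Data.Fin as Fin
import Data.Fin.Properties as FinP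
open import Data.List using (List; []; _∷_; _++_; _ʳ++_; length; map; allFin; lookup; cartesianProduct)
open import Data.List.Membership.Propositional using (_∈_; _∉_)
open import Data.List.Membership.Propositional.Properties using (∈-allFin; ∈-++⁻; ∈-++⁺ˡ; ∈-++⁺ʳ; ∈-lookup; ∈-cartesianProduct⁺)
import Data.List.Membership.DecPropositional as DecMembership
open import Data.List.Properties using (length-++; length-map; length-tabulate)
open import Data.List.Relation.Unary.Any using (here; there)
open import Data.List.Relation.Unary.All using (All; []; _∷_)
import Data.List.Relation.Unary.All as All
open import Data.List.Relation.Unary.AllPairs using ([]; _∷_)
open import Data.List.Relation.Unary.Unique.Propositional using (Unique)
open import Data.List.Relation.Unary.Unique.Propositional.Properties using (allFin⁺) renaming (++⁺ to Unique-++⁺)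
open import Data.Product using (Σ; ∃; _×_; _,_; proj₁; proj₂)
open import Data.Sum using (_⊎_; inj₁; inj₂)
open import Data.Empty using (⊥; ⊥-elim)
open import Relation.Nullary using (¬_; Dec; yes; no)
open import Relation.Binary.PropositionalEquality using (_≡_; _≢_; refl; sym; trans; cong; cong₂; subst; subst₂)
open import Function using (_∘_; id; case_of_)
open import Relation.Nullary.Decidable using (⌊_⌋; True; toWitness; decidable-stable; ¬?)
open import Defs hiding (sym; step)
import Data.Nat.ListAction
open import Data.Nat.Coprimality using (Coprime; 1-coprimeTo)
import Data.Integer as ℤ
import Data.Integer.Properties as ℤ
open import Data.Rational using (ℚ; mkℚ; 0ℚ; ½)
import Data.Rational as ℚ
import Data.Rational.Properties as ℚP
open import Data.Rational.Unnormalised using (mkℚᵘ)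
import Data.Rational.Unnormalised as ℚᵘ
import Data.Rational.Unnormalised.Properties as ℚᵘP

-- The obstacle to balance is the root of a piece: it must lie next to an image fixed earlier, so it
-- falls in neither class and is charged the full weight. Such charges are harmless only if the
-- average piece has of the order of a large constant h vertices; cutting at s₁ = h Δ leaves at most
-- 2 n / h pieces. Against this, the linearisation behind multiplicative weights needs |piece| log n
-- to be small compared with the free set. Both demands can be met when Δ(T) ≤ c n / log n. The
-- surplus α ≥ 2/k is spent in halves: the degree proportion is 1/2 + 2/k in G, 1/2 + 1/k survives
-- the absorber phase by mere counting, and afterwards the potential guarantees 1/2 + 1/(2k). Losing
-- the last half raises one load by a factor of at least 1 + 1/(6k) over what the potential allows,
-- so an exponent of order k log n makes that single term outweigh all n. Power sums instead of
-- exponentials keep every estimate in ℕ.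

-- Inequalities from semiring identities.

dec≤ : ∀ {a b} {_ : True (a ≤? b)} → a ≤ b
dec≤ {_} {_} {t} = toWitness t

-- Reduces an inequality to a semiring identity with an explicit slack.
cert : ∀ {a b l r} slack → l ≤ r → a + r + slack ≡ b + l → a ≤ b
cert {a} {b} {l} {r} sl l≤r eq = +-cancelʳ-≤ l a b (begin
  a + l        ≤⟨ +-monoʳ-≤ a l≤r ⟩
  a + r        ≤⟨ m≤m+n (a + r) sl ⟩
  a + r + sl   ≡⟨ eq ⟩
  b + l        ∎)
  where open ≤-Reasoning

≤-by : ∀ {a b} slack → a + slack ≡ b → a ≤ b
≤-by {a} sl eq = ≤-trans (m≤m+n a sl) (≤-reflexive eq)

*-left-comm : ∀ a b c → a * (b * c) ≡ b * (a * c)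
*-left-comm = solve-∀

+-left-comm : ∀ a b c → a + (b + c) ≡ b + (a + c)
+-left-comm = solve-∀

+-left-assoc : ∀ a b c → a + (b + c) ≡ b + a + c
+-left-assoc = solve-∀

*-pow : ∀ a b j → (a * b) ^ j ≡ a ^ j * b ^ j
*-pow a b zero = refl
*-pow a b (suc j) = trans (cong ((a * b) *_) (*-pow a b j)) (eq a b (a ^ j) (b ^ j))
  where
  eq : ∀ a b x y → (a * b) * (x * y) ≡ (a * x) * (b * y)
  eq = solve-∀

-- Finite sums

∑ : ∀ {A : Set} → List A → (A → ℕ) → ℕ
∑ [] f = 0
∑ (x ∷ xs) f = f x + ∑ xs f

∑-mono∈ : ∀ {A : Set} (xs : List A) {f g : A → ℕ} → (∀ x → x ∈ xs → f x ≤ g x) → ∑ xs f ≤ ∑ xs g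
∑-mono∈ [] le = z≤n
∑-mono∈ (x ∷ xs) le = +-mono-≤ (le x (here refl)) (∑-mono∈ xs (λ y y∈ → le y (there y∈)))

∑-mono : ∀ {A : Set} (xs : List A) {f g : A → ℕ} → (∀ x → f x ≤ g x) → ∑ xs f ≤ ∑ xs g
∑-mono xs le = ∑-mono∈ xs (λ x _ → le x)

∑-cong∈ : ∀ {A : Set} (xs : List A) {f g : A → ℕ} → (∀ x → x ∈ xs → f x ≡ g x) → ∑ xs f ≡ ∑ xs g
∑-cong∈ [] eq = refl
∑-cong∈ (x ∷ xs) eq = cong₂ _+_ (eq x (here refl)) (∑-cong∈ xs (λ y y∈ → eq y (there y∈)))

∑-cong : ∀ {A : Set} (xs : List A) {f g : A → ℕ} → (∀ x → f x ≡ g x) → ∑ xs f ≡ ∑ xs g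
∑-cong xs eq = ∑-cong∈ xs (λ x _ → eq x)

∑-0 : ∀ {A : Set} (xs : List A) → ∑ xs (λ _ → 0) ≡ 0
∑-0 [] = refl
∑-0 (x ∷ xs) = ∑-0 xs

private
  inter : ∀ a b c d → (a + b) + (c + d) ≡ (a + c) + (b + d)
  inter = solve-∀

∑-+ : ∀ {A : Set} (xs : List A) (f g : A → ℕ) → ∑ xs (λ x → f x + g x) ≡ ∑ xs f + ∑ xs g
∑-+ [] f g = refl
∑-+ (x ∷ xs) f g = trans (cong (f x + g x +_) (∑-+ xs f g)) (inter (f x) (g x) (∑ xs f) (∑ xs g))

∑-*ˡ : ∀ {A : Set} (xs : List A) c (f : A → ℕ) → ∑ xs (λ x → c * f x) ≡ c * ∑ xs f
∑-*ˡ [] c f = sym (*-zeroʳ c)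
∑-*ˡ (x ∷ xs) c f = trans (cong (c * f x +_) (∑-*ˡ xs c f)) (sym (*-distribˡ-+ c (f x) (∑ xs f)))

∑-*ʳ : ∀ {A : Set} (xs : List A) c (f : A → ℕ) → ∑ xs (λ x → f x * c) ≡ ∑ xs f * c
∑-*ʳ xs c f = trans (∑-cong xs (λ x → *-comm (f x) c)) (trans (∑-*ˡ xs c f) (*-comm c (∑ xs f)))

∑-const : ∀ {A : Set} (xs : List A) c → ∑ xs (λ _ → c) ≡ length xs * c
∑-const [] c = refl
∑-const (x ∷ xs) c = cong (c +_) (∑-const xs c)

∑-1 : ∀ {A : Set} (xs : List A) → ∑ xs (λ _ → 1) ≡ length xs
∑-1 xs = trans (∑-const xs 1) (*-identityʳ _)

∑-++ : ∀ {A : Set} (xs ys : List A) (f : A → ℕ) → ∑ (xs ++ ys) f ≡ ∑ xs f + ∑ ys f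
∑-++ [] ys f = refl
∑-++ (x ∷ xs) ys f = trans (cong (f x +_) (∑-++ xs ys f)) (sym (+-assoc (f x) _ _))

∑-swap : ∀ {A B : Set} (xs : List A) (ys : List B) (f : A → B → ℕ) →
  ∑ xs (λ x → ∑ ys (f x)) ≡ ∑ ys (λ y → ∑ xs (λ x → f x y))
∑-swap [] ys f = sym (∑-0 ys)
∑-swap (x ∷ xs) ys f = trans (cong (∑ ys (f x) +_) (∑-swap xs ys f)) (sym (∑-+ ys (f x) (λ y → ∑ xs (λ z → f z y))))

∑-≥ : ∀ {A : Set} {xs : List A} {x} (f : A → ℕ) → x ∈ xs → f x ≤ ∑ xs f
∑-≥ f (here refl) = m≤m+n _ _
∑-≥ f (there x∈) = ≤-trans (∑-≥ f x∈) (m≤n+m _ _)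

∑-<-∃ : ∀ {A : Set} (xs : List A) (f g : A → ℕ) → ∑ xs f < ∑ xs g → ∃ λ x → x ∈ xs × f x < g x
∑-<-∃ [] f g ()
∑-<-∃ (x ∷ xs) f g lt with f x <? g x
... | yes p = x , here refl , p
... | no ¬p =
  let y , y∈ , q = ∑-<-∃ xs f g (+-cancelˡ-< (g x) _ _ (≤-<-trans (+-monoˡ-≤ (∑ xs f) (≮⇒≥ ¬p)) lt))
  in y , there y∈ , q

-- Stands in for the first-moment method. Raising g by 1 makes the weighted comparison strict, which
-- is where the positive total weight enters.
∑-average : ∀ {A : Set} (xs : List A) (w f g : A → ℕ) → ∑ xs (λ x → w x * f x) ≤ ∑ xs (λ x → w x * g x) →
  0 < ∑ xs w → ∃ λ x → x ∈ xs × 0 < w x × f x ≤ g x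
∑-average xs w f g le pos
  with ∑-<-∃ xs (λ x → w x * f x) (λ x → w x * suc (g x)) (begin-strict
    ∑ xs (λ x → w x * f x)            ≤⟨ le ⟩
    ∑ xs (λ x → w x * g x)            <⟨ m<n+m _ pos ⟩
    ∑ xs w + ∑ xs (λ x → w x * g x)   ≡⟨ sym (∑-+ xs w _) ⟩
    ∑ xs (λ x → w x + w x * g x)      ≡⟨ ∑-cong xs (λ x → sym (*-suc (w x) (g x))) ⟩
    ∑ xs (λ x → w x * suc (g x))      ∎)
  where open ≤-Reasoning
... | x , x∈ , lt = x , x∈ , wpos , ≤-pred (*-cancelˡ-< (w x) _ _ lt)
  where
  wpos : 0 < w x
  wpos with w x
  ... | zero = ⊥-elim (n≮0 lt)
  ... | suc _ = s≤s z≤n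

-- Indicators and counting

⟦_⟧ : Bool → ℕ
⟦ true ⟧ = 1
⟦ false ⟧ = 0

⟦⟧≤1 : ∀ b → ⟦ b ⟧ ≤ 1
⟦⟧≤1 true = dec≤
⟦⟧≤1 false = dec≤

⟦∧⟧ : ∀ a b → ⟦ a ∧ b ⟧ ≡ ⟦ a ⟧ * ⟦ b ⟧
⟦∧⟧ true true = refl
⟦∧⟧ true false = refl
⟦∧⟧ false b = refl

⟦⟧-pos : ∀ {b} → 0 < ⟦ b ⟧ → b ≡ true
⟦⟧-pos {true} _ = refl

∧-l : ∀ {a b} → a ∧ b ≡ true → a ≡ true
∧-l {true} _ = refl

∧-r : ∀ {a b} → a ∧ b ≡ true → b ≡ true
∧-r {true} e = e

∧-i : ∀ {a b} → a ≡ true → b ≡ true → a ∧ b ≡ true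
∧-i refl refl = refl

⟦⟧-mono : ∀ {a b} → (a ≡ true → b ≡ true) → ⟦ a ⟧ ≤ ⟦ b ⟧
⟦⟧-mono {false} f = z≤n
⟦⟧-mono {true} f rewrite f refl = ≤-refl

# : ∀ {n} → (Fin n → Bool) → ℕ
# {n} P = ∑ (allFin n) (λ u → ⟦ P u ⟧)

#-∃ : ∀ {n} (P : Fin n → Bool) → 0 < # P → ∃ λ u → P u ≡ true
#-∃ {n} P pos with ∑-<-∃ (allFin n) (λ _ → 0) (λ u → ⟦ P u ⟧) (subst (_< # P) (sym (∑-0 (allFin n))) pos)
... | u , _ , lt = u , ⟦⟧-pos lt

#-mono : ∀ {n} {P Q : Fin n → Bool} → (∀ u → P u ≡ true → Q u ≡ true) → # P ≤ # Q
#-mono {n} i = ∑-mono (allFin n) (λ u → ⟦⟧-mono (i u))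

length-allFin : ∀ n → length (allFin n) ≡ n
length-allFin n = length-tabulate {n = n} id

_==_ : ∀ {n} → Fin n → Fin n → Bool
u == w = ⌊ u FinP.≟ w ⌋

==-refl : ∀ {n} (u : Fin n) → (u == u) ≡ true
==-refl u with u FinP.≟ u
... | yes _ = refl
... | no ne = ⊥-elim (ne refl)

==-≢ : ∀ {n} {u w : Fin n} → u ≢ w → (u == w) ≡ false
==-≢ {_} {u} {w} ne with u FinP.≟ w
... | yes e = ⊥-elim (ne e)
... | no _ = refl

==⇒≡ : ∀ {n} {u w : Fin n} → (u == w) ≡ true → u ≡ w
==⇒≡ {_} {u} {w} e with u FinP.≟ w
... | yes p = p
==⇒≡ {_} {u} {w} () | no _

∑-δ∉ : ∀ {n} (xs : List (Fin n)) w (f : Fin n → ℕ) → w ∉ xs → ∑ xs (λ u → ⟦ u == w ⟧ * f u) ≡ 0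
∑-δ∉ [] w f _ = refl
∑-δ∉ (x ∷ xs) w f w∉ rewrite ==-≢ {u = x} {w} (λ e → w∉ (here (sym e))) = ∑-δ∉ xs w f (w∉ ∘ there)

∑-δ : ∀ {n} {xs : List (Fin n)} {w} (f : Fin n → ℕ) → Unique xs → w ∈ xs → ∑ xs (λ u → ⟦ u == w ⟧ * f u) ≡ f w
∑-δ {xs = x ∷ xs} f (x≢ ∷ un) (here refl) rewrite ==-refl x =
  trans (cong (f x + 0 +_) (∑-δ∉ xs x f (λ x∈ → All.lookup x≢ x∈ refl))) (trans (+-identityʳ _) (+-identityʳ _))
∑-δ {xs = x ∷ xs} {w} f (x≢ ∷ un) (there w∈) rewrite ==-≢ {u = x} {w} (All.lookup x≢ w∈) = ∑-δ f un w∈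

∑-δ-all : ∀ {n} w (f : Fin n → ℕ) → ∑ (allFin n) (λ u → ⟦ u == w ⟧ * f u) ≡ f w
∑-δ-all {n} w f = ∑-δ f (allFin⁺ n) (∈-allFin w)

_⊖_ : ∀ {n} → (Fin n → Bool) → Fin n → Fin n → Bool
(P ⊖ w) u = P u ∧ not (u == w)

∑-⊖ : ∀ {n} (P : Fin n → Bool) w → P w ≡ true → (f : Fin n → ℕ) →
  ∑ (allFin n) (λ u → ⟦ P u ⟧ * f u) ≡ f w + ∑ (allFin n) (λ u → ⟦ (P ⊖ w) u ⟧ * f u)
∑-⊖ {n} P w Pw f = trans (∑-cong (allFin n) pt)
  (trans (∑-+ (allFin n) (λ u → ⟦ u == w ⟧ * f u) _) (cong (_+ ∑ (allFin n) (λ u → ⟦ (P ⊖ w) u ⟧ * f u)) (∑-δ-all w f)))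
  where
  pt : ∀ u → ⟦ P u ⟧ * f u ≡ ⟦ u == w ⟧ * f u + ⟦ (P ⊖ w) u ⟧ * f u
  pt u with u FinP.≟ w
  ... | yes refl rewrite Pw = sym (+-identityʳ _)
  ... | no _ with P u
  ... | true = refl
  ... | false = refl

#-⊖ : ∀ {n} (P : Fin n → Bool) w → P w ≡ true → # P ≡ suc (# (P ⊖ w))
#-⊖ {n} P w Pw = trans (∑-cong (allFin n) (λ u → sym (*-identityʳ ⟦ P u ⟧)))
  (trans (∑-⊖ P w Pw (λ _ → 1)) (cong suc (∑-cong (allFin n) (λ u → *-identityʳ _))))

-- Multiplicative weights

-- With x = D / (C + D) this is (1 - x)^j ≤ 1 - (c/(c+1)) j x. In the induction step the quadratic
-- term (c/(c+1)) j x² is paid by the share 1/(c+1) given away in the linear term, as c j x ≤ 1.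
pow-upper : ∀ c C D j → suc c * j * D ≤ C + D →
  suc c * C ^ j * (C + D) + c * j * D * (C + D) ^ j ≤ suc c * (C + D) ^ suc j
pow-upper c C D zero h = ≤-reflexive (eq c (C + D))
  where
  eq : ∀ c B → (1 + c) * 1 * B + c * 0 * D * 1 ≡ (1 + c) * (B * 1)
  eq = solve-∀
pow-upper c C D (suc j) h = cert (D * (C + D) ^ j * t) (*-monoˡ-≤ C ih)
  (+-cancelʳ-≡ (D * (C + D) ^ j * (c * j * D)) _ _ (begin-equality
    a + r + D * y * t + D * y * (c * j * D)   ≡⟨ regroup (a + r) (D * y) t (c * j * D) ⟩
    a + r + D * y * (c * j * D + t)           ≡⟨ cong (λ z → a + r + D * y * z) (sym tEq) ⟩
    a + r + D * y * (C + D)                   ≡⟨ expand c C D j (C ^ j) y ⟩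
    _                                         ∎))
  where
  open ≤-Reasoning
  y t a r : ℕ
  y = (C + D) ^ j
  t = (C + D) ∸ c * j * D
  a = suc c * (C * C ^ j) * (C + D) + c * suc j * D * ((C + D) * y)
  r = suc c * ((C + D) * y) * C
  tEq : C + D ≡ c * j * D + t
  tEq = sym (m+[n∸m]≡n (≤-trans (*-monoˡ-≤ D (*-mono-≤ (n≤1+n c) (n≤1+n j))) h))
  ih : suc c * C ^ j * (C + D) + c * j * D * y ≤ suc c * ((C + D) * y)
  ih = pow-upper c C D j (≤-trans (*-monoˡ-≤ D (*-monoʳ-≤ (suc c) (n≤1+n j))) h)
  regroup : ∀ a b t z → a + b * t + b * z ≡ a + b * (z + t)
  regroup = solve-∀
  expand : ∀ c C D j x y →
    (1 + c) * (C * x) * (C + D) + c * (1 + j) * D * ((C + D) * y) + (1 + c) * ((C + D) * y) * C + D * y * (C + D)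
    ≡ (1 + c) * ((C + D) * ((C + D) * y)) + ((1 + c) * x * (C + D) + c * j * D * y) * C + D * y * (c * j * D)
  expand = solve-∀

pow-upper′ : ∀ c C D j → suc c * suc j * D ≤ C + D →
  suc c * C ^ suc j + c * suc j * D * (C + D) ^ j ≤ suc c * (C + D) ^ suc j
pow-upper′ c zero zero j h = ≤-reflexive (eq c (suc j) (0 ^ j))
  where
  eq : ∀ c i x → (1 + c) * 0 + c * i * 0 * x ≡ (1 + c) * 0
  eq = solve-∀
pow-upper′ c (suc C) D j h = *-cancelʳ-≤ _ _ (suc C + D) (≤-trans
  (≤-reflexive (eq c (suc C ^ suc j) (suc j) D (suc C + D) ((suc C + D) ^ j)))
  (≤-trans (pow-upper c (suc C) D (suc j) h) (≤-reflexive (eq₂ (suc c) (suc C + D) ((suc C + D) ^ suc j)))))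
  where
  eq : ∀ c x i D B y → ((1 + c) * x + c * i * D * y) * B ≡ (1 + c) * x * B + c * i * D * (B * y)
  eq = solve-∀
  eq₂ : ∀ c B y → c * (B * y) ≡ c * y * B
  eq₂ = solve-∀
pow-upper′ c zero (suc D) j h = *-cancelʳ-≤ _ _ (suc D) (≤-trans
  (≤-reflexive (eq c (0 ^ suc j) (suc j) (suc D) (suc D ^ j)))
  (≤-trans (pow-upper c 0 (suc D) (suc j) h) (≤-reflexive (eq₂ (suc c) (suc D) (suc D ^ suc j)))))
  where
  eq : ∀ c x i D y → ((1 + c) * x + c * i * D * y) * D ≡ (1 + c) * x * D + c * i * D * (D * y)
  eq = solve-∀
  eq₂ : ∀ c B y → c * (B * y) ≡ c * y * B
  eq₂ = solve-∀

bernoulli : ∀ Y x j → (Y + x) ^ suc j ≤ Y ^ suc j + suc j * x * (Y + x) ^ j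
bernoulli Y x zero = ≤-reflexive (eq Y x)
  where
  eq : ∀ Y x → (Y + x) * 1 ≡ Y * 1 + 1 * x * 1
  eq = solve-∀
bernoulli Y x (suc j) = cert (suc j * x * x * P) (*-monoʳ-≤ Y (bernoulli Y x j)) (eq Y x j P (Y ^ suc j))
  where
  P = (Y + x) ^ j
  eq : ∀ Y x j P Q → (Y + x) * ((Y + x) * P) + Y * (Q + (1 + j) * x * P) + (1 + j) * x * x * P
    ≡ Y * Q + (2 + j) * x * ((Y + x) * P) + Y * ((Y + x) * P)
  eq = solve-∀

-- `pow-upper′` linearises each term, so the sum falls at least by the factor 1 - (j+1) c p / ((c+1)
-- q), and `bernoulli` turns this factor back into a (j+1)-st power. The sum thus behaves as if
-- every base had shrunk by the factor Y / ((c+1) q), although only the average of `D i` with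
-- weights `(C i + D i) ^ j` is controlled.
multiplicative-weights : ∀ {A : Set} (is : List A) (C D : A → ℕ) c j p q Y →
  (∀ i → suc c * suc j * D i ≤ C i + D i) →
  p * ∑ is (λ i → (C i + D i) ^ suc j) ≤ q * ∑ is (λ i → D i * (C i + D i) ^ j) →
  Y + c * p ≡ suc c * q →
  (suc c * q) ^ suc j * ∑ is (λ i → C i ^ suc j) ≤ Y ^ suc j * ∑ is (λ i → (C i + D i) ^ suc j)
multiplicative-weights is C D c j p q Y small avg YEq =
  +-cancelʳ-≤ (suc j * x * X ^ j * Φ) _ _ (begin
    X ^ suc j * Φ′ + suc j * x * X ^ j * Φ     ≡⟨ e₁ (X ^ j) (suc c) q Φ′ (suc j) c p Φ ⟩
    X ^ j * (q * (suc c * Φ′) + c * suc j * (p * Φ)) ≤⟨ *-monoʳ-≤ (X ^ j) (+-monoʳ-≤ (q * (suc c * Φ′)) (*-monoʳ-≤ (c * suc j) avg)) ⟩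
    X ^ j * (q * (suc c * Φ′) + c * suc j * (q * W)) ≡⟨ e₂ (X ^ j) q (suc c * Φ′) (c * suc j) W ⟩
    X ^ j * (q * (suc c * Φ′ + c * suc j * W)) ≤⟨ *-monoʳ-≤ (X ^ j) (*-monoʳ-≤ q total) ⟩
    X ^ j * (q * (suc c * Φ))                  ≡⟨ e₃ (X ^ j) q (suc c) Φ ⟩
    X ^ suc j * Φ                              ≤⟨ *-monoˡ-≤ Φ (subst (λ z → z ^ suc j ≤ Y ^ suc j + suc j * x * z ^ j) YEq (bernoulli Y x j)) ⟩
    (Y ^ suc j + suc j * x * X ^ j) * Φ        ≡⟨ *-distribʳ-+ Φ (Y ^ suc j) _ ⟩
    Y ^ suc j * Φ + suc j * x * X ^ j * Φ      ∎)
  where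
  open ≤-Reasoning
  x X Φ Φ′ W : ℕ
  x = c * p
  X = suc c * q
  Φ = ∑ is (λ i → (C i + D i) ^ suc j)
  Φ′ = ∑ is (λ i → C i ^ suc j)
  W = ∑ is (λ i → D i * (C i + D i) ^ j)
  e₁ : ∀ P L q f J c p F → L * q * P * f + J * (c * p) * P * F ≡ P * (q * (L * f) + c * J * (p * F))
  e₁ = solve-∀
  e₂ : ∀ P q a b w → P * (q * a + b * (q * w)) ≡ P * (q * (a + b * w))
  e₂ = solve-∀
  e₃ : ∀ P q L F → P * (q * (L * F)) ≡ L * q * P * F
  e₃ = solve-∀
  total : suc c * Φ′ + c * suc j * W ≤ suc c * Φ
  total = begin
    suc c * Φ′ + c * suc j * W ≡⟨ cong₂ _+_ (sym (∑-*ˡ is (suc c) _)) (sym (∑-*ˡ is (c * suc j) _)) ⟩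
    ∑ is (λ i → suc c * C i ^ suc j) + ∑ is (λ i → c * suc j * (D i * (C i + D i) ^ j)) ≡⟨ sym (∑-+ is _ _) ⟩
    ∑ is (λ i → suc c * C i ^ suc j + c * suc j * (D i * (C i + D i) ^ j))
      ≤⟨ ∑-mono is (λ i → subst (λ z → suc c * C i ^ suc j + z ≤ suc c * (C i + D i) ^ suc j) (*-assoc (c * suc j) (D i) _) (pow-upper′ c (C i) (D i) j (small i))) ⟩
    ∑ is (λ i → suc c * (C i + D i) ^ suc j) ≡⟨ ∑-*ˡ is (suc c) _ ⟩
    suc c * Φ ∎

pow-lower : ∀ L i → L ^ i * (L + i) ≤ suc L ^ i * L
pow-lower L zero = ≤-reflexive (cong (1 *_) (+-identityʳ L))
pow-lower L (suc i) = cert (L ^ i * i) (*-monoʳ-≤ (suc L) (pow-lower L i)) (eq L i (L ^ i) (suc L ^ i))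
  where
  eq : ∀ L i x y → L * x * (L + (1 + i)) + (1 + L) * (y * L) + x * i ≡ (1 + L) * y * L + (1 + L) * (x * (L + i))
  eq = solve-∀

double-pow : ∀ L j → .{{_ : NonZero L}} → 2 ^ j * L ^ (L * j) ≤ suc L ^ (L * j)
double-pow L j = subst₂ (λ a b → 2 ^ j * a ≤ b) (^-*-assoc L L j) (^-*-assoc (suc L) L j)
  (≤-trans (≤-reflexive (sym (*-pow 2 (L ^ L) j))) (^-monoˡ-≤ j
    (*-cancelʳ-≤ _ _ L (≤-trans (≤-reflexive (eq (L ^ L) L)) (pow-lower L L)))))
  where
  eq : ∀ x L → 2 * x * L ≡ x * (L + L)
  eq = solve-∀

-- Quantiles of a cost function.

least : ∀ {P : ℕ → Set} → (∀ i → Dec (P i)) → ∀ N → P N → ∃ λ τ → P τ × (∀ σ → σ < τ → ¬ P σ)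
least P? N pN with P? 0
... | yes p₀ = 0 , p₀ , λ σ ()
least P? zero pN | no ¬p₀ = ⊥-elim (¬p₀ pN)
least P? (suc N) pN | no ¬p₀ with least (λ i → P? (suc i)) N pN
... | τ , pτ , below = suc τ , pτ , λ { zero _ → ¬p₀ ; (suc σ) (s≤s lt) → below σ lt }

≤ᵇ-true : ∀ {a b} → a ≤ b → (a ≤ᵇ b) ≡ true
≤ᵇ-true {a} {b} le with a ≤ᵇ b | ≤⇒≤ᵇ le
... | true | _ = refl

≤ᵇ-≤ : ∀ {a b} → (a ≤ᵇ b) ≡ true → a ≤ b
≤ᵇ-≤ {a} {b} e = ≤ᵇ⇒≤ a b (subst T (sym e) _)

≤ᵇ-> : ∀ {a b} → (a ≤ᵇ b) ≡ false → b < a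
≤ᵇ-> {a} {b} e with a ≤? b
... | yes le = case trans (sym (≤ᵇ-true le)) e of λ ()
... | no ¬le = ≰⇒> ¬le

<ᵇ-true : ∀ {a b} → a < b → (a <ᵇ b) ≡ true
<ᵇ-true {a} {b} lt with a <ᵇ b | <⇒<ᵇ lt
... | true | _ = refl

<ᵇ-suc : ∀ a b → (a <ᵇ suc b) ≡ (a ≤ᵇ b)
<ᵇ-suc zero b = refl
<ᵇ-suc (suc a) b = refl

module _ {n : ℕ} where

  private
    V : List (Fin n)
    V = allFin n

  atMost below : (Fin n → Bool) → (Fin n → ℕ) → ℕ → Fin n → Bool
  atMost U g τ u = U u ∧ (g u ≤ᵇ τ)
  below U g τ u = U u ∧ (g u <ᵇ τ)

  -- Ties can push the count at τ far above r, so the strictly cheaper points are bounded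
  -- separately; it is their number that `low-sum` consumes.
  quantile : ∀ U (g : Fin n → ℕ) r → 1 ≤ r → r ≤ # U →
    ∃ λ τ → r ≤ # (atMost U g τ) × # (below U g τ) < r
  -- `∑ V g` exceeds no single value from below, so it bounds the search for the least threshold.
  quantile U g r 1≤r r≤ with least (λ τ → r ≤? # (atMost U g τ)) (∑ V g)
    (≤-trans r≤ (#-mono (λ u Uu → ∧-i Uu (≤ᵇ-true (∑-≥ g (∈-allFin u))))))
  ... | τ , le , min = τ , le , small τ min
    where
    small : ∀ τ → (∀ σ → σ < τ → ¬ (r ≤ # (atMost U g σ))) → # (below U g τ) < r
    small zero _ = ≤-trans (s≤s (≤-reflexive (trans (∑-cong V (λ u → cong ⟦_⟧ (∧-zeroʳ (U u)))) (∑-0 V)))) 1≤r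
    small (suc σ) m = ≤-<-trans
      (≤-reflexive (∑-cong V (λ u → cong (λ b → ⟦ U u ∧ b ⟧) (<ᵇ-suc (g u) σ)))) (≰⇒> (m σ ≤-refl))

  private
    low-bound : ∀ b g τ δ → (τ + δ) * ⟦ b ⟧ ≤ ⟦ b ⟧ * g + (τ * ⟦ b ∧ (g <ᵇ τ) ⟧ + δ * ⟦ b ∧ (g <ᵇ τ + δ) ⟧)
    low-bound false g τ δ = ≤-trans (≤-reflexive (*-zeroʳ (τ + δ))) z≤n
    low-bound true g τ δ with g <ᵇ τ in e₁ | g <ᵇ τ + δ in e₂
    ... | true | true = ≤-by g (eq g τ δ)
      where
      eq : ∀ g τ δ → (τ + δ) * 1 + g ≡ 1 * g + (τ * 1 + δ * 1)
      eq = solve-∀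
    ... | true | false = ⊥-elim (<⇒≱ (<ᵇ⇒< g τ (subst T (sym e₁) _)) (≤-trans (m≤m+n τ δ) (≮⇒≥ (λ lt → case trans (sym e₂) (<ᵇ-true lt) of λ ()))))
    ... | false | true = cert 0 (≮⇒≥ (λ lt → case trans (sym e₁) (<ᵇ-true lt) of λ ())) (eq g τ δ)
      where
      eq : ∀ g τ δ → (τ + δ) * 1 + g + 0 ≡ 1 * g + (τ * 0 + δ * 1) + τ
      eq = solve-∀
    ... | false | false = cert 0 (≮⇒≥ (λ lt → case trans (sym e₂) (<ᵇ-true lt) of λ ())) (eq g τ δ)
      where
      eq : ∀ g τ δ → (τ + δ) * 1 + g + 0 ≡ 1 * g + (τ * 0 + δ * 0) + (τ + δ)
      eq = solve-∀

  -- g is at least τ off the lowest r₁ points and at least τ + δ off the lowest half.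
  low-sum : ∀ U (g : Fin n → ℕ) τ δ →
    (τ + δ) * # U ≤ ∑ V (λ u → ⟦ U u ⟧ * g u) + (τ * # (below U g τ) + δ * # (below U g (τ + δ)))
  low-sum U g τ δ = begin
    (τ + δ) * # U ≡⟨ sym (∑-*ˡ V (τ + δ) _) ⟩
    ∑ V (λ u → (τ + δ) * ⟦ U u ⟧) ≤⟨ ∑-mono V (λ u → low-bound (U u) (g u) τ δ) ⟩
    ∑ V (λ u → ⟦ U u ⟧ * g u + (τ * ⟦ below U g τ u ⟧ + δ * ⟦ below U g (τ + δ) u ⟧)) ≡⟨ ∑-+ V _ _ ⟩
    ∑ V (λ u → ⟦ U u ⟧ * g u) + ∑ V (λ u → τ * ⟦ below U g τ u ⟧ + δ * ⟦ below U g (τ + δ) u ⟧)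
      ≡⟨ cong (∑ V (λ u → ⟦ U u ⟧ * g u) +_) (trans (∑-+ V _ _) (cong₂ _+_ (∑-*ˡ V τ _) (∑-*ˡ V δ _))) ⟩
    _ ∎
    where open ≤-Reasoning

  -- At most m/(2h) points lie below τ₁ and at most m/2 below τ₂ = τ₁ + δ, so `low-sum` gives 2 h m
  -- τ₂ ≤ 2 h Γ + m τ₁ + h m δ. As m τ₁ ≤ 2 Γ, the mean of the two thresholds is at most 1 + 1/h
  -- times the average Γ / m.
  two-thresholds : ∀ U (g : Fin n → ℕ) h r₁ r₂ → 1 ≤ r₁ → 1 ≤ h → 2 * h * r₁ ≤ # U → 2 * r₂ ≤ suc (# U) → # U ≤ 2 * r₂ →
    ∃ λ τ₁ → ∃ λ τ₂ → τ₁ ≤ τ₂ × r₁ ≤ # (atMost U g τ₁) × r₂ ≤ # (atMost U g τ₂) ×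
      h * # U * (τ₁ + τ₂) ≤ 2 * suc h * ∑ V (λ u → ⟦ U u ⟧ * g u)
  two-thresholds U g h r₁ r₂ 1≤r₁ 1≤h hr₁ r₂≤ ≤r₂ with
      quantile U g r₁ 1≤r₁ (≤-trans (m≤m+n r₁ _) (≤-trans (≤-trans (*-monoˡ-≤ r₁ (≤-trans 1≤h (m≤m+n h _))) ≤-refl) hr₁)) |
      quantile U g r₂ 1≤r₂ r₂≤m
    where
    1≤m : 1 ≤ # U
    1≤m = ≤-trans (*-mono-≤ {1} {2 * h} (≤-trans 1≤h (m≤m+n h _)) 1≤r₁) hr₁
    1≤r₂ : 1 ≤ r₂
    1≤r₂ = n≢0⇒n>0 λ { refl → n≮0 (≤-trans 1≤m ≤r₂) }
    r₂≤m : r₂ ≤ # U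
    r₂≤m = *-cancelˡ-≤ 2 (≤-trans r₂≤ (≤-trans (+-monoˡ-≤ (# U) 1≤m) (≤-reflexive (cong (# U +_) (sym (+-identityʳ _))))))
  ... | τ₁ , a₁ , b₁ | τ₂ , a₂ , b₂ = τ₁ , τ₂ , τ≤ , a₁ , a₂ , final
    where
    m Γ L₁ L₂ δ : ℕ
    m = # U
    Γ = ∑ V (λ u → ⟦ U u ⟧ * g u)
    r₁≤r₂ : r₁ ≤ r₂
    r₁≤r₂ = *-cancelˡ-≤ 2 (≤-trans (≤-trans (*-monoˡ-≤ r₁ (*-monoʳ-≤ 2 1≤h)) hr₁) ≤r₂)
    τ≤ : τ₁ ≤ τ₂
    τ≤ = ≮⇒≥ λ lt → <⇒≱ b₁ (≤-trans r₁≤r₂ (≤-trans a₂ (#-mono (λ u p →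
      ∧-i (∧-l p) (<ᵇ-true (≤-<-trans (≤ᵇ-≤ {g u} (∧-r {U u} p)) lt))))))
    L₁ = # (below U g τ₁)
    L₂ = # (below U g τ₂)
    δ = τ₂ ∸ τ₁
    τδ : τ₁ + δ ≡ τ₂
    τδ = m+[n∸m]≡n τ≤
    s₂ : (τ₁ + δ) * m ≤ Γ + (τ₁ * L₁ + δ * L₂)
    s₂ = subst (λ z → (τ₁ + δ) * m ≤ Γ + (τ₁ * L₁ + δ * # (below U g z))) τδ (low-sum U g τ₁ δ)
    s₁ : τ₁ * m ≤ Γ + τ₁ * L₁
    s₁ = subst₂ _≤_ (cong (_* m) (+-identityʳ τ₁)) (cong (Γ +_) (+-identityʳ _)) (low-sum U g τ₁ 0)
    l₁ : 2 * h * L₁ ≤ m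
    l₁ = ≤-trans (*-monoʳ-≤ (2 * h) (<⇒≤ b₁)) hr₁
    l₂ : 2 * L₂ ≤ m
    l₂ = ≤-pred (≤-pred (≤-trans (≤-reflexive (eq L₂)) (≤-trans (*-monoʳ-≤ 2 b₂) (≤-trans r₂≤ (n≤1+n _)))))
      where
      eq : ∀ x → 2 + (2 * x) ≡ 2 * (1 + x)
      eq = solve-∀
    l₁′ : 2 * L₁ ≤ m
    l₁′ = ≤-trans (*-monoˡ-≤ L₁ (*-monoʳ-≤ 2 1≤h)) l₁
    twoΓ : τ₁ * m ≤ 2 * Γ
    twoΓ = cert 0 (+-mono-≤ (*-monoʳ-≤ 2 s₁) (*-monoʳ-≤ τ₁ l₁′)) (eq τ₁ m Γ L₁)
      where
      eq : ∀ τ m Γ L → τ * m + (2 * (Γ + τ * L) + τ * m) + 0 ≡ 2 * Γ + (2 * (τ * m) + τ * (2 * L))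
      eq = solve-∀
    final : h * m * (τ₁ + τ₂) ≤ 2 * suc h * Γ
    final = subst (λ z → h * m * (τ₁ + z) ≤ 2 * suc h * Γ) τδ
      (cert 0 (+-mono-≤ (*-monoʳ-≤ (2 * h) s₂) (+-mono-≤ (*-monoʳ-≤ τ₁ l₁) (+-mono-≤ (*-monoʳ-≤ (h * δ) l₂) twoΓ)))
        (eq h m τ₁ δ Γ L₁ L₂))
      where
      eq : ∀ h m τ δ Γ L₁ L₂ →
        h * m * (τ + (τ + δ)) + (2 * h * (Γ + (τ * L₁ + δ * L₂)) + (τ * m + (h * δ * m + 2 * Γ))) + 0 ≡
        2 * (1 + h) * Γ + (2 * h * ((τ + δ) * m) + (τ * (2 * h * L₁) + (h * δ * (2 * L₂) + τ * m)))
      eq = solve-∀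

  -- Bipartite edge counts, cores of large minimum degree, common neighbours.

  module Graphs (e : Fin n → Fin n → Bool) (e-sym : ∀ u v → e u v ≡ e v u) where

    N∩ : (Fin n → Bool) → Fin n → Fin n → Bool
    N∩ U v u = U u ∧ e v u

    edges : (A B : Fin n → Bool) → ℕ
    edges A B = ∑ V (λ a → ⟦ A a ⟧ * # (N∩ B a))

    edges-comm : ∀ A B → edges A B ≡ edges B A
    edges-comm A B = trans (pull A B) (trans (∑-swap V V _)
      (trans (∑-cong V (λ b → ∑-cong V (λ a → pt (A a) (B b) (e-sym a b)))) (sym (pull B A))))
      where
      pull : ∀ A B → edges A B ≡ ∑ V (λ a → ∑ V (λ b → ⟦ A a ⟧ * ⟦ B b ∧ e a b ⟧))
      pull A B = ∑-cong V (λ a → sym (∑-*ˡ V ⟦ A a ⟧ _))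
      pt : ∀ x y {z w} → z ≡ w → ⟦ x ⟧ * ⟦ y ∧ z ⟧ ≡ ⟦ y ⟧ * ⟦ x ∧ w ⟧
      pt true true refl = refl
      pt true false refl = refl
      pt false true refl = refl
      pt false false refl = refl

    Rich : ℕ → (A B : Fin n → Bool) → Set
    Rich d A B = ∀ a → A a ≡ true → d < # (N∩ B a)

    poor? : ∀ d A B → (∃ λ a → A a ≡ true × # (N∩ B a) ≤ d) ⊎ Rich d A B
    poor? d A B with FinP.any? (λ a → ok (A a) (# (N∩ B a) ≤? d))
      where
      ok : ∀ b {P : Set} → Dec P → Dec (b ≡ true × P)
      ok true (yes p) = yes (refl , p)
      ok true (no ¬p) = no (¬p ∘ proj₂)
      ok false _ = no λ ()
    ... | yes p = inj₁ p
    ... | no ¬p = inj₂ (λ a Aa → ≰⇒> (λ le → ¬p (a , Aa , le)))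

    private
      drop : ∀ d A B a → A a ≡ true → # (N∩ B a) ≤ d → d * (# A + # B) < edges A B →
        d * (# (A ⊖ a) + # B) < edges (A ⊖ a) B
      drop d A B a Aa le lt = +-cancelˡ-< d _ _ (begin-strict
        d + d * (# (A ⊖ a) + # B) ≡⟨ sym (*-suc d _) ⟩
        d * (suc (# (A ⊖ a)) + # B) ≡⟨ cong (λ z → d * (z + # B)) (sym (#-⊖ A a Aa)) ⟩
        d * (# A + # B) <⟨ lt ⟩
        edges A B ≡⟨ ∑-⊖ A a Aa _ ⟩
        # (N∩ B a) + edges (A ⊖ a) B ≤⟨ +-monoˡ-≤ _ le ⟩
        d + edges (A ⊖ a) B ∎)
        where open ≤-Reasoning

      edges-pos : ∀ A B → 0 < edges A B → 0 < # A
      edges-pos A B pos with ∑-<-∃ V (λ _ → 0) (λ a → ⟦ A a ⟧ * # (N∩ B a)) (subst (_< edges A B) (sym (∑-0 V)) pos)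
      ... | a , _ , lt with A a in eq
      ... | true = ≤-trans (≤-reflexive (cong ⟦_⟧ (sym eq))) (∑-≥ (λ u → ⟦ A u ⟧) (∈-allFin a))
      ... | false = ⊥-elim (n≮0 lt)

    Sub : (A B : Fin n → Bool) → Set
    Sub A B = ∀ u → A u ≡ true → B u ≡ true

    -- Deleting a vertex with at most d neighbours on the other side lowers d (|A| + |B|) by d and
    -- the edge count by at most d. The strict inequality therefore survives every deletion, and it
    -- excludes an empty outcome.
    rich-core : ∀ fuel d A B → # A + # B ≤ fuel → d * (# A + # B) < edges A B →
      ∃ λ A′ → ∃ λ B′ → Sub A′ A × Sub B′ B × Rich d A′ B′ × Rich d B′ A′ × 0 < # A′ × 0 < # B′
    rich-core fuel d A B le lt with poor? d A B | poor? d B A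
    ... | inj₂ rA | inj₂ rB = A , B , (λ _ p → p) , (λ _ p → p) , rA , rB ,
      edges-pos A B (≤-<-trans z≤n lt) , edges-pos B A (subst (0 <_) (edges-comm A B) (≤-<-trans z≤n lt))
    rich-core zero d A B le lt | inj₁ (a , Aa , _) | _ = ⊥-elim (n≮0 (≤-trans (≤-reflexive (sym (#-⊖ A a Aa))) (≤-trans (m≤m+n _ _) le)))
    rich-core zero d A B le lt | inj₂ _ | inj₁ (b , Bb , _) = ⊥-elim (n≮0 (≤-trans (≤-reflexive (sym (#-⊖ B b Bb))) (≤-trans (m≤n+m _ (# A)) le)))
    rich-core (suc fuel) d A B le lt | inj₁ (a , Aa , p) | _
      with rich-core fuel d (A ⊖ a) B (≤-pred (subst (λ z → z + # B ≤ suc fuel) (#-⊖ A a Aa) le)) (drop d A B a Aa p lt)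
    ... | A′ , B′ , s₁ , s₂ , rest = A′ , B′ , (λ u q → ∧-l (s₁ u q)) , s₂ , rest
    rich-core (suc fuel) d A B le lt | inj₂ _ | inj₁ (b , Bb , p)
      with rich-core fuel d A (B ⊖ b)
        (≤-pred (subst (_≤ suc fuel) (trans (cong (# A +_) (#-⊖ B b Bb)) (+-suc (# A) _)) le))
        (subst₂ _<_ (cong (d *_) (+-comm (# (B ⊖ b)) (# A))) (edges-comm (B ⊖ b) A)
          (drop d B A b Bb p (subst₂ _<_ (cong (d *_) (+-comm (# A) (# B))) (edges-comm A B) lt)))
    ... | A′ , B′ , s₁ , s₂ , rest = A′ , B′ , s₁ , (λ u q → ∧-l (s₂ u q)) , rest

    -- Every vertex sees at least a proportion 1/2 + 1/(2k) of U.
    Dense : ℕ → (Fin n → Bool) → Set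
    Dense k U = ∀ v → suc k * # U ≤ 2 * k * # (N∩ U v)

    -- Inclusion-exclusion inside U: 2 (1/2 + 1/(2k)) - 1 = 1/k.
    common-neighbours : ∀ k U → Dense k U → ∀ v w → # U ≤ k * # (N∩ (N∩ U v) w)
    common-neighbours k U dense v w = *-cancelˡ-≤ 2 (cert 0
      (+-mono-≤ (dense v) (+-mono-≤ (dense w) (*-monoʳ-≤ (2 * k) incl))) (eq k (# U) (# (N∩ U v)) (# (N∩ U w)) (# (N∩ (N∩ U v) w))))
      where
      pt : ∀ a b c → ⟦ a ∧ b ⟧ + ⟦ a ∧ c ⟧ ≤ ⟦ a ⟧ + ⟦ (a ∧ b) ∧ c ⟧
      pt true true true = dec≤
      pt true true false = dec≤
      pt true false true = dec≤
      pt true false false = dec≤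
      pt false _ _ = dec≤
      incl : # (N∩ U v) + # (N∩ U w) ≤ # U + # (N∩ (N∩ U v) w)
      incl = ≤-trans (≤-reflexive (sym (∑-+ V _ _))) (≤-trans (∑-mono V (λ u → pt (U u) (e v u) (e w u))) (≤-reflexive (∑-+ V _ _)))
      eq : ∀ k m x y z → 2 * m + (2 * k * x + (2 * k * y + 2 * k * (m + z))) + 0
        ≡ 2 * (k * z) + ((1 + k) * m + ((1 + k) * m + 2 * k * (x + y)))
      eq = solve-∀

-- Updates of maps, fresh lists and Boolean bookkeeping.

upd : ∀ {n} {X : Set} → (Fin n → X) → Fin n → X → Fin n → X
upd φ x w y = if y == x then w else φ y

upd-same : ∀ {n} {X : Set} (φ : Fin n → X) x w → upd φ x w x ≡ w
upd-same φ x w rewrite ==-refl x = refl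

upd-other : ∀ {n} {X : Set} (φ : Fin n → X) {x y} w → y ≢ x → upd φ x w y ≡ φ y
upd-other φ {x} {y} w ne rewrite ==-≢ ne = refl

_∈?_ : ∀ {n} (x : Fin n) xs → Dec (x ∈ xs)
_∈?_ = DecMembership._∈?_ FinP._≟_

∈≢ : ∀ {A : Set} {x y : A} {D} → y ∈ D → x ∉ D → y ≢ x
∈≢ y∈ x∉ refl = x∉ y∈

-- Freshness against a growing accumulator mirrors placement one vertex at a time, which turns the
-- domain D into `xs ʳ++ D`.
data Fresh {A : Set} (D : List A) : List A → Set where
  [] : Fresh D []
  _∷_ : ∀ {x xs} → x ∉ D → Fresh (x ∷ D) xs → Fresh D (x ∷ xs)

∈-ʳ++ʳ : ∀ {A : Set} {x : A} xs {D} → x ∈ D → x ∈ xs ʳ++ D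
∈-ʳ++ʳ [] x∈ = x∈
∈-ʳ++ʳ (y ∷ xs) x∈ = ∈-ʳ++ʳ xs (there x∈)

∈-ʳ++ˡ : ∀ {A : Set} {x : A} {xs} D → x ∈ xs → x ∈ xs ʳ++ D
∈-ʳ++ˡ {xs = y ∷ xs} D (here refl) = ∈-ʳ++ʳ xs (here refl)
∈-ʳ++ˡ {xs = y ∷ xs} D (there x∈) = ∈-ʳ++ˡ (y ∷ D) x∈

half : ∀ m → ∃ λ r → 2 * r ≤ suc m × m ≤ 2 * r
half zero = 0 , z≤n , z≤n
half (suc zero) = 1 , dec≤ , dec≤
half (suc (suc m)) with half m
... | r , p , q = suc r , ≤-trans (≤-reflexive (eq r)) (s≤s (s≤s p)) , ≤-trans (s≤s (s≤s q)) (≤-reflexive (sym (eq r)))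
  where
  eq : ∀ r → 2 * (1 + r) ≡ 2 + (2 * r)
  eq = solve-∀

fresh-∉ : ∀ {A : Set} {D xs : List A} → Fresh D xs → ∀ {x} → x ∈ xs → x ∉ D
fresh-∉ (x∉ ∷ fr) (here refl) = x∉
fresh-∉ (x∉ ∷ fr) (there x∈) x∈D = fresh-∉ fr x∈ (there x∈D)

∑-indicator-split : ∀ {A : Set} (xs : List A) (P : A → Bool) → ∑ xs (λ x → ⟦ P x ⟧) + ∑ xs (λ x → ⟦ not (P x) ⟧) ≡ length xs
∑-indicator-split xs P = trans (sym (∑-+ xs _ _)) (trans (∑-cong xs (λ x → pt (P x))) (∑-1 xs))
  where
  pt : ∀ b → ⟦ b ⟧ + ⟦ not b ⟧ ≡ 1
  pt true = refl
  pt false = refl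

-- `f` is the identity or the negation. That it commutes with `not` carries a proper two-colouring
-- over to the relabelled one.
majority : ∀ {A : Set} (xs : List A) (colour : A → Bool) → ∃ λ (f : Bool → Bool) →
  (∀ b → f (not b) ≡ not (f b)) × ∑ xs (λ x → ⟦ not (f (colour x)) ⟧) ≤ ∑ xs (λ x → ⟦ f (colour x) ⟧)
majority xs colour with ≤-total (∑ xs (λ x → ⟦ not (colour x) ⟧)) (∑ xs (λ x → ⟦ colour x ⟧))
... | inj₁ le = id , (λ _ → refl) , le
... | inj₂ le = not , (λ _ → refl) , ≤-trans (≤-reflexive (∑-cong xs (λ x → cong ⟦_⟧ (not-involutive (colour x))))) le

every : ∀ {A : Set} → List A → (A → Bool) → Bool
every [] f = true
every (x ∷ xs) f = f x ∧ every xs f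

every-i : ∀ {A : Set} (xs : List A) {f : A → Bool} → (∀ x → f x ≡ true) → every xs f ≡ true
every-i [] p = refl
every-i (x ∷ xs) p = ∧-i (p x) (every-i xs p)

every-e : ∀ {A : Set} {xs : List A} {f : A → Bool} {x} → every xs f ≡ true → x ∈ xs → f x ≡ true
every-e p (here refl) = ∧-l p
every-e {xs = y ∷ xs} {f} p (there x∈) = every-e (∧-r {f y} p) x∈

∨-e : ∀ {a b} → a ∨ b ≡ true → a ≡ true ⊎ b ≡ true
∨-e {true} _ = inj₁ refl
∨-e {false} p = inj₂ p

∨-r : ∀ {a b} → b ≡ true → a ∨ b ≡ true
∨-r {true} _ = refl
∨-r {false} p = p

not-e : ∀ {a} → not a ≡ true → a ≡ false
not-e {false} _ = refl

∨-l : ∀ {a b} → a ≡ true → a ∨ b ≡ true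
∨-l refl = refl

guard : ∀ a {b} → (a ≡ true → b ≡ true) → not a ∨ b ≡ true
guard true f = f refl
guard false f = refl

if-true : ∀ {c x y} → c ≡ true → x ≡ true → (if c then x else y) ≡ true
if-true refl q = q

if-false : ∀ {c x y} → c ≡ false → y ≡ true → (if c then x else y) ≡ true
if-false refl q = q

from-true : ∀ {c x y} → c ≡ true → (if c then x else y) ≡ true → x ≡ true
from-true refl q = q

from-false : ∀ {c x y} → c ≡ false → (if c then x else y) ≡ true → y ≡ true
from-false refl q = q

fresh-head : ∀ {A : Set} {D : List A} {p ys} → Fresh D (p ∷ ys) → ∀ {x} → x ∈ ys → x ≢ p
fresh-head (_ ∷ fr) x∈ refl = fresh-∉ fr x∈ (here refl)

bool-split : ∀ b → b ≡ true ⊎ b ≡ false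
bool-split true = inj₁ refl
bool-split false = inj₂ refl

-- Numerical cores of the potential arguments.

cancel-pow : ∀ j a {x y} → 0 < a → a ^ j * x ≤ a ^ j * y → x ≤ y
cancel-pow j (suc a) _ le = *-cancelˡ-≤ (suc a ^ j) {{m^n≢0 (suc a) j}} le

-- (1 + 1/K) ^ (K j) ≥ 2 ^ j beats any L < 2 ^ j.
growth-contradiction : ∀ K j Λ L Q → Λ ≡ K * j → L < 2 ^ j → 0 < K → 0 < Q → ¬ ((Q * (K + 1)) ^ Λ ≤ L * (Q * K) ^ Λ)
growth-contradiction K j Λ L Q refl L< K>0 Q>0 le = <⇒≱ (*-monoˡ-< (K ^ Λ) {{m^n≢0 K Λ {{nz}}}} L<) (≤-trans
  (double-pow K j {{nz}})
  (cancel-pow Λ Q Q>0 (≤-trans (≤-reflexive (trans (sym (*-pow Q (suc K) Λ)) (cong (λ z → (Q * z) ^ Λ) (+-comm 1 K))))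
    (≤-trans le (≤-reflexive (trans (cong (L *_) (*-pow Q K Λ)) (*-left-comm L (Q ^ Λ) (K ^ Λ))))))))
  where
  nz : NonZero K
  nz = >-nonZero K>0

private
  -- With h = c + 1, the factor Y / (h h m) supplied by `multiplicative-weights` is compared with
  -- the ideal ratio m′ / m. The excess h + 2 s consists of h for the uncontrolled root, s for the
  -- loss 1 + 1/h in the thresholds and s for the loss c/(c+1) in the linearisation.
  rate-bound : ∀ c P Y s m m′ → m ≡ s + m′ → P + (suc c + s) ≡ suc c * s → Y + c * P ≡ suc c * (suc c * m) →
    Y ≤ suc c * (suc c * m′ + (suc c + 2 * s))
  rate-bound c P Y s m m′ refl e₁ e₂ = cert 0
    (+-mono-≤ (≤-reflexive e₂) (+-mono-≤ (*-monoʳ-≤ (suc c) (≤-reflexive (sym e₁))) (≤-trans (m≤m+n P (suc c + s)) (≤-reflexive e₁)))) (eq c P Y s m′)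
    where
    eq : ∀ c P Y s m → Y + ((1 + c) * ((1 + c) * (s + m)) + ((1 + c) * (P + ((1 + c) + s)) + (1 + c) * s)) + 0
      ≡ (1 + c) * ((1 + c) * m + ((1 + c) + 2 * s)) + (Y + c * P + ((1 + c) * ((1 + c) * s) + P))
    eq = solve-∀

  -- SD = 2 s W - SX, where SX is at most W, for the root, plus (1 + 1/h) s Γ / m. By Γ = 2 m W - Φ
  -- the main terms leave s Φ / m, and the errors W and s Γ / (h m) are at most Φ / m and s Φ / (h
  -- m), because m W ≤ Φ also yields Γ ≤ Φ.
  average-drop : ∀ h s m W Φ Γ SD SX Sg P → Γ + Φ ≡ 2 * m * W → m * W ≤ Φ → SD + SX ≡ 2 * s * W → SX ≤ W + Sg →
    h * m * Sg ≤ suc h * s * Γ → P + (h + s) ≡ h * s → P * Φ ≤ h * m * SD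
  average-drop h s m W Φ Γ SD SX Sg P e₁ le₁ e₂ le₂ le₃ e₃ = cert 0
    (+-mono-≤ (*-monoʳ-≤ (h * m) le₂) (+-mono-≤ le₃ (+-mono-≤ (*-monoʳ-≤ (h + 2 * s) le₁)
      (+-mono-≤ (*-monoʳ-≤ (h * m) (≤-reflexive (sym e₂))) (+-mono-≤ (*-monoʳ-≤ (suc h * s) (≤-reflexive e₁)) (*-monoˡ-≤ Φ (≤-reflexive e₃)))))))
    (eq h s m W Φ Γ SD SX Sg P)
    where
    eq : ∀ h s m W Φ Γ SD SX Sg P →
      P * Φ + (h * m * (W + Sg) + ((1 + h) * s * Γ + ((h + 2 * s) * Φ + (h * m * (SD + SX) + ((1 + h) * s * (2 * m * W) + h * s * Φ))))) + 0
      ≡ h * m * SD + (h * m * SX + (h * m * Sg + ((h + 2 * s) * (m * W) + (h * m * (2 * s * W) + ((1 + h) * s * (Γ + Φ) + (P + (h + s)) * Φ)))))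
    eq = solve-∀

private
  -- This is (1 - 1/(2J)) (1 + 1/J) ≥ 1 + 1/(4J) without denominators, which `reward-enough` raises
  -- to a high power.
  reward-gap : ∀ J e₀ → 2 ≤ J → suc e₀ ≡ 2 * J → 2 * J * J * (4 * J + 1) ≤ 4 * J * (e₀ * (J + 1))
  reward-gap J e₀ le eq = cert 0 (+-mono-≤ (*-monoʳ-≤ (2 * J) le) (*-monoʳ-≤ (4 * J * (J + 1)) (≤-reflexive (sym eq)))) (ring J e₀)
    where
    ring : ∀ J e → 2 * J * J * (4 * J + 1) + (2 * J * J + 4 * J * (J + 1) * (1 + e)) + 0 ≡ 4 * J * (e * (J + 1)) + (2 * J * 2 + 4 * J * (J + 1) * (2 * J))
    ring = solve-∀

-- Removal, selection and multiplicities in lists.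

remove : ∀ {A : Set} {y : A} {Ys} → y ∈ Ys → List A
remove {Ys = _ ∷ Ys} (here _) = Ys
remove {Ys = x ∷ _} (there y∈) = x ∷ remove y∈

∑-remove : ∀ {A : Set} {y : A} {Ys} (y∈ : y ∈ Ys) (f : A → ℕ) → ∑ Ys f ≡ f y + ∑ (remove y∈) f
∑-remove (here refl) f = refl
∑-remove {y = y} {x ∷ _} (there y∈) f = trans (cong (f x +_) (∑-remove y∈ f)) (+-left-comm (f x) (f y) (∑ (remove y∈) f))

∈-remove : ∀ {A : Set} {y z : A} {Ys} (y∈ : y ∈ Ys) → z ∈ remove y∈ → z ∈ Ys
∈-remove (here refl) z∈ = there z∈
∈-remove (there y∈) (here eq) = here eq
∈-remove (there y∈) (there z∈) = there (∈-remove y∈ z∈)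

unique-remove : ∀ {A : Set} {y : A} {Ys} (y∈ : y ∈ Ys) → Unique Ys → Unique (remove y∈)
unique-remove (here refl) (_ ∷ un) = un
unique-remove (there y∈) (x≢ ∷ un) = All.tabulate (λ z∈ → All.lookup x≢ (∈-remove y∈ z∈)) ∷ unique-remove y∈ un

remove-≢ : ∀ {A : Set} {y z : A} {Ys} (y∈ : y ∈ Ys) → Unique Ys → z ∈ remove y∈ → z ≢ y
remove-≢ (here refl) (x≢ ∷ _) z∈ eq = All.lookup x≢ z∈ (sym eq)
remove-≢ (there y∈) (x≢ ∷ un) (here refl) eq = All.lookup x≢ y∈ eq
remove-≢ (there y∈) (x≢ ∷ un) (there z∈) = remove-≢ y∈ un z∈

select : ∀ {A : Set} → (A → Bool) → List A → List A
select P [] = []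
select P (x ∷ xs) = if P x then x ∷ select P xs else select P xs

∈-select : ∀ {A : Set} (P : A → Bool) {xs x} → x ∈ select P xs → x ∈ xs × P x ≡ true
∈-select P {y ∷ xs} x∈ with P y in eq
∈-select P {y ∷ xs} (here refl) | true = here refl , eq
∈-select P {y ∷ xs} (there x∈) | true = let a , b = ∈-select P x∈ in there a , b
∈-select P {y ∷ xs} x∈ | false = let a , b = ∈-select P x∈ in there a , b

∑-select : ∀ {A : Set} (P : A → Bool) xs (f : A → ℕ) → ∑ (select P xs) f ≡ ∑ xs (λ x → ⟦ P x ⟧ * f x)
∑-select P [] f = refl
∑-select P (x ∷ xs) f with P x
... | true = cong₂ _+_ (sym (+-identityʳ (f x))) (∑-select P xs f)
... | false = ∑-select P xs f

∑-select-split : ∀ {A : Set} (P : A → Bool) xs (f : A → ℕ) → ∑ (select P xs) f + ∑ (select (not ∘ P) xs) f ≡ ∑ xs f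
∑-select-split P xs f = trans (cong₂ _+_ (∑-select P xs f) (∑-select (not ∘ P) xs f))
  (trans (sym (∑-+ xs (λ x → ⟦ P x ⟧ * f x) (λ x → ⟦ not (P x) ⟧ * f x))) (∑-cong xs (λ x → pt (P x) (f x))))
  where
  pt : ∀ b a → ⟦ b ⟧ * a + ⟦ not b ⟧ * a ≡ a
  pt true a = trans (+-identityʳ _) (+-identityʳ a)
  pt false a = +-identityʳ a

length-select : ∀ {A : Set} (P : A → Bool) xs → length (select P xs) ≡ ∑ xs (λ x → ⟦ P x ⟧)
length-select P xs = trans (sym (∑-1 (select P xs))) (trans (∑-select P xs (λ _ → 1)) (∑-cong xs (λ x → *-identityʳ ⟦ P x ⟧)))

∑-ʳ++ : ∀ {A : Set} (xs D : List A) f → ∑ (xs ʳ++ D) f ≡ ∑ xs f + ∑ D f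
∑-ʳ++ [] D f = refl
∑-ʳ++ (x ∷ xs) D f = trans (∑-ʳ++ xs (x ∷ D) f) (+-left-assoc (∑ xs f) (f x) (∑ D f))

mult : ∀ {n} → List (Fin n) → Fin n → ℕ
mult D x = ∑ D (λ y → ⟦ y == x ⟧)

mult-∈ : ∀ {n} {D : List (Fin n)} {x} → x ∈ D → 1 ≤ mult D x
mult-∈ {x = x} x∈ = ≤-trans (≤-reflexive (cong ⟦_⟧ (sym (==-refl x)))) (∑-≥ (λ y → ⟦ y == x ⟧) x∈)

mult-all : ∀ {n} (x : Fin n) → mult (allFin n) x ≡ 1
mult-all {n} x = trans (∑-cong (allFin n) (λ y → sym (*-identityʳ ⟦ y == x ⟧))) (∑-δ-all x (λ _ → 1))

mult-zero : ∀ {n} (D : List (Fin n)) x → x ∉ D → mult D x ≡ 0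
mult-zero D x x∉ = trans (∑-cong D (λ y → sym (*-identityʳ ⟦ y == x ⟧))) (∑-δ∉ D x (λ _ → 1) x∉)

mult-fresh : ∀ {n} (D xs : List (Fin n)) → (∀ x → mult D x + mult xs x ≤ 1) → Fresh D xs
mult-fresh D [] le = []
mult-fresh D (x ∷ xs) le = (λ x∈ → <⇒≱ (+-mono-≤ (mult-∈ x∈) (mult-∈ {D = x ∷ xs} (here refl))) (le x)) ∷
  mult-fresh (x ∷ D) xs (λ y → ≤-trans (≤-reflexive (eq ⟦ x == y ⟧ (mult D y) (mult xs y))) (le y))
  where
  eq : ∀ a b c → a + b + c ≡ b + (a + c)
  eq = solve-∀

∑-cover : ∀ {n} {D : List (Fin n)} → Unique D → (∀ x → x ∈ D) → ∀ (f : Fin n → ℕ) → ∑ D f ≡ ∑ (allFin n) f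
∑-cover {n} {D} un cov f = begin-equality
  ∑ D f ≡⟨ ∑-cong D (λ x → sym (∑-δ-all x f)) ⟩
  ∑ D (λ x → ∑ (allFin n) (λ u → ⟦ u == x ⟧ * f u)) ≡⟨ ∑-swap D (allFin n) (λ x u → ⟦ u == x ⟧ * f u) ⟩
  ∑ (allFin n) (λ u → ∑ D (λ x → ⟦ u == x ⟧ * f u)) ≡⟨ ∑-cong (allFin n) (λ u → trans (∑-cong D (λ x → cong (λ b → ⟦ b ⟧ * f u) (==-comm u x))) (∑-δ (λ _ → f u) un (cov u))) ⟩
  ∑ (allFin n) f ∎
  where
  open ≤-Reasoning
  ==-comm : ∀ u x → (u == x) ≡ (x == u)
  ==-comm u x with u FinP.≟ x
  ... | yes refl = sym (==-refl u)
  ... | no ne = sym (==-≢ (λ q → ne (sym q)))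

two-members : ∀ {A : Set} {xs : List A} {q r} (g : A → ℕ) → q ∈ xs → r ∈ xs → q ≡ r ⊎ g q + g r ≤ ∑ xs g
two-members g (here refl) (here refl) = inj₁ refl
two-members g (here refl) (there r∈) = inj₂ (+-monoʳ-≤ _ (∑-≥ g r∈))
two-members {r = r} g (there {x = x} q∈) (here refl) = inj₂ (≤-trans (≤-reflexive (+-comm _ (g r))) (+-monoʳ-≤ _ (∑-≥ g q∈)))
two-members g (there q∈) (there r∈) with two-members g q∈ r∈
... | inj₁ eq = inj₁ eq
... | inj₂ le = inj₂ (≤-trans le (m≤n+m _ _))

mult-unique : ∀ {n} (xs : List (Fin n)) → (∀ x → mult xs x ≤ 1) → Unique xs
mult-unique [] le = []
mult-unique (x ∷ xs) le = All.tabulate (λ {y} y∈ eq → <⇒≱ (twice y y∈ eq) (le y)) ∷ mult-unique xs (λ y → ≤-trans (m≤n+m _ _) (le y))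
  where
  twice : ∀ y → y ∈ xs → x ≡ y → 2 ≤ mult (x ∷ xs) y
  twice y y∈ refl = +-mono-≤ (≤-reflexive (cong ⟦_⟧ (sym (==-refl x)))) (mult-∈ y∈)

divide : ∀ n d → 0 < d → ∃ λ q → d * q ≤ n × n < d * suc q
divide n (suc d) _ = n / suc d , ≤-trans (≤-reflexive (*-comm (suc d) _)) (m/n*n≤m n (suc d)) ,
  <-≤-trans (subst (_< suc d + n / suc d * suc d) (sym (m≡m%n+[m/n]*n n (suc d))) (+-monoˡ-< (n / suc d * suc d) (m%n<n n (suc d))))
    (≤-reflexive (trans (cong (suc d +_) (*-comm (n / suc d) (suc d))) (sym (*-suc (suc d) (n / suc d)))))

-- Rooting and two-colouring the tree.

-- Read from its head, such a list meets every vertex before its parent, so recursion on it is the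
-- bottom-up pass that `decompose` makes.
data Grown {n : ℕ} (t : Fin n) (par : Fin n → Fin n) : List (Fin n) → Set where
  seed : Grown t par (t ∷ [])
  sprout : ∀ {x D} → par x ∈ D → x ≢ t → Grown t par D → Grown t par (x ∷ D)

grown-cong : ∀ {n} {t : Fin n} {par par′ D} → (∀ x → x ∈ D → par′ x ≡ par x) → Grown t par D → Grown t par′ D
grown-cong eq seed = seed
grown-cong {D = x ∷ D} eq (sprout p∈ ne g) = sprout (subst (_∈ D) (sym (eq x (here refl))) p∈) ne (grown-cong (λ y y∈ → eq y (there y∈)) g)

module TreeOrder {n : ℕ} (T : Graph n) (connected : Connected T) (acyclic : Acyclic T) (t : Fin n) where

  nb : Fin n → Fin n → Bool
  nb = adj T

  nb-sym : ∀ x y → nb x y ≡ nb y x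
  nb-sym = Graph.sym T

  data Path (D : List (Fin n)) : Fin n → Fin n → List (Fin n) → Set where
    stop : ∀ {a} → a ∈ D → Path D a a (a ∷ [])
    go : ∀ {a c b l} → a ∈ D → nb a c ≡ true → a ∉ l → Path D c b l → Path D a b (a ∷ l)

  path-weaken : ∀ {D x a b l} → Path D a b l → Path (x ∷ D) a b l
  path-weaken (stop a∈) = stop (there a∈)
  path-weaken (go a∈ ac a∉ p) = go (there a∈) ac a∉ (path-weaken p)

  path-⊂ : ∀ {D a b l} → Path D a b l → ∀ {z} → z ∈ l → z ∈ D
  path-⊂ (stop a∈) (here refl) = a∈
  path-⊂ (go a∈ _ _ p) (here refl) = a∈
  path-⊂ (go a∈ _ _ p) (there z∈) = path-⊂ p z∈

  path-snoc : ∀ {D x a b l} → x ∉ D → nb b x ≡ true → Path D a b l → Path (x ∷ D) a x (l ++ x ∷ [])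
  path-snoc x∉ bx (stop a∈) = go (there a∈) bx (λ { (here refl) → x∉ a∈ }) (stop (here refl))
  path-snoc {x = x} {a = a} {l = _ ∷ l} x∉ bx (go a∈ ac a∉ p) = go (there a∈) ac new (path-snoc x∉ bx p)
    where
    new : a ∉ l ++ x ∷ []
    new q with ∈-++⁻ l q
    ... | inj₁ r = a∉ r
    ... | inj₂ (here refl) = x∉ a∈

  path-injective : ∀ {D a b l} → Path D a b l → ∀ i j → lookup l i ≡ lookup l j → i ≡ j
  path-injective (stop _) Fin.zero Fin.zero _ = refl
  path-injective (go _ _ _ p) Fin.zero Fin.zero _ = refl
  path-injective {l = _ ∷ l} (go _ _ a∉ p) Fin.zero (Fin.suc j) eq = ⊥-elim (a∉ (subst (_∈ l) (sym eq) (∈-lookup j)))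
  path-injective {l = _ ∷ l} (go _ _ a∉ p) (Fin.suc i) Fin.zero eq = ⊥-elim (a∉ (subst (_∈ l) eq (∈-lookup i)))
  path-injective (go _ _ _ p) (Fin.suc i) (Fin.suc j) eq = cong Fin.suc (path-injective p i j eq)

  path-consecutive : ∀ {D a b l} → Path D a b l → ∀ i j → suc (Fin.toℕ i) ≡ Fin.toℕ j → nb (lookup l i) (lookup l j) ≡ true
  path-consecutive (stop _) Fin.zero Fin.zero ()
  path-consecutive (go _ ac _ (stop _)) Fin.zero (Fin.suc Fin.zero) eq = ac
  path-consecutive (go _ ac _ (go _ _ _ _)) Fin.zero (Fin.suc Fin.zero) eq = ac
  path-consecutive (go _ ac _ p) (Fin.suc i) (Fin.suc j) eq = path-consecutive p i j (suc-injective eq)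

  path-last : ∀ {D a b c l} → Path D a b (c ∷ l) → lookup (c ∷ l) (Fin.fromℕ (length l)) ≡ b
  path-last (stop _) = refl
  path-last {l = _ ∷ _} (go _ _ _ p) = path-last p

  path-first : ∀ {D a b c l} → Path D a b (c ∷ l) → c ≡ a
  path-first (stop _) = refl
  path-first (go _ _ _ _) = refl

  no-closed-path : ∀ {D a b c₁ c₂ c₃ l} → Path D a b (c₁ ∷ c₂ ∷ c₃ ∷ l) → nb b a ≡ true → ⊥
  no-closed-path {c₁ = c₁} {c₂} {c₃} {l} p ba = acyclic (length l) record
    { f = lookup (c₁ ∷ c₂ ∷ c₃ ∷ l)
    ; inj = λ {i} {j} → path-injective p i j
    ; consec = path-consecutive p
    ; close = subst₂ (λ u v → nb u v ≡ true) (sym (path-last p)) (sym (path-first p)) ba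
    }

  -- `paths` is there for the sake of the next extension: it turns a second neighbour of the new
  -- vertex into a cycle, which is what preserves `nb-par`.
  record Order (D : List (Fin n)) : Set where
    field
      par : Fin n → Fin n
      colour : Fin n → Bool
      par-t : par t ≡ t
      root∈ : t ∈ D
      unique : Unique D
      par-∈ : ∀ x → x ∈ D → par x ∈ D
      par-nb : ∀ x → x ∈ D → x ≢ t → nb x (par x) ≡ true
      alternates : ∀ x → x ∈ D → x ≢ t → colour x ≡ not (colour (par x))
      nb-par : ∀ x y → x ∈ D → y ∈ D → nb x y ≡ true → y ≡ par x ⊎ par y ≡ x
      paths : ∀ a b → a ∈ D → b ∈ D → ∃ (Path D a b)

  initial : Order (t ∷ [])
  initial = record
    { par = λ x → x
    ; colour = λ _ → true
    ; par-t = refl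
    ; root∈ = here refl
    ; unique = [] ∷ []
    ; par-∈ = λ x x∈ → x∈
    ; par-nb = λ { x (here refl) ne → ⊥-elim (ne refl) }
    ; alternates = λ { x (here refl) ne → ⊥-elim (ne refl) }
    ; nb-par = λ { x y (here refl) (here refl) _ → inj₁ refl }
    ; paths = λ { a b (here refl) (here refl) → _ , stop (here refl) }
    }

  extend : ∀ {D} → Order D → ∀ q x → q ∈ D → x ∉ D → nb q x ≡ true → Order (x ∷ D)
  extend {D} o q x q∈ x∉ qx = record
    { par = par′
    ; colour = colour′
    ; par-t = trans (same (root∈)) par-t
    ; root∈ = there root∈
    ; unique = All.tabulate (λ {y} y∈ eq → x∉ (subst (_∈ D) (sym eq) y∈)) ∷ unique
    ; par-∈ = λ { y (here refl) → there (subst (_∈ D) (sym par-x) q∈) ; y (there y∈) → there (subst (_∈ D) (sym (same y∈)) (par-∈ y y∈)) }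
    ; par-nb = λ { y (here refl) ne → trans (cong (nb y) par-x) (trans (nb-sym y q) qx) ; y (there y∈) ne → trans (cong (nb y) (same y∈)) (par-nb y y∈ ne) }
    ; alternates = λ
        { y (here refl) ne → trans colour-x (cong not (sym (trans (cong colour′ par-x) (same-colour q∈))))
        ; y (there y∈) ne → trans (same-colour y∈) (trans (alternates y y∈ ne) (cong not (sym (trans (cong colour′ (same y∈)) (same-colour (par-∈ y y∈)))))) }
    ; nb-par = nb-par′
    ; paths = paths′
    }
    where
    open Order o
    par′ : Fin n → Fin n
    par′ = upd par x q
    colour′ : Fin n → Bool
    colour′ = upd colour x (not (colour q))
    par-x : par′ x ≡ q
    par-x = upd-same par x q
    colour-x : colour′ x ≡ not (colour q)
    colour-x = upd-same colour x (not (colour q))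
    same : ∀ {y} → y ∈ D → par′ y ≡ par y
    same y∈ = upd-other par q (∈≢ y∈ x∉)
    same-colour : ∀ {y} → y ∈ D → colour′ y ≡ colour y
    same-colour y∈ = upd-other colour (not (colour q)) (∈≢ y∈ x∉)
    -- A nontrivial path in D from z to q closes up through x to a cycle. The two cases of such a
    -- path differ only in the shape that exposes three vertices.
    only : ∀ z → z ∈ D → nb x z ≡ true → z ≡ q
    only z z∈ xz with paths z q z∈ q∈
    ... | _ , stop _ = refl
    ... | _ , p@(go _ _ _ (stop _)) = ⊥-elim (no-closed-path (go (here refl) xz (λ r → x∉ (path-⊂ p r)) (path-weaken p)) qx)
    ... | _ , p@(go _ _ _ (go _ _ _ _)) = ⊥-elim (no-closed-path (go (here refl) xz (λ r → x∉ (path-⊂ p r)) (path-weaken p)) qx)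
    nb-par′ : ∀ y z → y ∈ x ∷ D → z ∈ x ∷ D → nb y z ≡ true → z ≡ par′ y ⊎ par′ z ≡ y
    nb-par′ y z (here refl) (here refl) yz = ⊥-elim (case trans (sym yz) (irrefl T y) of λ ())
    nb-par′ y z (here refl) (there z∈) yz = inj₁ (trans (only z z∈ yz) (sym par-x))
    nb-par′ y z (there y∈) (here refl) yz = inj₂ (trans par-x (sym (only y y∈ (trans (nb-sym x y) yz))))
    nb-par′ y z (there y∈) (there z∈) yz with nb-par y z y∈ z∈ yz
    ... | inj₁ eq = inj₁ (trans eq (sym (same y∈)))
    ... | inj₂ eq = inj₂ (trans (same z∈) eq)
    paths′ : ∀ a b → a ∈ x ∷ D → b ∈ x ∷ D → ∃ (Path (x ∷ D) a b)
    paths′ a b (here refl) (here refl) = _ , stop (here refl)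
    paths′ a b (here refl) (there b∈) = let l , p = paths q b q∈ b∈ in _ , go (here refl) (trans (nb-sym x q) qx) (λ r → x∉ (path-⊂ p r)) (path-weaken p)
    paths′ a b (there a∈) (here refl) = let l , p = paths a q a∈ q∈ in _ , path-snoc x∉ qx p
    paths′ a b (there a∈) (there b∈) = let l , p = paths a b a∈ b∈ in _ , path-weaken p

  crossing : ∀ {D u v} → Walk T u v → u ∈ D → v ∉ D → ∃ λ q → ∃ λ x → q ∈ D × x ∉ D × nb q x ≡ true
  crossing here u∈ v∉ = ⊥-elim (v∉ u∈)
  crossing {D} (Walk.step {u} {w} uw walk) u∈ v∉ with w ∈? D
  ... | yes w∈ = crossing walk w∈ v∉
  ... | no w∉ = u , w , u∈ , w∉ , uw

  record FullOrder : Set where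
    field
      D : List (Fin n)
      order : Order D
      grown : Grown t (Order.par order) D
      covers : ∀ x → x ∈ D

  missing : List (Fin n) → Fin n → Bool
  missing D x = not ⌊ x ∈? D ⌋

  complete : ∀ fuel D (o : Order D) → Grown t (Order.par o) D → # (missing D) ≤ fuel → FullOrder
  complete fuel D o g le with FinP.any? (λ x → ¬? (x ∈? D))
  ... | no all∈ = record { D = D ; order = o ; grown = g ; covers = λ x → decidable-stable (x ∈? D) (λ x∉ → all∈ (x , x∉)) }
  ... | yes (z , z∉) = add fuel le (crossing (connected t z) (Order.root∈ o) z∉)
    where
    add : ∀ fuel → # (missing D) ≤ fuel → (∃ λ q → ∃ λ x → q ∈ D × x ∉ D × nb q x ≡ true) → FullOrder
    add fuel le (q , x , q∈ , x∉ , qx) = next fuel (≤-trans (≤-reflexive (sym card)) le)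
      where
      miss-x : missing D x ≡ true
      miss-x with x ∈? D
      ... | yes p = ⊥-elim (x∉ p)
      ... | no _ = refl
      pt : ∀ u → (missing D ⊖ x) u ≡ missing (x ∷ D) u
      pt u with u FinP.≟ x | u ∈? D
      ... | yes _ | yes _ = refl
      ... | yes _ | no _ = refl
      ... | no _ | yes _ = refl
      ... | no _ | no _ = refl
      card : # (missing D) ≡ suc (# (missing (x ∷ D)))
      card = trans (#-⊖ (missing D) x miss-x) (cong suc (∑-cong (allFin n) (λ u → cong ⟦_⟧ (pt u))))
      next : ∀ fuel → suc (# (missing (x ∷ D))) ≤ fuel → FullOrder
      next (suc fuel) (s≤s le) = complete fuel (x ∷ D) (extend o q x q∈ x∉ qx)
        (sprout (subst (_∈ D) (sym (upd-same (Order.par o) x q)) q∈) (λ { refl → x∉ (Order.root∈ o) })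
          (grown-cong (λ y y∈ → upd-other (Order.par o) q (∈≢ y∈ x∉)) g)) le

  full-order : FullOrder
  full-order = complete (# (missing (t ∷ []))) (t ∷ []) initial seed ≤-refl

-- Partial embeddings and greedy placement.

module RootedTree {n : ℕ} (e : Fin n → Fin n → Bool) (e-sym : ∀ u v → e u v ≡ e v u)
  (nbr : Fin n → Fin n → Bool) (nbr-sym : ∀ x y → nbr x y ≡ nbr y x)
  (t : Fin n) (par : Fin n → Fin n) (par-t : par t ≡ t)
  (par-nbr : ∀ x → x ≢ t → nbr x (par x) ≡ true) (nbr-par : ∀ x y → nbr x y ≡ true → y ≡ par x ⊎ par y ≡ x)
  (colour : Fin n → Bool) (alternates : ∀ x → x ≢ t → colour x ≡ not (colour (par x)))
  (s₁ Δ : ℕ) (deg≤ : ∀ x → # (nbr x) ≤ Δ) where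

  open Graphs e e-sym public

  V : List (Fin n)
  V = allFin n

  data Build (S : List (Fin n)) : List (Fin n) → Set where
    [] : Build S []
    _∷_ : ∀ {x xs} → par x ∈ S → Build (x ∷ S) xs → Build S (x ∷ xs)

  -- `φ` is meaningful on `D` alone. In place of a description of `U` as the complement of the
  -- image, `used` and `size` record what the arguments consume: disjointness and a count.
  record State (D : List (Fin n)) : Set where
    field
      φ : Fin n → Fin n
      U : Fin n → Bool
      used : ∀ x → x ∈ D → U (φ x) ≡ false
      inj : ∀ x y → x ∈ D → y ∈ D → φ x ≡ φ y → x ≡ y
      edge : ∀ x → x ∈ D → x ≢ t → e (φ x) (φ (par x)) ≡ true
      closed : ∀ x → x ∈ D → par x ∈ D
      root : t ∈ D
      size : # U + length D ≡ n

  open State public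

  place : ∀ {D} (st : State D) x w → x ∉ D → par x ∈ D → U st w ≡ true → e w (φ st (par x)) ≡ true → State (x ∷ D)
  place {D} st x w x∉ p∈ Uw ew = record
    { φ = φ′
    ; U = U st ⊖ w
    ; used = used′
    ; inj = inj′
    ; edge = edge′
    ; closed = λ { y (here refl) → there p∈ ; y (there y∈) → there (closed st y y∈) }
    ; root = there (root st)
    ; size = trans (trans (+-suc _ (length D)) (cong (_+ length D) (sym (#-⊖ (U st) w Uw)))) (size st)
    }
    where
    φ′ = upd (φ st) x w
    old : ∀ {y} → y ∈ D → φ′ y ≡ φ st y
    old y∈ = upd-other (φ st) w (∈≢ y∈ x∉)
    new : φ′ x ≡ w
    new = upd-same (φ st) x w
    used′ : ∀ y → y ∈ x ∷ D → (U st ⊖ w) (φ′ y) ≡ false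
    used′ y (here refl) rewrite new | ==-refl w = ∧-zeroʳ (U st w)
    used′ y (there y∈) rewrite old y∈ | used st y y∈ = refl
    w≢ : ∀ {y} → y ∈ D → φ′ y ≢ w
    w≢ {y} y∈ eq = case trans (sym (used st y y∈)) (subst (λ z → U st z ≡ true) (trans (sym eq) (old y∈)) Uw) of λ ()
    inj′ : ∀ y z → y ∈ x ∷ D → z ∈ x ∷ D → φ′ y ≡ φ′ z → y ≡ z
    inj′ y z (here refl) (here refl) eq = refl
    inj′ y z (here refl) (there z∈) eq = ⊥-elim (w≢ z∈ (trans (sym eq) new))
    inj′ y z (there y∈) (here refl) eq = ⊥-elim (w≢ y∈ (trans eq new))
    inj′ y z (there y∈) (there z∈) eq = inj st y z y∈ z∈ (trans (sym (old y∈)) (trans eq (old z∈)))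
    edge′ : ∀ y → y ∈ x ∷ D → y ≢ t → e (φ′ y) (φ′ (par y)) ≡ true
    edge′ y (here refl) y≢t = subst₂ (λ a b → e a b ≡ true) (sym new) (sym (old p∈)) ew
    edge′ y (there y∈) y≢t = subst₂ (λ a b → e a b ≡ true) (sym (old y∈)) (sym (old (closed st y y∈))) (edge st y y∈ y≢t)

  -- `conserve` is stated for all f at once: f = 1 yields the size of the new free set, and the
  -- indicator of the non-neighbours of v yields `far-ext`.
  record Ext {D} (st : State D) (xs : List (Fin n)) : Set where
    field
      st′ : State (xs ʳ++ D)
      agree : ∀ y → y ∈ D → φ st′ y ≡ φ st y
      conserve : ∀ (f : Fin n → ℕ) → ∑ V (λ u → ⟦ U st u ⟧ * f u) ≡ ∑ xs (λ x → f (φ st′ x)) + ∑ V (λ u → ⟦ U st′ u ⟧ * f u)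

  open Ext public

  ext-[] : ∀ {D} (st : State D) → Ext st []
  ext-[] st = record { st′ = st ; agree = λ _ _ → refl ; conserve = λ f → refl }

  ext-∷ : ∀ {D xs} (st : State D) x w x∉ p∈ Uw ew → Ext (place st x w x∉ p∈ Uw ew) xs → Ext st (x ∷ xs)
  ext-∷ {D} {xs} st x w x∉ p∈ Uw ew E = record
    { st′ = st′ E
    ; agree = λ y y∈ → trans (agree E y (there y∈)) (upd-other (φ st) w (∈≢ y∈ x∉))
    ; conserve = λ f → trans (∑-⊖ (U st) w Uw f) (trans (cong (f w +_) (conserve E f))
        (trans (sym (+-assoc (f w) _ _)) (cong (λ z → f z + ∑ xs (λ x → f (φ (st′ E) x)) + ∑ V (λ u → ⟦ U (st′ E) u ⟧ * f u)) (sym (trans (agree E x (here refl)) (upd-same (φ st) x w))))))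
    }

  count-ext : ∀ {D xs} {st : State D} (E : Ext st xs) → # (U st) ≡ length xs + # (U (st′ E))
  count-ext {D} {xs} {st} E = trans (sym (tot (U st))) (trans (conserve E (λ _ → 1)) (cong₂ _+_ (∑-1 xs) (tot (U (st′ E)))))
    where
    tot : ∀ P → ∑ V (λ u → ⟦ P u ⟧ * 1) ≡ # P
    tot P = ∑-cong V (λ u → *-identityʳ _)

  -- A rule judges a vertex x, the images g and b of its grandparent and parent, and a proposed image w.
  Rule : Set
  Rule = (x g b w : Fin n) → Bool

  Obeys : Rule → (Fin n → Fin n) → Fin n → Set
  Obeys rule φ x = rule x (φ (par (par x))) (φ (par x)) (φ x) ≡ true

  -- At most s - ℓ vertices of U₀ have been used up, too few to cover more than s candidates.
  available : ∀ {s ℓ} (c U U₀ : Fin n → Bool) → Sub c U₀ → Sub U U₀ → # U₀ + ℓ ≤ # U + s → s < # c →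
    ∃ λ w → c w ≡ true × U w ≡ true
  available {s} {ℓ} c U U₀ c⊂ U⊂ le lt =
    let w , p = #-∃ (λ u → c u ∧ U u) pos in w , ∧-l p , ∧-r {c w} p
    where
    pt : ∀ a b c → (a ≡ true → c ≡ true) → (b ≡ true → c ≡ true) → ⟦ a ⟧ + ⟦ b ⟧ ≤ ⟦ c ⟧ + ⟦ a ∧ b ⟧
    pt true b c f g rewrite f refl = ≤-refl
    pt false true c f g rewrite g refl = dec≤
    pt false false c f g = z≤n
    incl : # c + # U ≤ # U₀ + # (λ u → c u ∧ U u)
    incl = ≤-trans (≤-reflexive (sym (∑-+ V _ _)))
      (≤-trans (∑-mono V (λ u → pt (c u) (U u) (U₀ u) (c⊂ u) (U⊂ u))) (≤-reflexive (∑-+ V _ _)))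
    pos : 0 < # (λ u → c u ∧ U u)
    pos = cert ℓ (+-mono-≤ incl (+-mono-≤ le lt)) (eq (# (λ u → c u ∧ U u)) (# c) (# U) (# U₀) s ℓ)
      where
      eq : ∀ x c u u₀ s ℓ → 1 + (u₀ + x + (u + s + c)) + ℓ ≡ x + (c + u + (u₀ + ℓ + (1 + s)))
      eq = solve-∀

  -- Candidates are counted once, in the initial free set: more than s of them against at most s
  -- vertices used in all, so no count is ever updated. The hypothesis on x asks only that its
  -- parent obeys, for arbitrary images g, b, a; being hereditary in this way, a rule can be
  -- followed through a piece of any shape.
  greedy : ∀ (rule : Rule) s U₀ {D} (st : State D) S xs → Build S xs → Fresh D xs → (∀ x → x ∈ S → x ∈ D) →
    (∀ x → x ∈ S → Obeys rule (φ st) x) →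
    (∀ x → x ∈ xs → ∀ g b a → rule (par x) g b a ≡ true → s < # (λ w → N∩ U₀ a w ∧ rule x b a w)) →
    Sub (U st) U₀ → # U₀ + length xs ≤ # (U st) + s →
    Σ (Ext st xs) λ E → ∀ x → x ∈ xs → Obeys rule (φ (st′ E)) x
  greedy rule s U₀ st S [] bu fr S⊂ nice cand sub le = ext-[] st , λ _ ()
  greedy rule s U₀ {D} st S (x ∷ xs) (p∈S ∷ bu) (x∉ ∷ fr) S⊂ nice cand sub le
    = step (available (λ w → N∩ U₀ (φ st (par x)) w ∧ rule x (φ st (par (par x))) (φ st (par x)) w) (U st) U₀
        (λ u q → ∧-l (∧-l q)) sub le (cand x (here refl) _ _ _ (nice (par x) p∈S)))
    where
    p∈ : par x ∈ D
    p∈ = S⊂ (par x) p∈S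
    move : ∀ (φ₁ φ₂ : Fin n → Fin n) {y} → φ₂ y ≡ φ₁ y → φ₂ (par y) ≡ φ₁ (par y) → φ₂ (par (par y)) ≡ φ₁ (par (par y)) →
      Obeys rule φ₁ y → Obeys rule φ₂ y
    move _ _ e₁ e₂ e₃ ob rewrite e₁ | e₂ | e₃ = ob
    step : (∃ λ w → (N∩ U₀ (φ st (par x)) w ∧ rule x (φ st (par (par x))) (φ st (par x)) w) ≡ true × U st w ≡ true) →
      Σ (Ext st (x ∷ xs)) λ E → ∀ y → y ∈ x ∷ xs → Obeys rule (φ (st′ E)) y
    step (w , cw , Uw) = ext-∷ st x w x∉ p∈ Uw ew (proj₁ rec) ,
        λ { y (here refl) → transport (proj₁ rec) (here refl) nice-x ; y (there y∈) → proj₂ rec y y∈ }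
      where
      ew : e w (φ st (par x)) ≡ true
      ew = trans (e-sym w _) (∧-r {U₀ w} (∧-l cw))
      st₁ : State (x ∷ D)
      st₁ = place st x w x∉ p∈ Uw ew
      same : ∀ y → y ∈ D → φ st₁ y ≡ φ st y
      same y y∈ = upd-other (φ st) w (∈≢ y∈ x∉)
      transport : ∀ {ys} (E : Ext st₁ ys) {y} → y ∈ x ∷ D → Obeys rule (φ st₁) y → Obeys rule (φ (st′ E)) y
      transport E {y} y∈ = move (φ st₁) (φ (st′ E)) (agree E y y∈) (agree E _ (closed st₁ y y∈)) (agree E _ (closed st₁ _ (closed st₁ y y∈)))
      nice-x : Obeys rule (φ st₁) x
      nice-x rewrite upd-same (φ st) x w | same (par x) p∈ | same (par (par x)) (closed st _ p∈) = ∧-r {N∩ U₀ (φ st (par x)) w} cw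
      rec : Σ (Ext st₁ xs) λ E → ∀ x → x ∈ xs → Obeys rule (φ (st′ E)) x
      rec = greedy rule s U₀ st₁ (x ∷ S) xs bu fr
        (λ { y (here refl) → here refl ; y (there y∈) → there (S⊂ y y∈) })
        (λ { y (here refl) → nice-x
           ; y (there y∈) → let y∈D = S⊂ y y∈ in
               move (φ st) (φ st₁) (same y y∈D) (same _ (closed st y y∈D)) (same _ (closed st _ (closed st y y∈D))) (nice y y∈) })
        (λ y y∈ → cand y (there y∈))
        (λ u q → sub u (∧-l q))
        (≤-pred (subst₂ _≤_ (+-suc (# U₀) (length xs)) (cong (_+ s) (#-⊖ (U st) w Uw)) le))

  -- Placing a piece at average cost.

  record Piece (D : List (Fin n)) (p : Fin n) (ys : List (Fin n)) : Set where
    field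
      attached : par p ∈ D
      build : Build (p ∷ []) ys
      fresh : Fresh D (p ∷ ys)
      alternate : ∀ x → x ∈ ys → colour x ≡ not (colour (par x))

  open Piece public

  edges-≥ : ∀ A B c d → (∀ a → A a ≡ true → c ≤ d * # (N∩ B a)) → # A * c ≤ d * edges A B
  edges-≥ A B c d le = begin
    # A * c ≡⟨ sym (∑-*ʳ V c _) ⟩
    ∑ V (λ a → ⟦ A a ⟧ * c) ≤⟨ ∑-mono V pt ⟩
    ∑ V (λ a → d * (⟦ A a ⟧ * # (N∩ B a))) ≡⟨ ∑-*ˡ V d _ ⟩
    d * edges A B ∎
    where
    open ≤-Reasoning
    pt : ∀ a → ⟦ A a ⟧ * c ≤ d * (⟦ A a ⟧ * # (N∩ B a))
    pt a with A a in eq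
    ... | true = ≤-trans (≤-reflexive (*-identityˡ c)) (≤-trans (le a eq) (*-monoʳ-≤ d (≤-reflexive (sym (*-identityˡ _)))))
    ... | false = z≤n

  dense-pos : ∀ k U → Dense k U → 0 < # U → ∀ v → 0 < # (N∩ U v)
  dense-pos k U dense pos v = n≢0⇒n>0 λ z → <⇒≱ pos (≤-trans (m≤n*m (# U) (suc k))
    (≤-trans (dense v) (≤-reflexive (trans (cong (2 * k *_) z) (*-zeroʳ (2 * k))))))

  -- Each a in X has at least |U| / k common neighbours with q, so by double counting the vertices
  -- of N(q) in U see a proportion 1/k of X on average. The root of a piece, confined to N(q), can
  -- thus reach the class intended for its children.
  connector : ∀ k U → Dense k U → 0 < # U → ∀ q X →
    ∃ λ z → N∩ U q z ≡ true × # X ≤ k * # (N∩ X z)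
  connector k U dense pos q X =
    let z , _ , w>0 , le = ∑-average V (λ z → ⟦ N∩ U q z ⟧) (λ _ → # X) (λ z → k * # (N∩ X z)) avg (dense-pos k U dense pos q)
    in z , ⟦⟧-pos w>0 , le
    where
    open ≤-Reasoning
    avg : ∑ V (λ z → ⟦ N∩ U q z ⟧ * # X) ≤ ∑ V (λ z → ⟦ N∩ U q z ⟧ * (k * # (N∩ X z)))
    avg = begin
      ∑ V (λ z → ⟦ N∩ U q z ⟧ * # X) ≡⟨ ∑-*ʳ V (# X) _ ⟩
      # (N∩ U q) * # X ≤⟨ *-monoˡ-≤ (# X) (#-mono {P = N∩ U q} {Q = U} (λ u r → ∧-l r)) ⟩
      # U * # X ≡⟨ *-comm (# U) (# X) ⟩
      # X * # U ≤⟨ edges-≥ X (N∩ U q) (# U) k (λ a _ → common-neighbours k U dense q a) ⟩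
      k * edges X (N∩ U q) ≡⟨ cong (k *_) (edges-comm X (N∩ U q)) ⟩
      k * edges (N∩ U q) X ≡⟨ sym (∑-*ˡ V k _) ⟩
      ∑ V (λ z → k * (⟦ N∩ U q z ⟧ * # (N∩ X z))) ≡⟨ ∑-cong V (λ z → *-left-comm k ⟦ N∩ U q z ⟧ _) ⟩
      ∑ V (λ z → ⟦ N∩ U q z ⟧ * (k * # (N∩ X z))) ∎

  -- cls true consists of the cheapest vertices of U, cls false of vertices of the cheaper half.
  record Classes (U : Fin n → Bool) (g : Fin n → ℕ) (h d : ℕ) : Set where
    field
      cls : Bool → Fin n → Bool
      rich : ∀ b → Rich d (cls b) (cls (not b))
      nonempty : ∀ b → 0 < # (cls b)
      cls⊂ : ∀ b → Sub (cls b) U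
      τ₁ τ₂ : ℕ
      τ≤ : τ₁ ≤ τ₂
      cls-cost : ∀ b u → cls b u ≡ true → g u ≤ (if b then τ₁ else τ₂)
      average : h * # U * (τ₁ + τ₂) ≤ 2 * suc h * ∑ V (λ u → ⟦ U u ⟧ * g u)

  -- A takes more than 4 k² s cheapest vertices and B at least half of U₀. Every vertex sees m/(2k)
  -- of B, since 1/2 + 1/(2k) and 1/2 overlap by 1/(2k). Hence A and B span more than 2 k s m edges,
  -- while d (|A| + |B|) ≤ 2 k s m for d = k s, and `rich-core` applies. Ties may enlarge A, so both
  -- sizes are bounded by m only.
  cheap-classes : ∀ k h s U₀ (g : Fin n → ℕ) → Dense k U₀ → 1 ≤ k → 1 ≤ h → 1 ≤ s → 16 * h * k * k * s < # U₀ →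
    Classes U₀ g h (k * s)
  cheap-classes k h s U₀ g dense 1≤k 1≤h 1≤s big = choose (half (# U₀))
    where
    r₁≤ : 2 * h * suc (4 * k * k * s) ≤ # U₀
    r₁≤ = ≤-trans (cert (6 * h * k * k * s) (*-monoʳ-≤ (2 * h) (*-mono-≤ 1≤k (*-mono-≤ 1≤k 1≤s))) (eq h k s)) (<⇒≤ big)
      where
      eq : ∀ h k s → 2 * h * (1 + 4 * k * k * s) + 2 * h * (k * (k * s)) + 6 * h * k * k * s ≡ 16 * h * k * k * s + 2 * h * (1 * (1 * 1))
      eq = solve-∀
    main : ∀ r₂ → # U₀ ≤ 2 * r₂ → ∀ τ₁ τ₂ → τ₁ ≤ τ₂ → suc (4 * k * k * s) ≤ # (atMost U₀ g τ₁) → r₂ ≤ # (atMost U₀ g τ₂) →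
      h * # U₀ * (τ₁ + τ₂) ≤ 2 * suc h * ∑ V (λ u → ⟦ U₀ u ⟧ * g u) → Classes U₀ g h (k * s)
    choose : (∃ λ r → 2 * r ≤ suc (# U₀) × # U₀ ≤ 2 * r) → Classes U₀ g h (k * s)
    choose (r₂ , r₂≤ , ≤r₂) =
      let τ₁ , τ₂ , τ≤ , r₁≤A , r₂≤B , average = two-thresholds U₀ g h (suc (4 * k * k * s)) r₂ (s≤s z≤n) 1≤h r₁≤ r₂≤ ≤r₂
      in main r₂ ≤r₂ τ₁ τ₂ τ≤ r₁≤A r₂≤B average
    main r₂ ≤r₂ τ₁ τ₂ τ≤ r₁≤A r₂≤B average = assemble (rich-core (# A + # B) d A B ≤-refl many-edges)
      where
      open ≤-Reasoning
      m d r₁ : ℕ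
      m = # U₀
      d = k * s
      r₁ = suc (4 * k * k * s)
      m>0 : 0 < m
      m>0 = ≤-<-trans z≤n big
      A B : Fin n → Bool
      A = atMost U₀ g τ₁
      B = atMost U₀ g τ₂
      into-half : ∀ a → m ≤ 2 * k * # (N∩ B a)
      into-half a = cert 0 (+-mono-≤ (dense a) (+-mono-≤ (*-monoʳ-≤ (2 * k) incl) (*-monoʳ-≤ k (≤-trans ≤r₂ (*-monoʳ-≤ 2 r₂≤B)))))
        (eq k m (# (N∩ U₀ a)) (# B) (# (N∩ B a)))
        where
        pt : ∀ u b c → ⟦ u ∧ c ⟧ + ⟦ u ∧ b ⟧ ≤ ⟦ u ⟧ + ⟦ (u ∧ b) ∧ c ⟧
        pt true true true = dec≤
        pt true true false = dec≤
        pt true false true = dec≤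
        pt true false false = dec≤
        pt false _ _ = dec≤
        incl : # (N∩ U₀ a) + # B ≤ m + # (N∩ B a)
        incl = ≤-trans (≤-reflexive (sym (∑-+ V _ _)))
          (≤-trans (∑-mono V (λ u → pt (U₀ u) (g u ≤ᵇ τ₂) (e a u))) (≤-reflexive (∑-+ V _ _)))
        eq : ∀ k m x b y → m + (2 * k * x + (2 * k * (m + y) + k * (2 * b))) + 0 ≡ 2 * k * y + ((1 + k) * m + (2 * k * (x + b) + k * m))
        eq = solve-∀
      many-edges : d * (# A + # B) < edges A B
      many-edges = *-cancelˡ-< (2 * k) _ _ (begin-strict
        2 * k * (d * (# A + # B)) ≤⟨ *-monoʳ-≤ (2 * k) (*-monoʳ-≤ d (+-mono-≤ (#-mono {P = A} {Q = U₀} (λ u q → ∧-l q)) (#-mono {P = B} {Q = U₀} (λ u q → ∧-l q)))) ⟩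
        2 * k * (d * (m + m))     ≡⟨ eq k s m ⟩
        4 * k * k * s * m         <⟨ m<n+m _ m>0 ⟩
        r₁ * m                    ≤⟨ *-monoˡ-≤ m r₁≤A ⟩
        # A * m                   ≤⟨ edges-≥ A B m (2 * k) (λ a _ → into-half a) ⟩
        2 * k * edges A B         ∎)
        where
        eq : ∀ k s m → 2 * k * (k * s * (m + m)) ≡ 4 * k * k * s * m
        eq = solve-∀
      assemble : (∃ λ A′ → ∃ λ B′ → Sub A′ A × Sub B′ B × Rich d A′ B′ × Rich d B′ A′ × 0 < # A′ × 0 < # B′) → Classes U₀ g h d
      assemble (A′ , B′ , A⊂ , B⊂ , rA , rB , pA , pB) = record
        { cls = λ b → if b then A′ else B′
        ; rich = λ { true → rA ; false → rB }
        ; nonempty = λ { true → pA ; false → pB }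
        ; cls⊂ = λ { true u q → ∧-l (A⊂ u q) ; false u q → ∧-l (B⊂ u q) }
        ; τ₁ = τ₁
        ; τ₂ = τ₂
        ; τ≤ = τ≤
        ; cls-cost = λ { true u q → ≤ᵇ-≤ {g u} (∧-r {U₀ u} (A⊂ u q)) ; false u q → ≤ᵇ-≤ {g u} (∧-r {U₀ u} (B⊂ u q)) }
        ; average = average
        }

  -- The majority colour class goes to the cheapest vertices, the other one to the cheaper half.
  cheap-embedding : ∀ k h {D} (st : State D) (g : Fin n → ℕ) p ys → Piece D p ys → Dense k (U st) → 1 ≤ k →
    0 < # (U st) → Classes (U st) g h (k * suc (length ys)) →
    Σ (Ext st (p ∷ ys)) λ E →
      h * # (U st) * ∑ ys (λ x → g (φ (st′ E) x)) ≤ suc h * length ys * ∑ V (λ u → ⟦ U st u ⟧ * g u)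
  cheap-embedding k h {D} st g p ys piece dense 1≤k m>0 C = choose (majority ys colour) (fresh piece)
    where
    Result : Set
    Result = Σ (Ext st (p ∷ ys)) λ E →
      h * # (U st) * ∑ ys (λ x → g (φ (st′ E) x)) ≤ suc h * length ys * ∑ V (λ u → ⟦ U st u ⟧ * g u)
    main : ∀ (f : Bool → Bool) → (∀ b → f (not b) ≡ not (f b)) → ∑ ys (λ x → ⟦ not (f (colour x)) ⟧) ≤ ∑ ys (λ x → ⟦ f (colour x) ⟧) →
      p ∉ D → Fresh (p ∷ D) ys → ∀ z → N∩ (U st) (φ st (par p)) z ≡ true →
      # (Classes.cls C (not (f (colour p)))) ≤ k * # (N∩ (Classes.cls C (not (f (colour p)))) z) → Result
    choose : (∃ λ (f : Bool → Bool) → (∀ b → f (not b) ≡ not (f b)) × ∑ ys (λ x → ⟦ not (f (colour x)) ⟧) ≤ ∑ ys (λ x → ⟦ f (colour x) ⟧)) →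
      Fresh D (p ∷ ys) → Result
    choose (f , f-not , f-maj) (p∉ ∷ fr) =
      let z , Nz , X≤ = connector k (U st) dense m>0 (φ st (par p)) (Classes.cls C (not (f (colour p))))
      in main f f-not f-maj p∉ fr z Nz X≤
    main f f-not f-maj p∉ fr z Nz X≤ = result
      where
      open ≤-Reasoning
      open Classes C
      U₀ = U st
      m s d Γ : ℕ
      m = # U₀
      s = suc (length ys)
      d = k * s
      Γ = ∑ V (λ u → ⟦ U₀ u ⟧ * g u)
      s≤d : s ≤ d
      s≤d = ≤-trans (≤-reflexive (sym (*-identityˡ s))) (*-monoˡ-≤ s 1≤k)
      isA : Fin n → Bool
      isA x = f (colour x)
      flip : ∀ x → x ∈ ys → isA x ≡ not (isA (par x))
      flip x x∈ = trans (cong f (alternate piece x x∈)) (f-not _)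
      X : Fin n → Bool
      X = cls (not (isA p))
      d<X : d < # X
      d<X with #-∃ (cls (isA p)) (nonempty (isA p))
      ... | a , q = <-≤-trans (rich (isA p) a q) (#-mono {P = N∩ X a} {Q = X} (λ u r → ∧-l r))
      Uz : U₀ z ≡ true
      Uz = ∧-l Nz
      rule : Rule
      rule x _ _ w = if x == p then w == z else cls (isA x) w
      st₁ : State (p ∷ D)
      st₁ = place st p z p∉ (attached piece) Uz (trans (e-sym z _) (∧-r {U₀ z} Nz))
      ≢p : ∀ {x} → x ∈ ys → x ≢ p
      ≢p x∈ refl = fresh-∉ fr x∈ (here refl)
      root-obeys : ∀ x → x ∈ p ∷ [] → Obeys rule (φ st₁) x
      root-obeys x (here refl) rewrite ==-refl x = ==-refl z
      -- The factor k in the minimum degree d = k s is there to pay for the connector here.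
      s<X : s < # (N∩ X z)
      s<X = *-cancelˡ-< k _ _ (<-≤-trans d<X X≤)
      within : ∀ b a {x c} → x ∈ ys → isA x ≡ b → # (N∩ (cls b) a) ≤ # (λ w → N∩ U₀ a w ∧ rule x c a w)
      within b a {x} x∈ refl rewrite ==-≢ (≢p x∈) = #-mono {P = N∩ (cls (isA x)) a} (λ u q → ∧-i (∧-i (cls⊂ (isA x) u (∧-l q)) (∧-r {cls (isA x) u} q)) (∧-l q))
      candidates : ∀ x → x ∈ ys → ∀ c b a → rule (par x) c b a ≡ true → s < # (λ w → N∩ U₀ a w ∧ rule x b a w)
      candidates x x∈ c b a ob with par x FinP.≟ p
      ... | yes eq with ==⇒≡ ob
      ... | refl = <-≤-trans s<X (within (not (isA p)) z {c = b} x∈ (trans (flip x x∈) (cong (not ∘ isA) eq)))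
      candidates x x∈ c b a ob | no _ = ≤-<-trans s≤d (<-≤-trans (rich (isA (par x)) a ob) (within (not (isA (par x))) a {c = b} x∈ (flip x x∈)))
      finish : (Σ (Ext st₁ ys) λ E → ∀ x → x ∈ ys → Obeys rule (φ (st′ E)) x) →
        Σ (Ext st (p ∷ ys)) λ E → h * m * ∑ ys (λ x → g (φ (st′ E) x)) ≤ suc h * length ys * Γ
      finish (E , obeys) = ext-∷ st p z _ _ _ _ E , cost
        where
        each : ∀ x → x ∈ ys → g (φ (st′ E) x) ≤ ⟦ isA x ⟧ * τ₁ + ⟦ not (isA x) ⟧ * τ₂
        each x x∈ = ≤-trans (cls-cost (isA x) _ (member (==-≢ (≢p x∈)) (obeys x x∈))) (val (isA x))
          where
          member : ∀ {b} {y z} → b ≡ false → (if b then y else z) ≡ true → z ≡ true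
          member refl q = q
          val : ∀ b → (if b then τ₁ else τ₂) ≤ ⟦ b ⟧ * τ₁ + ⟦ not b ⟧ * τ₂
          val true = ≤-reflexive (sym (trans (+-identityʳ _) (+-identityʳ _)))
          val false = ≤-reflexive (sym (+-identityʳ _))
        c₁ c₀ : ℕ
        c₁ = ∑ ys (λ x → ⟦ isA x ⟧)
        c₀ = ∑ ys (λ x → ⟦ not (isA x) ⟧)
        total : ∑ ys (λ x → g (φ (st′ E) x)) ≤ c₁ * τ₁ + c₀ * τ₂
        total = ≤-trans (∑-mono∈ ys each) (≤-reflexive (trans (∑-+ ys _ _) (cong₂ _+_ (∑-*ʳ ys τ₁ _) (∑-*ʳ ys τ₂ _))))
        -- The larger colour class meets the smaller threshold, so an unbalanced bipartition of the
        -- piece only helps.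
        balance : 2 * (c₁ * τ₁ + c₀ * τ₂) ≤ length ys * (τ₁ + τ₂)
        balance = subst (λ l → 2 * (c₁ * τ₁ + c₀ * τ₂) ≤ l * (τ₁ + τ₂)) (∑-indicator-split ys isA)
          (chebyshev f-maj τ≤)
          where
          eq : ∀ c γ t δ → 2 * ((c + γ) * t + c * (t + δ)) + γ * δ ≡ ((c + γ) + c) * (t + (t + δ))
          eq = solve-∀
          chebyshev : ∀ {c₀ c₁ t₁ t₂} → c₀ ≤ c₁ → t₁ ≤ t₂ → 2 * (c₁ * t₁ + c₀ * t₂) ≤ (c₁ + c₀) * (t₁ + t₂)
          chebyshev {c₀} {c₁} {t₁} {t₂} p q = subst₂ (λ c t → 2 * (c * t₁ + c₀ * t) ≤ (c + c₀) * (t₁ + t)) (m+[n∸m]≡n p) (m+[n∸m]≡n q)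
            (≤-by _ (eq c₀ (c₁ ∸ c₀) t₁ (t₂ ∸ t₁)))
        cost : h * m * ∑ ys (λ x → g (φ (st′ E) x)) ≤ suc h * length ys * Γ
        cost = *-cancelˡ-≤ 2 (begin
          2 * (h * m * ∑ ys (λ x → g (φ (st′ E) x))) ≤⟨ *-monoʳ-≤ 2 (*-monoʳ-≤ (h * m) total) ⟩
          2 * (h * m * (c₁ * τ₁ + c₀ * τ₂))          ≡⟨ e₁ (h * m) (c₁ * τ₁ + c₀ * τ₂) ⟩
          h * m * (2 * (c₁ * τ₁ + c₀ * τ₂))          ≤⟨ *-monoʳ-≤ (h * m) balance ⟩
          h * m * (length ys * (τ₁ + τ₂))            ≡⟨ *-left-comm (h * m) (length ys) (τ₁ + τ₂) ⟩
          length ys * (h * m * (τ₁ + τ₂))            ≤⟨ *-monoʳ-≤ (length ys) average ⟩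
          length ys * (2 * suc h * Γ)                ≡⟨ e₃ (length ys) (suc h) Γ ⟩
          2 * (suc h * length ys * Γ)                ∎)
          where
          e₁ : ∀ a b → 2 * (a * b) ≡ a * (2 * b)
          e₁ = solve-∀
          e₃ : ∀ a b c → a * (2 * b * c) ≡ 2 * (b * a * c)
          e₃ = solve-∀
      result : Σ (Ext st (p ∷ ys)) λ E → h * m * ∑ ys (λ x → g (φ (st′ E) x)) ≤ suc h * length ys * Γ
      result = finish (greedy rule s U₀ st₁ (p ∷ []) ys (build piece) fr (λ { x (here refl) → here refl }) root-obeys candidates
        (λ u q → ∧-l q) (≤-reflexive (trans (cong (_+ length ys) (#-⊖ U₀ z Uz)) (sym (+-suc _ (length ys))))))

  -- Placing a piece so that its absorbers serve much of a given weight.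

  markov : ∀ (P : Fin n → Bool) (f : Fin n → ℕ) m c → (∀ u → P u ≡ true → m ≤ c * f u) →
    # P * m ≤ c * ∑ V (λ u → ⟦ P u ⟧ * f u)
  markov P f m c le = ≤-trans (≤-reflexive (sym (∑-*ʳ V m (λ u → ⟦ P u ⟧))))
    (≤-trans (∑-mono V pt) (≤-reflexive (∑-*ˡ V c (λ u → ⟦ P u ⟧ * f u))))
    where
    pt : ∀ u → ⟦ P u ⟧ * m ≤ c * (⟦ P u ⟧ * f u)
    pt u with P u in eq
    ... | true = ≤-trans (≤-reflexive (*-identityˡ m)) (≤-trans (le u eq) (*-monoʳ-≤ c (≤-reflexive (sym (*-identityˡ _)))))
    ... | false = z≤n

  Pair : Set
  Pair = Fin n × Fin n

  module Weighted (is : List Pair) (w : Pair → ℕ) (k κ : ℕ) (U : Fin n → Bool) where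

    m W : ℕ
    m = # U
    W = ∑ is w

    -- In a pair, u is the vertex to which the absorber moves, and v is the vertex next to which
    -- room is wanted.
    hits : (b a b′ : Fin n) → Pair → Bool
    hits b a b′ (u , v) = (e u b ∧ e u b′) ∧ e v a

    -- An absorber at a with its neighbours at b and b′ serves a proportion 1/κ of the weight.
    tri : (b a b′ : Fin n) → Bool
    tri b a b′ = W ≤ᵇ κ * ∑ is (λ i → w i * ⟦ hits b a b′ i ⟧)

    badEnds : (B : Fin n → Bool) (b a : Fin n) → ℕ
    badEnds B b a = # (λ b′ → B b′ ∧ not (tri b a b′))

    badTriples : (A B : Fin n → Bool) → ℕ
    badTriples A B = ∑ V (λ b → ⟦ B b ⟧ * ∑ V (λ a → ⟦ A a ⟧ * badEnds B b a))

    private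
      cell : Pair → Fin n → Fin n → Fin n → ℕ
      cell (u , v) b a b′ = ⟦ N∩ U u b ⟧ * (⟦ N∩ U v a ⟧ * ⟦ N∩ U u b′ ∧ not (tri b a b′) ⟧)

      expand : ∀ u v → badTriples (N∩ U v) (N∩ U u) ≡ ∑ V (λ b → ∑ V (λ a → ∑ V (cell (u , v) b a)))
      expand u v = ∑-cong V (λ b → trans (sym (∑-*ˡ V ⟦ N∩ U u b ⟧ (λ a → ⟦ N∩ U v a ⟧ * badEnds (N∩ U u) b a)))
        (∑-cong V (λ a → trans (cong (⟦ N∩ U u b ⟧ *_) (sym (∑-*ˡ V ⟦ N∩ U v a ⟧ (λ b′ → ⟦ N∩ U u b′ ∧ not (tri b a b′) ⟧))))
          (sym (∑-*ˡ V ⟦ N∩ U u b ⟧ (λ b′ → ⟦ N∩ U v a ⟧ * ⟦ N∩ U u b′ ∧ not (tri b a b′) ⟧))))))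

      cell-≤ : ∀ i b a b′ → cell i b a b′ ≤ ⟦ U b ⟧ * (⟦ U a ⟧ * ⟦ U b′ ⟧) * (⟦ not (tri b a b′) ⟧ * ⟦ hits b a b′ i ⟧)
      cell-≤ (u , v) b a b′ = pt (U b) (U a) (U b′) (e u b) (e v a) (e u b′) (not (tri b a b′))
        where
        pt : ∀ x y z p q r s → ⟦ x ∧ p ⟧ * (⟦ y ∧ q ⟧ * ⟦ (z ∧ r) ∧ s ⟧) ≤ ⟦ x ⟧ * (⟦ y ⟧ * ⟦ z ⟧) * (⟦ s ⟧ * ⟦ (p ∧ r) ∧ q ⟧)
        pt false _ _ _ _ _ _ = z≤n
        pt true y z false q r s = z≤n
        pt true false z true q r s = z≤n
        pt true true z true false r s = z≤n
        pt true true false true true r s = z≤n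
        pt true true true true true false s = z≤n
        pt true true true true true true true = dec≤
        pt true true true true true true false = z≤n

      -- A triple that is `tri` contributes no cell at all; one that is not is hit by pairs of
      -- weight less than W / κ.
      cell-sum : ∀ b a b′ → κ * ∑ is (λ i → w i * cell i b a b′) ≤ W * (⟦ U b ⟧ * (⟦ U a ⟧ * ⟦ U b′ ⟧))
      cell-sum b a b′ = ≤-trans (*-monoʳ-≤ κ (∑-mono is (λ i → *-monoʳ-≤ (w i) (cell-≤ i b a b′)))) (bound (tri b a b′) refl)
        where
        open ≤-Reasoning
        T₀ : ℕ
        T₀ = ⟦ U b ⟧ * (⟦ U a ⟧ * ⟦ U b′ ⟧)
        H : ℕ
        H = ∑ is (λ i → w i * ⟦ hits b a b′ i ⟧)
        e₁ : ∀ w T s h → w * (T * (s * h)) ≡ T * s * (w * h)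
        e₁ = solve-∀
        e₂ : ∀ k T h → k * (T * h) ≡ k * h * T
        e₂ = solve-∀
        bound : ∀ c → tri b a b′ ≡ c → κ * ∑ is (λ i → w i * (T₀ * (⟦ not c ⟧ * ⟦ hits b a b′ i ⟧))) ≤ W * T₀
        bound c eq = ≤-trans (≤-reflexive (cong (κ *_) (trans (∑-cong is (λ i → e₁ (w i) T₀ ⟦ not c ⟧ _)) (∑-*ˡ is (T₀ * ⟦ not c ⟧) _)))) (fin c eq)
          where
          fin : ∀ c → tri b a b′ ≡ c → κ * (T₀ * ⟦ not c ⟧ * H) ≤ W * T₀
          fin true _ = ≤-trans (≤-reflexive (trans (cong (λ z → κ * (z * H)) (*-zeroʳ T₀)) (*-zeroʳ κ))) z≤n
          fin false eq = begin
            κ * (T₀ * 1 * H) ≡⟨ cong (λ z → κ * (z * H)) (*-identityʳ T₀) ⟩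
            κ * (T₀ * H) ≡⟨ e₂ κ T₀ H ⟩
            κ * H * T₀ ≤⟨ *-monoˡ-≤ T₀ (<⇒≤ (≤ᵇ-> {W} eq)) ⟩
            W * T₀ ∎

      cube : ∑ V (λ b → ∑ V (λ a → ∑ V (λ b′ → W * (⟦ U b ⟧ * (⟦ U a ⟧ * ⟦ U b′ ⟧))))) ≡ W * (m * (m * m))
      cube = trans (∑-cong V (λ b → trans (∑-cong V (λ a → trans (∑-*ˡ V W (λ b′ → ⟦ U b ⟧ * (⟦ U a ⟧ * ⟦ U b′ ⟧)))
                 (cong (W *_) (trans (∑-*ˡ V ⟦ U b ⟧ (λ b′ → ⟦ U a ⟧ * ⟦ U b′ ⟧)) (cong (⟦ U b ⟧ *_) (∑-*ˡ V ⟦ U a ⟧ (λ b′ → ⟦ U b′ ⟧)))))))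
               (trans (∑-*ˡ V W (λ a → ⟦ U b ⟧ * (⟦ U a ⟧ * m)))
                 (cong (W *_) (trans (∑-*ˡ V ⟦ U b ⟧ (λ a → ⟦ U a ⟧ * m)) (cong (⟦ U b ⟧ *_) (∑-*ʳ V m (λ a → ⟦ U a ⟧))))))))
             (trans (∑-*ˡ V W (λ b → ⟦ U b ⟧ * (m * m))) (cong (W *_) (∑-*ʳ V (m * m) (λ b → ⟦ U b ⟧))))

      push : ∀ (f : Pair → Fin n → ℕ) → ∑ is (λ i → w i * ∑ V (f i)) ≡ ∑ V (λ b → ∑ is (λ i → w i * f i b))
      push f = trans (∑-cong is (λ i → sym (∑-*ˡ V (w i) (f i)))) (∑-swap is V (λ i b → w i * f i b))

      total : κ * ∑ is (λ i → w i * badTriples (N∩ U (proj₂ i)) (N∩ U (proj₁ i))) ≤ W * (m * (m * m))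
      total = begin
        κ * ∑ is (λ i → w i * badTriples (N∩ U (proj₂ i)) (N∩ U (proj₁ i)))
          ≡⟨ cong (κ *_) (∑-cong is (λ i → cong (w i *_) (expand (proj₁ i) (proj₂ i)))) ⟩
        κ * ∑ is (λ i → w i * ∑ V (λ b → ∑ V (λ a → ∑ V (cell i b a))))
          ≡⟨ cong (κ *_) (trans (push (λ i b → ∑ V (λ a → ∑ V (cell i b a)))) (∑-cong V (λ b →
               trans (push (λ i a → ∑ V (cell i b a))) (∑-cong V (λ a → push (λ i b′ → cell i b a b′)))))) ⟩
        κ * ∑ V (λ b → ∑ V (λ a → ∑ V (λ b′ → ∑ is (λ i → w i * cell i b a b′))))
          ≡⟨ trans (sym (∑-*ˡ V κ _)) (∑-cong V (λ b → trans (sym (∑-*ˡ V κ _)) (∑-cong V (λ a → sym (∑-*ˡ V κ _))))) ⟩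
        ∑ V (λ b → ∑ V (λ a → ∑ V (λ b′ → κ * ∑ is (λ i → w i * cell i b a b′))))
          ≤⟨ ∑-mono V (λ b → ∑-mono V (λ a → ∑-mono V (λ b′ → cell-sum b a b′))) ⟩
        ∑ V (λ b → ∑ V (λ a → ∑ V (λ b′ → W * (⟦ U b ⟧ * (⟦ U a ⟧ * ⟦ U b′ ⟧)))))
          ≡⟨ cube ⟩
        W * (m * (m * m)) ∎
        where open ≤-Reasoning

    -- Draw a pair with probability proportional to its weight: each of the m³ triples that fails
    -- `tri` lies in the resulting classes with probability less than 1/κ. Some pair does no worse
    -- than this expectation.
    few-bad-triples : 0 < W → ∃ λ u → ∃ λ v → κ * badTriples (N∩ U v) (N∩ U u) ≤ m * (m * m)
    few-bad-triples W>0 =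
      let i , _ , _ , le = ∑-average is w (λ i → κ * badTriples (N∩ U (proj₂ i)) (N∩ U (proj₁ i))) (λ _ → m * (m * m))
            (≤-trans (≤-reflexive (trans (∑-cong is (λ i → *-left-comm (w i) κ _)) (∑-*ˡ is κ _)))
              (≤-trans total (≤-reflexive (sym (∑-*ʳ is (m * (m * m)) w))))) W>0
      in proj₁ i , proj₂ i , le

    -- Absorber vertices will be placed in A and their tree neighbours in B.
    record Targets : Set where
      field
        A B : Fin n → Bool
        A⊂ : Sub A U
        B⊂ : Sub B U
        sees-A : ∀ x → m ≤ k * # (N∩ A x)
        sees-B : ∀ x → m ≤ k * # (N∩ B x)
        goodEnd : Fin n → Bool
        goodPair : Fin n → Fin n → Bool
        few-ends : 8 * k * # (λ b → B b ∧ not (goodEnd b)) ≤ m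
        few-pairs : ∀ b → goodEnd b ≡ true → 8 * k * # (λ a → A a ∧ not (goodPair b a)) ≤ m
        few-triples : ∀ b a → goodPair b a ≡ true → 8 * k * # (λ b′ → B b′ ∧ not (tri b a b′)) ≤ m

    -- κ = (8k)³ pays for three applications of Markov's inequality: exceptional third vertices,
    -- exceptional pairs and exceptional ends may each number m/(8k).
    targets : κ ≡ 512 * (k * (k * k)) → Dense k U → 1 ≤ k → 0 < m → 0 < W → Targets
    targets κ≡ dense 1≤k m>0 W>0 = let u , v , le = few-bad-triples W>0 in assemble u v le
      where
      assemble : ∀ u v → κ * badTriples (N∩ U v) (N∩ U u) ≤ m * (m * m) → Targets
      assemble u v few = record
        { A = A
        ; B = B
        ; A⊂ = λ x q → ∧-l q
        ; B⊂ = λ x q → ∧-l q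
        ; sees-A = λ x → common-neighbours k U dense v x
        ; sees-B = λ x → common-neighbours k U dense u x
        ; goodEnd = goodEnd
        ; goodPair = goodPair
        ; few-ends = few-ends
        ; few-pairs = λ b q → ≤ᵇ-≤ {8 * k * badPairs b} q
        ; few-triples = λ b a q → ≤ᵇ-≤ {8 * k * badEnds B b a} q
        }
        where
        A B : Fin n → Bool
        A = N∩ U v
        B = N∩ U u
        goodPair : Fin n → Fin n → Bool
        goodPair b a = 8 * k * badEnds B b a ≤ᵇ m
        badPairs : Fin n → ℕ
        badPairs b = # (λ a → A a ∧ not (goodPair b a))
        goodEnd : Fin n → Bool
        goodEnd b = 8 * k * badPairs b ≤ᵇ m
        N : ℕ
        N = # (λ b → B b ∧ not (goodEnd b))
        weaken : ∀ x y z → ⟦ x ∧ y ⟧ * z ≤ ⟦ x ⟧ * z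
        weaken true true z = ≤-refl
        weaken true false z = z≤n
        weaken false y z = z≤n
        pairs-step : ∀ b → badPairs b * m ≤ 8 * k * ∑ V (λ a → ⟦ A a ⟧ * badEnds B b a)
        pairs-step b = ≤-trans (markov (λ a → A a ∧ not (goodPair b a)) (badEnds B b) m (8 * k) (λ a q → <⇒≤ (≤ᵇ-> {8 * k * badEnds B b a} (not-e (∧-r {A a} q)))))
          (*-monoʳ-≤ (8 * k) (∑-mono V (λ a → weaken (A a) (not (goodPair b a)) _)))
        ends-step : N * (m * m) ≤ 8 * k * (8 * k) * badTriples A B
        ends-step = ≤-trans (markov (λ b → B b ∧ not (goodEnd b)) (λ b → ∑ V (λ a → ⟦ A a ⟧ * badEnds B b a)) (m * m) (8 * k * (8 * k)) step)
          (*-monoʳ-≤ (8 * k * (8 * k)) (∑-mono V (λ b → weaken (B b) (not (goodEnd b)) _)))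
          where
          step : ∀ b → (B b ∧ not (goodEnd b)) ≡ true → m * m ≤ 8 * k * (8 * k) * ∑ V (λ a → ⟦ A a ⟧ * badEnds B b a)
          step b q = ≤-trans (*-monoˡ-≤ m (<⇒≤ (≤ᵇ-> {8 * k * badPairs b} (not-e (∧-r {B b} q)))))
            (≤-trans (≤-reflexive (*-assoc (8 * k) (badPairs b) m)) (≤-trans (*-monoʳ-≤ (8 * k) (pairs-step b)) (≤-reflexive (sym (*-assoc (8 * k) (8 * k) _)))))
        few-ends : 8 * k * N ≤ m
        few-ends = *-cancelˡ-≤ (64 * (k * k) * (m * m)) {{>-nonZero pos}} (begin
          64 * (k * k) * (m * m) * (8 * k * N)            ≡⟨ e₁ k m N ⟩
          512 * (k * (k * k)) * (N * (m * m))             ≡⟨ cong (_* (N * (m * m))) (sym κ≡) ⟩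
          κ * (N * (m * m))                               ≤⟨ *-monoʳ-≤ κ ends-step ⟩
          κ * (8 * k * (8 * k) * badTriples A B)          ≡⟨ e₂ κ k (badTriples A B) ⟩
          64 * (k * k) * (κ * badTriples A B)             ≤⟨ *-monoʳ-≤ (64 * (k * k)) few ⟩
          64 * (k * k) * (m * (m * m))                    ≡⟨ e₃ (64 * (k * k)) m ⟩
          64 * (k * k) * (m * m) * m                      ∎)
          where
          open ≤-Reasoning
          pos : 0 < 64 * (k * k) * (m * m)
          pos = *-mono-≤ {1} (*-mono-≤ {1} {64} dec≤ (*-mono-≤ 1≤k 1≤k)) (*-mono-≤ m>0 m>0)
          e₁ : ∀ k m N → 64 * (k * k) * (m * m) * (8 * k * N) ≡ 512 * (k * (k * k)) * (N * (m * m))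
          e₁ = solve-∀
          e₂ : ∀ c k x → c * (8 * k * (8 * k) * x) ≡ 64 * (k * k) * (c * x)
          e₂ = solve-∀
          e₃ : ∀ c m → c * (m * (m * m)) ≡ c * (m * m) * m
          e₃ = solve-∀

  private
    -- A vertex sees m/k = 8 m/(8k) of a class; the two kinds of exceptions and the s used vertices
    -- take at most m/(8k) each.
    enough : ∀ k m s x c y₁ y₂ → 0 < m → m ≤ k * x → x ≤ c + (y₁ + y₂) → 8 * k * y₁ ≤ m → 8 * k * y₂ ≤ m → 8 * k * s ≤ m → s < c
    enough k m s x c y₁ y₂ m>0 h₁ h₂ h₃ h₄ h₅ = *-cancelˡ-< (8 * k) s c (cert (4 * m) (+-mono-≤ m>0 (+-mono-≤ (*-monoʳ-≤ 8 h₁) (+-mono-≤ (*-monoʳ-≤ (8 * k) h₂) (+-mono-≤ h₃ (+-mono-≤ h₄ h₅)))))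
      (eq k m s x c y₁ y₂))
      where
      eq : ∀ k m s x c y₁ y₂ → 1 + 8 * k * s + (m + (8 * (k * x) + (8 * k * (c + (y₁ + y₂)) + (m + (m + m))))) + 4 * m ≡
        8 * k * c + (1 + (8 * m + (8 * k * x + (8 * k * y₁ + (8 * k * y₂ + 8 * k * s)))))
      eq = solve-∀

    discard : ∀ (X g₁ g₂ : Fin n → Bool) a → # (N∩ X a) ≤ # (λ w → N∩ X a w ∧ (g₁ w ∧ g₂ w)) + (# (λ w → X w ∧ not (g₁ w)) + # (λ w → X w ∧ not (g₂ w)))
    discard X g₁ g₂ a = ≤-trans (∑-mono V (λ w → pt (X w) (e a w) (g₁ w) (g₂ w)))
      (≤-reflexive (trans (∑-+ V (λ w → ⟦ N∩ X a w ∧ (g₁ w ∧ g₂ w) ⟧) (λ w → ⟦ X w ∧ not (g₁ w) ⟧ + ⟦ X w ∧ not (g₂ w) ⟧))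
        (cong (# (λ w → N∩ X a w ∧ (g₁ w ∧ g₂ w)) +_) (∑-+ V (λ w → ⟦ X w ∧ not (g₁ w) ⟧) (λ w → ⟦ X w ∧ not (g₂ w) ⟧)))))
      where
      pt : ∀ x y p q → ⟦ x ∧ y ⟧ ≤ ⟦ (x ∧ y) ∧ (p ∧ q) ⟧ + (⟦ x ∧ not p ⟧ + ⟦ x ∧ not q ⟧)
      pt false y p q = z≤n
      pt true false p q = z≤n
      pt true true true true = dec≤
      pt true true true false = dec≤
      pt true true false q = s≤s z≤n

    none : ∀ (X : Fin n → Bool) → # (λ w → X w ∧ not true) ≡ 0
    none X = trans (∑-cong V (λ w → cong ⟦_⟧ (∧-zeroʳ (X w)))) (∑-0 V)

  -- The layers of goodness make the rule hereditary: a good end in B has few bad pairs, so its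
  -- children fit into A with good pairs; a good pair has few bad triples, so the next children fit
  -- into B and complete `tri` triples at good ends again.
  absorbing-embedding : ∀ k κ is w {D} (st : State D) p ys (f : Bool → Bool) → (∀ b → f (not b) ≡ not (f b)) → Piece D p ys →
    (tg : Weighted.Targets is w k κ (U st)) → 0 < # (U st) → 8 * k * suc (length ys) ≤ # (U st) →
    Σ (Ext st (p ∷ ys)) λ E →
      (∀ x → x ∈ ys → f (colour x) ≡ true → Weighted.Targets.goodPair tg (φ (st′ E) (par x)) (φ (st′ E) x) ≡ true) ×
      (∀ x → x ∈ ys → f (colour x) ≡ false → par x ≢ p →
        Weighted.tri is w k κ (U st) (φ (st′ E) (par (par x))) (φ (st′ E) (par x)) (φ (st′ E) x) ≡ true)
  absorbing-embedding k κ is w {D} st p ys f f-not piece tg m>0 big = start (fresh piece) (root-choice (isA p) refl)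
    where
    open Weighted is w k κ (U st) hiding (Targets)
    open Weighted.Targets tg
    s : ℕ
    s = suc (length ys)
    isA : Fin n → Bool
    isA x = f (colour x)
    flip : ∀ x → x ∈ ys → isA x ≡ not (isA (par x))
    flip x x∈ = trans (cong f (alternate piece x x∈)) (f-not _)
    -- At p, and at its children if p goes to A, the pair or triple would involve images outside the
    -- piece, about which nothing is known; hence the exemptions.
    rule : Rule
    rule x g b w = if isA x then A w ∧ (x == p ∨ goodPair b w) else (B w ∧ goodEnd w) ∧ ((x == p ∨ par x == p) ∨ tri g b w)
    0≤m : 8 * k * 0 ≤ m
    0≤m = ≤-trans (≤-reflexive (*-zeroʳ (8 * k))) z≤n
    room-A : ∀ a (g : Fin n → Bool) → 8 * k * # (λ w → A w ∧ not (g w)) ≤ m → s < # (λ w → N∩ A a w ∧ (g w ∧ true))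
    room-A a g few = enough k m s (# (N∩ A a)) _ _ _ m>0 (sees-A a) (discard A g (λ _ → true) a) few
      (≤-trans (≤-reflexive (cong (8 * k *_) (none A))) 0≤m) big
    room-B : ∀ a (g : Fin n → Bool) → 8 * k * # (λ w → B w ∧ not (g w)) ≤ m → s < # (λ w → N∩ B a w ∧ (goodEnd w ∧ g w))
    room-B a g few = enough k m s (# (N∩ B a)) _ _ _ m>0 (sees-B a) (discard B goodEnd g a) few-ends few big
    root-choice : ∀ c → isA p ≡ c → ∃ λ z → N∩ (U st) (φ st (par p)) z ≡ true × (∀ g b → rule p g b z ≡ true)
    root-choice true eq =
      let z , q = #-∃ (λ w → N∩ A (φ st (par p)) w ∧ (true ∧ true)) (≤-<-trans z≤n (room-A (φ st (par p)) (λ _ → true) (≤-trans (≤-reflexive (cong (8 * k *_) (none A))) 0≤m)))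
          Az = ∧-l (∧-l q)
      in z , ∧-i (A⊂ z Az) (∧-r {A z} (∧-l q)) , λ g b → good g b z Az
      where
      good : ∀ g b z → A z ≡ true → rule p g b z ≡ true
      good g b z Az = if-true eq (∧-i Az (∨-l (==-refl p)))
    root-choice false eq =
      let z , q = #-∃ (λ w → N∩ B (φ st (par p)) w ∧ (goodEnd w ∧ true)) (≤-<-trans z≤n (room-B (φ st (par p)) (λ _ → true) (≤-trans (≤-reflexive (cong (8 * k *_) (none B))) 0≤m)))
          Bz = ∧-l (∧-l q)
      in z , ∧-i (B⊂ z Bz) (∧-r {B z} (∧-l q)) , λ g b → good g b z Bz (∧-l (∧-r {N∩ B (φ st (par p)) z} q))
      where
      good : ∀ g b z → B z ≡ true → goodEnd z ≡ true → rule p g b z ≡ true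
      good g b z Bz gz = if-false eq (∧-i (∧-i Bz gz) (∨-l (∨-l (==-refl p))))
    Result : Set
    Result = Σ (Ext st (p ∷ ys)) λ E →
      (∀ x → x ∈ ys → isA x ≡ true → goodPair (φ (st′ E) (par x)) (φ (st′ E) x) ≡ true) ×
      (∀ x → x ∈ ys → isA x ≡ false → par x ≢ p → tri (φ (st′ E) (par (par x))) (φ (st′ E) (par x)) (φ (st′ E) x) ≡ true)
    start : Fresh D (p ∷ ys) → (∃ λ z → N∩ (U st) (φ st (par p)) z ≡ true × (∀ g b → rule p g b z ≡ true)) → Result
    start (p∉ ∷ fr) (z , Nz , root-ok) = finish
      (greedy rule s (U st) st₁ (p ∷ []) ys (build piece) fr (λ { x (here refl) → here refl }) root-obeys candidates
        (λ u q → ∧-l q) (≤-reflexive (trans (cong (_+ length ys) (#-⊖ (U st) z (∧-l Nz))) (sym (+-suc _ (length ys))))))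
      where
      st₁ : State (p ∷ D)
      st₁ = place st p z p∉ (attached piece) (∧-l Nz) (trans (e-sym z _) (∧-r {U st z} Nz))
      ≢p : ∀ {x} → x ∈ ys → x ≢ p
      ≢p x∈ refl = fresh-∉ fr x∈ (here refl)
      root-obeys : ∀ x → x ∈ p ∷ [] → Obeys rule (φ st₁) x
      root-obeys x (here refl) = trans (cong (rule x (φ st₁ (par (par x))) (φ st₁ (par x))) (upd-same (φ st) x z)) (root-ok _ _)
      rule-A : ∀ x {g b a} → isA x ≡ true → rule x g b a ≡ true → A a ≡ true × (x == p ≡ true ⊎ goodPair b a ≡ true)
      rule-A x {g} {b} {a} eq ob = let q = from-true eq ob in ∧-l q , ∨-e (∧-r {A a} q)
      rule-B : ∀ x {g b a} → isA x ≡ false → rule x g b a ≡ true →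
        goodEnd a ≡ true × ((x == p ∨ par x == p) ≡ true ⊎ tri g b a ≡ true)
      rule-B x {g} {b} {a} eq ob = let q = from-false {isA x} {A a ∧ (x == p ∨ goodPair b a)} eq ob in ∧-r {B a} (∧-l q) , ∨-e (∧-r {B a ∧ goodEnd a} q)
      rule-A-i : ∀ x {g b a} → isA x ≡ true → A a ≡ true → goodPair b a ≡ true → rule x g b a ≡ true
      rule-A-i x {g} {b} {a} eq Aa gp = if-true eq (∧-i Aa (∨-r {x == p} gp))
      rule-B-i : ∀ x {g b a} → isA x ≡ false → B a ≡ true → goodEnd a ≡ true → ((par x == p) ∨ tri g b a) ≡ true → rule x g b a ≡ true
      rule-B-i x {g} {b} {a} eq Ba ge r = if-false eq (∧-i (∧-i Ba ge) (reassoc (x == p) r))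
        where
        reassoc : ∀ c {d e} → d ∨ e ≡ true → (c ∨ d) ∨ e ≡ true
        reassoc true _ = refl
        reassoc false q = q
      candidates : ∀ x → x ∈ ys → ∀ g b a → rule (par x) g b a ≡ true → s < # (λ w → N∩ (U st) a w ∧ rule x b a w)
      candidates x x∈ g b a ob = by (bool-split (isA x))
        where
        par-not : ∀ {c} → isA x ≡ c → isA (par x) ≡ not c
        par-not eq = trans (sym (not-involutive _)) (cong not (trans (sym (flip x x∈)) eq))
        by : isA x ≡ true ⊎ isA x ≡ false → s < # (λ w → N∩ (U st) a w ∧ rule x b a w)
        by (inj₁ eq) = <-≤-trans (room-A a (goodPair a) (few-pairs a (proj₁ (rule-B (par x) {g} {b} {a} (par-not eq) ob))))
          (#-mono {P = λ w → N∩ A a w ∧ (goodPair a w ∧ true)} (λ u q → ∧-i (∧-i (A⊂ u (∧-l (∧-l q))) (∧-r {A u} (∧-l q)))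
            (rule-A-i x eq (∧-l (∧-l q)) (∧-l (∧-r {N∩ A a u} q)))))
        by (inj₂ eq) = <-≤-trans (room-B a (λ w → (par x == p) ∨ tri b a w) (few (proj₂ (rule-A (par x) {g} {b} {a} (par-not eq) ob))))
          (#-mono {P = λ w → N∩ B a w ∧ (goodEnd w ∧ ((par x == p) ∨ tri b a w))} (λ u q → ∧-i (∧-i (B⊂ u (∧-l (∧-l q))) (∧-r {B u} (∧-l q)))
            (rule-B-i x eq (∧-l (∧-l q)) (∧-l (∧-r {N∩ B a u} q)) (∧-r {goodEnd u} (∧-r {N∩ B a u} q)))))
          where
          few : par x == p ≡ true ⊎ goodPair b a ≡ true → 8 * k * # (λ w → B w ∧ not ((par x == p) ∨ tri b a w)) ≤ m
          few (inj₁ r) rewrite r = ≤-trans (≤-reflexive (cong (8 * k *_) (none B))) 0≤m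
          few (inj₂ gp) = ≤-trans (*-monoʳ-≤ (8 * k) (#-mono {P = λ w → B w ∧ not ((par x == p) ∨ tri b a w)} {Q = λ w → B w ∧ not (tri b a w)}
            (λ u q → ∧-i (∧-l q) (weaken (par x == p) (∧-r {B u} q))))) (few-triples b a gp)
            where
            weaken : ∀ c {d} → not (c ∨ d) ≡ true → not d ≡ true
            weaken false q = q
      finish : (Σ (Ext st₁ ys) λ E → ∀ x → x ∈ ys → Obeys rule (φ (st′ E)) x) → Result
      finish (E , obeys) = ext-∷ st p z _ _ _ _ E , pairs , triples
        where
        pairs : ∀ x → x ∈ ys → isA x ≡ true → goodPair (φ (st′ E) (par x)) (φ (st′ E) x) ≡ true
        pairs x x∈ eq = pick (proj₂ (rule-A x {φ (st′ E) (par (par x))} eq (obeys x x∈)))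
          where
          pick : ∀ {X : Set} → x == p ≡ true ⊎ X → X
          pick (inj₁ q) = ⊥-elim (≢p x∈ (==⇒≡ q))
          pick (inj₂ q) = q
        triples : ∀ x → x ∈ ys → isA x ≡ false → par x ≢ p → tri (φ (st′ E) (par (par x))) (φ (st′ E) (par x)) (φ (st′ E) x) ≡ true
        triples x x∈ eq ne = pick (proj₂ (rule-B x eq (obeys x x∈)))
          where
          pick : ∀ {X : Set} → (x == p ∨ par x == p) ≡ true ⊎ X → X
          pick (inj₁ q) with ∨-e q
          ... | inj₁ r = ⊥-elim (≢p x∈ (==⇒≡ r))
          ... | inj₂ r = ⊥-elim (ne (==⇒≡ r))
          pick (inj₂ q) = q

  -- y can be moved to u, which frees a neighbour of v.
  absorbs : (Fin n → Fin n) → Fin n → Pair → Bool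
  absorbs φ y (u , v) = e v (φ y) ∧ every V (λ z → not (nbr y z) ∨ e u (φ z))

  -- Besides its parent, such a vertex has at most one neighbour, matching the two places b and b′
  -- in `hits`. Keeping the child inside the piece makes its image part of the same placement.
  record Absorber (ys : List (Fin n)) (y : Fin n) : Set where
    field
      inside : y ∈ ys
      only-child : ∀ z z′ → par z ≡ y → par z′ ≡ y → z ≡ z′
      child-inside : ∀ z → par z ≡ y → z ∈ ys

  open Absorber public

  -- If y has a child, the images of parent, y and child form a `tri` triple, and hitting it means
  -- absorbing. A leaf has no third vertex, but its good pair leaves some b′ that completes a `tri`
  -- triple, and hitting that is more than a leaf requires.
  absorber-reward : ∀ k κ is w → κ ≡ 512 * (k * (k * k)) → ∀ {D} (st : State D) p ys (f : Bool → Bool) → (∀ b → f (not b) ≡ not (f b)) → Piece D p ys →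
    Dense k (U st) → 1 ≤ k → 0 < # (U st) → 8 * k * suc (length ys) ≤ # (U st) → 0 < ∑ is w →
    Σ (Ext st (p ∷ ys)) λ E →
      (∀ y → Absorber ys y → f (colour y) ≡ true →
        ∑ is w ≤ κ * ∑ is (λ i → w i * ⟦ absorbs (φ (st′ E)) y i ⟧))
  absorber-reward k κ is w κ≡ {D} st p ys f f-not piece dense 1≤k m>0 big W>0 =
    let E , pairs , triples = absorbing-embedding k κ is w st p ys f f-not piece tg m>0 big
    in E , reward E pairs triples
    where
    open Weighted is w k κ (U st) hiding (Targets)
    tg : Weighted.Targets is w k κ (U st)
    tg = targets κ≡ dense 1≤k m>0 W>0
    open Weighted.Targets tg
    reward : (E : Ext st (p ∷ ys)) →
      (∀ x → x ∈ ys → f (colour x) ≡ true → goodPair (φ (st′ E) (par x)) (φ (st′ E) x) ≡ true) →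
      (∀ x → x ∈ ys → f (colour x) ≡ false → par x ≢ p → tri (φ (st′ E) (par (par x))) (φ (st′ E) (par x)) (φ (st′ E) x) ≡ true) →
      ∀ y → Absorber ys y → f (colour y) ≡ true → W ≤ κ * ∑ is (λ i → w i * ⟦ absorbs (φ (st′ E)) y i ⟧)
    reward E pairs triples y ab fy = by (FinP.any? (λ z → par z FinP.≟ y))
      where
      ψ = φ (st′ E)
      b = ψ (par y)
      a = ψ y
      from-tri : ∀ b′ → tri b a b′ ≡ true → (∀ z → par z ≡ y → ψ z ≡ b′) → W ≤ κ * ∑ is (λ i → w i * ⟦ absorbs ψ y i ⟧)
      from-tri b′ tr child = ≤-trans (≤ᵇ-≤ {W} tr) (*-monoʳ-≤ κ (∑-mono is (λ i → *-monoʳ-≤ (w i) (⟦⟧-mono (imp i)))))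
        where
        imp : ∀ i → hits b a b′ i ≡ true → absorbs ψ y i ≡ true
        imp (u , v) h = ∧-i (∧-r {e u b ∧ e u b′} h) (every-i V each)
          where
          each : ∀ z → not (nbr y z) ∨ e u (ψ z) ≡ true
          each z = guard (nbr y z) (λ eq → at (nbr-par y z eq))
            where
            at : z ≡ par y ⊎ par z ≡ y → e u (ψ z) ≡ true
            at (inj₁ refl) = ∧-l (∧-l h)
            at (inj₂ pz) = subst (λ c → e u c ≡ true) (sym (child z pz)) (∧-r {e u b} (∧-l h))
      ≢p : ∀ {x} → x ∈ ys → x ≢ p
      ≢p = fresh-head (fresh piece)
      by : Dec (∃ λ z → par z ≡ y) → W ≤ κ * ∑ is (λ i → w i * ⟦ absorbs ψ y i ⟧)
      by (yes (z , pz)) = from-tri (ψ z) (subst (λ q → tri (ψ (par q)) (ψ q) (ψ z) ≡ true) pz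
          (triples z z∈ fz (λ eq → ≢p (inside ab) (trans (sym pz) eq))))
        (λ z′ pz′ → cong ψ (only-child ab z′ z pz′ pz))
        where
        z∈ = child-inside ab z pz
        fz : f (colour z) ≡ false
        fz = trans (cong f (alternate piece z z∈)) (trans (f-not _) (trans (cong (not ∘ f ∘ colour) pz) (cong not fy)))
      by (no none′) =
        let b′ , q = #-∃ (λ w → N∩ B a w ∧ (goodEnd w ∧ tri b a w)) (≤-<-trans z≤n
              (enough k m (suc (length ys)) (# (N∩ B a)) _ _ _ m>0 (sees-B a) (discard B goodEnd (tri b a) a) few-ends (few-triples b a (pairs y (inside ab) fy)) big))
        in from-tri b′ (∧-r {goodEnd b′} (∧-r {N∩ B a b′} q)) (λ z pz → ⊥-elim (none′ (z , pz)))

  -- The balance potential and one step of it.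

  far : (Fin n → Bool) → Fin n → ℕ
  far U v = # (λ u → U u ∧ not (e v u))

  near+far : ∀ U v → # (N∩ U v) + far U v ≡ # U
  near+far U v = trans (sym (∑-+ V (λ u → ⟦ N∩ U v u ⟧) (λ u → ⟦ U u ∧ not (e v u) ⟧))) (∑-cong V (λ u → pt (U u) (e v u)))
    where
    pt : ∀ a b → ⟦ a ∧ b ⟧ + ⟦ a ∧ not b ⟧ ≡ ⟦ a ⟧
    pt true true = refl
    pt true false = refl
    pt false b = refl

  far-ext : ∀ {D xs} {st : State D} (E : Ext st xs) v →
    far (U st) v ≡ ∑ xs (λ x → ⟦ not (e v (φ (st′ E) x)) ⟧) + far (U (st′ E)) v
  far-ext {D} {xs} {st} E v = trans (tot (U st)) (trans (conserve E (λ u → ⟦ not (e v u) ⟧))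
    (cong (∑ xs (λ x → ⟦ not (e v (φ (st′ E) x)) ⟧) +_) (sym (tot (U (st′ E))))))
    where
    tot : ∀ P → far P v ≡ ∑ V (λ u → ⟦ P u ⟧ * ⟦ not (e v u) ⟧)
    tot P = ∑-cong V (λ u → ⟦∧⟧ (P u) (not (e v u)))

  -- load U v / # U is 1 + the proportion of U that v does not see.
  load : (Fin n → Bool) → Fin n → ℕ
  load U v = # U + far U v

  -- A smooth substitute for the maximum load. All loads lie between # U and 2 # U, so a piece that
  -- is small compared with U changes each of them by a factor close to 1, as the linearisation
  -- requires.
  potential : ℕ → (Fin n → Bool) → ℕ
  potential j U = ∑ V (λ v → load U v ^ suc j)

  module _ (c j k : ℕ) {D} (st : State D) (p : Fin n) (ys : List (Fin n)) where

    private
      h s m W Γ Φ : ℕ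
      h = suc c
      s = suc (length ys)
      m = # (U st)
      w : Fin n → ℕ
      w v = load (U st) v ^ j
      -- Taking u is charged to the vertices that see it, most heavily to those that already see
      -- little of U.
      g : Fin n → ℕ
      g u = ∑ V (λ v → w v * ⟦ e v u ⟧)
      W = ∑ V w
      Γ = ∑ V (λ u → ⟦ U st u ⟧ * g u)
      Φ = potential j (U st)

      Γ-swap : Γ ≡ ∑ V (λ v → w v * # (N∩ (U st) v))
      Γ-swap = begin-equality
        Γ ≡⟨ ∑-cong V (λ u → sym (∑-*ˡ V ⟦ U st u ⟧ (λ v → w v * ⟦ e v u ⟧))) ⟩
        ∑ V (λ u → ∑ V (λ v → ⟦ U st u ⟧ * (w v * ⟦ e v u ⟧))) ≡⟨ ∑-swap V V (λ u v → ⟦ U st u ⟧ * (w v * ⟦ e v u ⟧)) ⟩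
        ∑ V (λ v → ∑ V (λ u → ⟦ U st u ⟧ * (w v * ⟦ e v u ⟧))) ≡⟨ ∑-cong V (λ v → trans (∑-cong V (λ u → pt ⟦ U st u ⟧ (w v) (U st u) (e v u) refl)) (∑-*ˡ V (w v) (λ u → ⟦ N∩ (U st) v u ⟧))) ⟩
        ∑ V (λ v → w v * # (N∩ (U st) v)) ∎
        where
        open ≤-Reasoning
        pt : ∀ x y a b → x ≡ ⟦ a ⟧ → x * (y * ⟦ b ⟧) ≡ y * ⟦ a ∧ b ⟧
        pt x y a b refl = trans (*-left-comm ⟦ a ⟧ y ⟦ b ⟧) (cong (y *_) (sym (⟦∧⟧ a b)))

      Γ+Φ : Γ + Φ ≡ 2 * m * W
      Γ+Φ = trans (cong (_+ Φ) Γ-swap) (trans (sym (∑-+ V (λ v → w v * # (N∩ (U st) v)) (λ v → load (U st) v ^ suc j)))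
        (trans (∑-cong V (λ v → trans (eq (w v) (# (N∩ (U st) v)) m (far (U st) v)) (trans (cong (λ z → (z + m) * w v) (near+far (U st) v)) (cong (λ z → (m + z) * w v) (sym (+-identityʳ m))))))
          (∑-*ˡ V (2 * m) w)))
        where
        eq : ∀ w a m b → w * a + (m + b) * w ≡ ((a + b) + m) * w
        eq = solve-∀

      mW≤Φ : m * W ≤ Φ
      mW≤Φ = ≤-trans (≤-reflexive (sym (∑-*ˡ V m w))) (∑-mono V (λ v → *-monoˡ-≤ (w v) (m≤m+n m (far (U st) v))))

    -- After normalisation: ∑ (load / m)^(j+1) grows at most by the factor (1 + (h + 2 s) / (h
    -- m′))^(j+1), since average cost makes all loads shrink nearly in proportion to the free set.
    potential-step : (E : Ext st (p ∷ ys)) → h * m * ∑ ys (λ x → g (φ (st′ E) x)) ≤ suc h * length ys * Γ →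
      h * suc j * (2 * s) ≤ m →
      (h * m) ^ suc j * potential j (U (st′ E)) ≤ (h * # (U (st′ E)) + (h + 2 * s)) ^ suc j * Φ
    potential-step E cost small = by (≤-total (h + s) (h * s))
      where
      open ≤-Reasoning
      m′ : ℕ
      m′ = # (U (st′ E))
      C Dv xv yv : Fin n → ℕ
      C v = load (U (st′ E)) v
      yv v = ∑ (p ∷ ys) (λ x → ⟦ not (e v (φ (st′ E) x)) ⟧)
      xv v = ∑ (p ∷ ys) (λ x → ⟦ e v (φ (st′ E) x) ⟧)
      -- A load falls by s together with # U, and by 1 more for every placed vertex outside N(v).
      Dv v = s + yv v
      C+D : ∀ v → C v + Dv v ≡ load (U st) v
      C+D v = trans (inter m′ (far (U (st′ E)) v) s (yv v)) (cong₂ _+_ (trans (+-comm m′ s) (sym (count-ext E))) (trans (+-comm (far (U (st′ E)) v) (yv v)) (sym (far-ext E v))))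
      x+y : ∀ v → xv v + yv v ≡ s
      x+y v = ∑-indicator-split (p ∷ ys) (λ x → e v (φ (st′ E) x))
      m≡ : m ≡ s + m′
      m≡ = count-ext E
      Φ′ : ℕ
      Φ′ = potential j (U (st′ E))
      Φ≡ : ∑ V (λ v → (C v + Dv v) ^ suc j) ≡ Φ
      Φ≡ = ∑-cong V (λ v → cong (_^ suc j) (C+D v))
      by : h + s ≤ h * s ⊎ h * s ≤ h + s → (h * m) ^ suc j * Φ′ ≤ (h * m′ + (h + 2 * s)) ^ suc j * Φ
      -- Here the guaranteed drop h s - (h + s) is vacuous, but the claimed factor is then at least
      -- 1.
      by (inj₂ le) = *-mono-≤ (^-monoˡ-≤ (suc j) hm≤) (∑-mono V (λ v → ^-monoˡ-≤ (suc j) (≤-trans (m≤m+n (C v) (Dv v)) (≤-reflexive (C+D v)))))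
        where
        hm≤ : h * m ≤ h * m′ + (h + 2 * s)
        hm≤ = ≤-trans (≤-reflexive (trans (cong (h *_) m≡) (*-distribˡ-+ h s m′))) (cert s le (eq h s m′))
          where
          eq : ∀ h s m → h * s + h * m + (h + s) + s ≡ h * m + (h + 2 * s) + h * s
          eq = solve-∀
      by (inj₁ le) = cancel-pow (suc j) h (s≤s z≤n) (begin
        h ^ suc j * ((h * m) ^ suc j * Φ′) ≡⟨ sym (*-assoc (h ^ suc j) ((h * m) ^ suc j) Φ′) ⟩
        h ^ suc j * (h * m) ^ suc j * Φ′ ≡⟨ cong (_* Φ′) (sym (*-pow h (h * m) (suc j))) ⟩
        (h * (h * m)) ^ suc j * Φ′ ≤⟨ multiplicative-weights V C Dv c j P (h * m) Y small′ avg YEq ⟩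
        Y ^ suc j * ∑ V (λ v → (C v + Dv v) ^ suc j) ≡⟨ cong (Y ^ suc j *_) Φ≡ ⟩
        Y ^ suc j * Φ ≤⟨ *-monoˡ-≤ Φ (^-monoˡ-≤ (suc j) Y≤) ⟩
        (h * (h * m′ + (h + 2 * s))) ^ suc j * Φ ≡⟨ cong (_* Φ) (*-pow h (h * m′ + (h + 2 * s)) (suc j)) ⟩
        h ^ suc j * (h * m′ + (h + 2 * s)) ^ suc j * Φ ≡⟨ *-assoc (h ^ suc j) _ Φ ⟩
        h ^ suc j * ((h * m′ + (h + 2 * s)) ^ suc j * Φ) ∎)
        where
        P Y : ℕ
        P = h * s ∸ (h + s)
        Y = h * (h * m) ∸ c * P
        PEq : P + (h + s) ≡ h * s
        PEq = m∸n+n≡m le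
        cP≤ : c * P ≤ h * (h * m)
        cP≤ = *-mono-≤ (n≤1+n c) (≤-trans (m∸n≤m (h * s) (h + s)) (*-monoʳ-≤ h (≤-trans (m≤m+n s m′) (≤-reflexive (sym m≡)))))
        YEq : Y + c * P ≡ suc c * (h * m)
        YEq = m∸n+n≡m cP≤
        Y≤ : Y ≤ h * (h * m′ + (h + 2 * s))
        Y≤ = rate-bound c P Y s m m′ m≡ PEq YEq
        small′ : ∀ v → suc c * suc j * Dv v ≤ C v + Dv v
        small′ v = ≤-trans (*-monoʳ-≤ (h * suc j) (≤-trans (+-monoʳ-≤ s (≤-trans (m≤n+m (yv v) (xv v)) (≤-reflexive (x+y v)))) (≤-reflexive (cong (s +_) (sym (+-identityʳ s))))))
          (≤-trans small (≤-trans (m≤m+n m (far (U st) v)) (≤-reflexive (sym (C+D v)))))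
        avg : P * ∑ V (λ v → (C v + Dv v) ^ suc j) ≤ h * m * ∑ V (λ v → Dv v * (C v + Dv v) ^ j)
        avg = ≤-trans (≤-reflexive (cong (P *_) Φ≡)) (≤-trans
          (average-drop h s m W Φ Γ SD SX Sg P Γ+Φ mW≤Φ SD+SX SX≤ (≤-trans cost (*-monoˡ-≤ Γ (*-monoʳ-≤ (suc h) (n≤1+n (length ys))))) PEq)
          (≤-reflexive (cong (h * m *_) (∑-cong V (λ v → cong (λ z → Dv v * z ^ j) (sym (C+D v)))))))
          where
          SD SX Sg : ℕ
          SD = ∑ V (λ v → Dv v * w v)
          SX = ∑ V (λ v → xv v * w v)
          Sg = ∑ ys (λ x → g (φ (st′ E) x))
          SD+SX : SD + SX ≡ 2 * s * W
          SD+SX = trans (sym (∑-+ V (λ v → Dv v * w v) (λ v → xv v * w v)))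
            (trans (∑-cong V (λ v → trans (eq₁ s (yv v) (xv v) (w v)) (trans (cong (λ z → (s + z) * w v) (x+y v)) (eq₂ s (w v))))) (∑-*ˡ V (2 * s) w))
            where
            eq₁ : ∀ s y x w → (s + y) * w + x * w ≡ (s + (x + y)) * w
            eq₁ = solve-∀
            eq₂ : ∀ s w → (s + s) * w ≡ 2 * s * w
            eq₂ = solve-∀
          SX≤ : SX ≤ W + Sg
          SX≤ = begin
            SX ≡⟨ ∑-cong V (λ v → trans (*-comm (xv v) (w v)) (sym (∑-*ˡ (p ∷ ys) (w v) (λ x → ⟦ e v (φ (st′ E) x) ⟧)))) ⟩
            ∑ V (λ v → ∑ (p ∷ ys) (λ x → w v * ⟦ e v (φ (st′ E) x) ⟧)) ≡⟨ ∑-swap V (p ∷ ys) (λ v x → w v * ⟦ e v (φ (st′ E) x) ⟧) ⟩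
            g (φ (st′ E) p) + Sg ≤⟨ +-monoˡ-≤ Sg (∑-mono V (λ v → ≤-trans (*-monoʳ-≤ (w v) (⟦⟧≤1 _)) (≤-reflexive (*-identityʳ (w v))))) ⟩
            W + Sg ∎

    cheap-step : Piece D p ys → Dense k (U st) → 1 ≤ k → 16 * h * k * k * s < m → h * suc j * (2 * s) ≤ m →
      Σ (Ext st (p ∷ ys)) λ E →
        (h * m) ^ suc j * potential j (U (st′ E)) ≤ (h * # (U (st′ E)) + (h + 2 * s)) ^ suc j * Φ
    cheap-step piece dense 1≤k big small =
      let E , cost = cheap-embedding k h st g p ys piece dense 1≤k (≤-<-trans z≤n big)
            (cheap-classes k h s (U st) g dense 1≤k (s≤s z≤n) (s≤s z≤n) big)
      in E , potential-step E cost small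

  -- The balanced phase.

  PieceList : Set
  PieceList = List (Fin n × List (Fin n))

  size-of : Fin n × List (Fin n) → ℕ
  size-of q = suc (length (proj₂ q))

  total : PieceList → ℕ
  total ps = ∑ ps size-of

  flat : PieceList → List (Fin n) → List (Fin n)
  flat [] D = D
  flat ((p , ys) ∷ ps) D = flat ps ((p ∷ ys) ʳ++ D)

  data Pieces (D : List (Fin n)) : PieceList → Set where
    [] : Pieces D []
    _∷_ : ∀ {p ys ps} → Piece D p ys → Pieces ((p ∷ ys) ʳ++ D) ps → Pieces D ((p , ys) ∷ ps)

  Extends : ∀ {D D′} → State D → State D′ → Set
  Extends {D} st st″ = ∀ y → y ∈ D → φ st″ y ≡ φ st y

  module Phase₂ (c j k c₂ S ē j₀ m₀ X₀ : ℕ) (1≤k : 1 ≤ k) (c₂-eq : c₂ + 2 ≡ 3 * k)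
    (j-eq : suc j ≡ 6 * k * j₀) (n< : n < 2 ^ j₀) (n≤ : n ≤ ē * m₀)
    (big : 16 * suc c * k * k * S < m₀) (small : suc c * suc j * (2 * S) ≤ m₀)
    (X₀-big : 6 * k * (suc c * n) ≤ 6 * k * X₀ + suc c * n) where

    private
      h N : ℕ
      h = suc c
      N = suc c * n
      Λ : ℕ
      Λ = suc j

    -- X is an error budget, which drops from suc c * n to X₀ as the pieces are placed.
    Balanced : ∀ {D} → State D → ℕ → Set
    Balanced st X = potential j (U st) * (2 * k * X) ^ Λ ≤ n * (c₂ * # (U st) * N) ^ Λ

    private
      excess : ∀ m a b → a + b ≡ m → 2 * k * a < suc k * m → suc c₂ * m ≤ 2 * k * (m + b)
      excess m a b refl lt = cert 0 (+-mono-≤ (<⇒≤ lt) (*-monoʳ-≤ (a + b) (≤-reflexive c₂-eq))) (eq k c₂ a b)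
        where
        eq : ∀ k c a b → (1 + c) * (a + b) + ((1 + k) * (a + b) + (a + b) * (3 * k)) + 0 ≡ 2 * k * ((a + b) + b) + (2 * k * a + (a + b) * (c + 2))
        eq = solve-∀

      ratio : c₂ * (6 * k + 1) * N ≤ suc c₂ * (6 * k * X₀)
      ratio = cert (3 * N) (+-mono-≤ (*-monoʳ-≤ (suc c₂) X₀-big) (*-monoʳ-≤ (2 * N) (≤-reflexive c₂-eq))) (eq c₂ k N X₀)
        where
        eq : ∀ c k N X → c * (6 * k + 1) * N + ((1 + c) * (6 * k * X + N) + 2 * N * (3 * k)) + 3 * N ≡ (1 + c) * (6 * k * X) + ((1 + c) * (6 * k * N) + 2 * N * (c + 2))
        eq = solve-∀

      c₂>0 : 0 < c₂
      c₂>0 = n≢0⇒n>0 λ { refl → <⇒≱ (≤-trans (s≤s (s≤s (s≤s z≤n))) (*-monoʳ-≤ 3 1≤k)) (≤-reflexive (sym c₂-eq)) }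

    -- A vertex violating density has load at least (3k-1)/(2k) m, whereas the invariant is built on
    -- the base (3k-2)/(2k) m. With X ≥ (1 - 1/(6k)) N the quotient is still at least 1 + 1/(6k),
    -- and its power with exponent Λ = 6 k j₀ is at least 2^j₀ > n.
    balanced-dense : ∀ {D} (st : State D) X → Balanced st X → X₀ ≤ X → 0 < # (U st) → 0 < N → Dense k (U st)
    balanced-dense st X bal X₀≤ m>0 N>0 v = ≮⇒≥ λ lt → growth-contradiction (6 * k) j₀ Λ n (c₂ * (m * N)) j-eq n< (*-mono-≤ {1} {6} (s≤s z≤n) 1≤k) (*-mono-≤ c₂>0 (*-mono-≤ m>0 N>0)) (begin
      (c₂ * (m * N) * (6 * k + 1)) ^ Λ            ≡⟨ cong (_^ Λ) (e₁ c₂ m N (6 * k + 1)) ⟩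
      (m * (c₂ * (6 * k + 1) * N)) ^ Λ            ≤⟨ ^-monoˡ-≤ Λ (*-monoʳ-≤ m (≤-trans ratio (*-monoʳ-≤ (suc c₂) (*-monoʳ-≤ (6 * k) X₀≤)))) ⟩
      (m * (suc c₂ * (6 * k * X))) ^ Λ            ≡⟨ cong (_^ Λ) (e₂ m (suc c₂) (6 * k) X) ⟩
      (6 * k * (suc c₂ * m * X)) ^ Λ              ≤⟨ ^-monoˡ-≤ Λ (*-monoʳ-≤ (6 * k) (*-monoˡ-≤ X (excess m (# (N∩ (U st) v)) (far (U st) v) (near+far (U st) v) lt))) ⟩
      (6 * k * (2 * k * load (U st) v * X)) ^ Λ   ≡⟨ cong (_^ Λ) (e₃ (6 * k) (2 * k) (load (U st) v) X) ⟩
      (6 * k * (load (U st) v * (2 * k * X))) ^ Λ ≡⟨ trans (*-pow (6 * k) (load (U st) v * (2 * k * X)) Λ) (cong ((6 * k) ^ Λ *_) (*-pow (load (U st) v) (2 * k * X) Λ)) ⟩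
      (6 * k) ^ Λ * (load (U st) v ^ Λ * (2 * k * X) ^ Λ) ≤⟨ *-monoʳ-≤ ((6 * k) ^ Λ) (*-monoˡ-≤ ((2 * k * X) ^ Λ) (∑-≥ (λ v → load (U st) v ^ Λ) (∈-allFin v))) ⟩
      (6 * k) ^ Λ * (potential j (U st) * (2 * k * X) ^ Λ) ≤⟨ *-monoʳ-≤ ((6 * k) ^ Λ) bal ⟩
      (6 * k) ^ Λ * (n * (c₂ * m * N) ^ Λ)        ≡⟨ *-left-comm ((6 * k) ^ Λ) n ((c₂ * m * N) ^ Λ) ⟩
      n * ((6 * k) ^ Λ * (c₂ * m * N) ^ Λ)        ≡⟨ cong (n *_) (sym (*-pow (6 * k) (c₂ * m * N) Λ)) ⟩
      n * (6 * k * (c₂ * m * N)) ^ Λ              ≡⟨ cong (λ z → n * z ^ Λ) (e₄ (6 * k) c₂ m N) ⟩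
      n * (c₂ * (m * N) * (6 * k)) ^ Λ            ∎)
      where
      open ≤-Reasoning
      m : ℕ
      m = # (U st)
      e₁ : ∀ c m N z → c * (m * N) * z ≡ m * (c * z * N)
      e₁ = solve-∀
      e₂ : ∀ m c z X → m * (c * (z * X)) ≡ z * (c * m * X)
      e₂ = solve-∀
      e₃ : ∀ z q l X → z * (q * l * X) ≡ z * (l * (q * X))
      e₃ = solve-∀
      e₄ : ∀ z c m N → z * (c * m * N) ≡ c * (m * N) * z
      e₄ = solve-∀

    -- The factor 1 + (h + 2 s) / (h m′) of one step is at most X / X′, because X′ ≤ h n ≤ h ē m′. A
    -- telescoping quotient thus replaces the product of all these factors, and the errors of the
    -- pieces simply add up.
    balanced-step : ∀ {D D′} (st : State D) (st″ : State D′) s X X′ → X ≡ X′ + ē * (h + 2 * s) → X ≤ N → m₀ ≤ # (U st″) → 0 < # (U st) →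
      (h * # (U st)) ^ Λ * potential j (U st″) ≤ (h * # (U st″) + (h + 2 * s)) ^ Λ * potential j (U st) →
      Balanced st X → Balanced st″ X′
    balanced-step st st″ s X X′ X≡ X≤ m₀≤ m>0 step bal = cancel-pow Λ (h * m) (*-mono-≤ {1} {h} (s≤s z≤n) m>0) (begin
      (h * m) ^ Λ * (potential j (U st″) * (2 * k * X′) ^ Λ) ≡⟨ sym (*-assoc ((h * m) ^ Λ) _ _) ⟩
      (h * m) ^ Λ * potential j (U st″) * (2 * k * X′) ^ Λ   ≤⟨ *-monoˡ-≤ ((2 * k * X′) ^ Λ) step ⟩
      Z ^ Λ * potential j (U st) * (2 * k * X′) ^ Λ          ≡⟨ e₁ (Z ^ Λ) (potential j (U st)) ((2 * k * X′) ^ Λ) ⟩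
      potential j (U st) * (Z ^ Λ * (2 * k * X′) ^ Λ)        ≡⟨ cong (potential j (U st) *_) (sym (*-pow Z (2 * k * X′) Λ)) ⟩
      potential j (U st) * (Z * (2 * k * X′)) ^ Λ            ≤⟨ *-monoʳ-≤ (potential j (U st)) (^-monoˡ-≤ Λ key) ⟩
      potential j (U st) * (h * m′ * (2 * k * X)) ^ Λ        ≡⟨ cong (potential j (U st) *_) (*-pow (h * m′) (2 * k * X) Λ) ⟩
      potential j (U st) * ((h * m′) ^ Λ * (2 * k * X) ^ Λ)  ≡⟨ *-left-comm (potential j (U st)) ((h * m′) ^ Λ) ((2 * k * X) ^ Λ) ⟩
      (h * m′) ^ Λ * (potential j (U st) * (2 * k * X) ^ Λ)  ≤⟨ *-monoʳ-≤ ((h * m′) ^ Λ) bal ⟩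
      (h * m′) ^ Λ * (n * (c₂ * m * N) ^ Λ)                  ≡⟨ *-left-comm ((h * m′) ^ Λ) n _ ⟩
      n * ((h * m′) ^ Λ * (c₂ * m * N) ^ Λ)                  ≡⟨ cong (n *_) (trans (sym (*-pow (h * m′) (c₂ * m * N) Λ)) (trans (cong (_^ Λ) (e₃ h m′ c₂ m N)) (*-pow (h * m) (c₂ * m′ * N) Λ))) ⟩
      n * ((h * m) ^ Λ * (c₂ * m′ * N) ^ Λ)                  ≡⟨ *-left-comm n ((h * m) ^ Λ) _ ⟩
      (h * m) ^ Λ * (n * (c₂ * m′ * N) ^ Λ)                  ∎)
      where
      open ≤-Reasoning
      m m′ Z ê : ℕ
      m = # (U st)
      m′ = # (U st″)
      ê = h + 2 * s
      Z = h * m′ + ê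
      e₁ : ∀ a b c → a * b * c ≡ b * (a * c)
      e₁ = solve-∀
      e₃ : ∀ h m′ c m N → h * m′ * (c * m * N) ≡ h * m * (c * m′ * N)
      e₃ = solve-∀
      X′≤ : X′ ≤ h * (ē * m′)
      X′≤ = ≤-trans (≤-trans (m≤m+n X′ _) (≤-reflexive (sym X≡))) (≤-trans X≤ (*-monoʳ-≤ h (≤-trans n≤ (*-monoʳ-≤ ē m₀≤))))
      key : Z * (2 * k * X′) ≤ h * m′ * (2 * k * X)
      key = subst (λ x → Z * (2 * k * X′) ≤ h * m′ * (2 * k * x)) (sym X≡) (cert 0 (*-monoʳ-≤ (2 * k * ê) X′≤) (eq h m′ ê k X′ ē))
        where
        eq : ∀ h m q k X ē → (h * m + q) * (2 * k * X) + 2 * k * q * (h * (ē * m)) + 0 ≡ h * m * (2 * k * (X + ē * q)) + 2 * k * q * X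
        eq = solve-∀

    charge : PieceList → ℕ
    charge ps = ∑ ps (λ q → ē * (h + 2 * size-of q))

    phase₂ : ∀ ps {D} (st : State D) X → Pieces D ps → (∀ q → q ∈ ps → size-of q ≤ S) → Balanced st X → X ≤ N → 0 < N →
      X₀ + charge ps ≤ X → m₀ + total ps ≤ # (U st) → Σ (State (flat ps D)) (Extends st)
    phase₂ [] st X _ _ _ _ _ _ _ = st , λ _ _ → refl
    phase₂ ((p , ys) ∷ ps) {D} st X (piece ∷ pcs) sizes bal X≤ N>0 budget room = continue
      (cheap-step c j k st p ys piece (balanced-dense st X bal (≤-trans (m≤m+n X₀ _) budget) m>0 N>0) 1≤k
        (≤-<-trans (*-monoʳ-≤ (16 * h * k * k) s≤S) (<-≤-trans big m₀≤m))
        (≤-trans (*-monoʳ-≤ (h * suc j) (*-monoʳ-≤ 2 s≤S)) (≤-trans small m₀≤m)))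
      where
      s : ℕ
      s = suc (length ys)
      s≤S : s ≤ S
      s≤S = sizes (p , ys) (here refl)
      m₀≤m : m₀ ≤ # (U st)
      m₀≤m = ≤-trans (m≤m+n m₀ _) room
      m>0 : 0 < # (U st)
      m>0 = <-≤-trans (≤-<-trans z≤n big) m₀≤m
      q : ℕ
      q = ē * (h + 2 * s)
      X′ : ℕ
      X′ = X ∸ q
      budget′ : (X₀ + charge ps) + q ≤ X
      budget′ = ≤-trans (≤-reflexive (trans (+-assoc X₀ (charge ps) q) (cong (X₀ +_) (+-comm (charge ps) q)))) budget
      X≡ : X ≡ X′ + q
      X≡ = sym (m∸n+n≡m (≤-trans (m≤n+m q (X₀ + charge ps)) budget′))
      continue : (Σ (Ext st (p ∷ ys)) λ E →
        (h * # (U st)) ^ Λ * potential j (U (st′ E)) ≤ (h * # (U (st′ E)) + (h + 2 * s)) ^ Λ * potential j (U st)) →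
        Σ (State (flat ps ((p ∷ ys) ʳ++ D))) (Extends st)
      continue (E , drop) =
        let st″ , ext = phase₂ ps (st′ E) X′ pcs (λ r r∈ → sizes r (there r∈))
              (balanced-step st (st′ E) s X X′ X≡ X≤ (≤-trans (m≤m+n m₀ (total ps)) room′) m>0 drop bal)
              (≤-trans (m∸n≤m X q) X≤) N>0 (+-cancelʳ-≤ q _ _ (≤-trans budget′ (≤-reflexive X≡))) room′
        in st″ , λ y y∈ → trans (ext y (∈-ʳ++ʳ (p ∷ ys) y∈)) (agree E y y∈)
        where
        room′ : m₀ + total ps ≤ # (U (st′ E))
        room′ = +-cancelˡ-≤ s _ _ (≤-trans (≤-reflexive (+-left-comm s m₀ (total ps))) (≤-trans room (≤-reflexive (count-ext E))))

  -- Absorbers and the first phase.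

  Settled : List (Fin n) → Fin n → Set
  Settled D y = y ∈ D × (∀ z → nbr y z ≡ true → z ∈ D)

  absorbs-cong : ∀ (φ₁ φ₂ : Fin n → Fin n) y → φ₂ y ≡ φ₁ y → (∀ z → nbr y z ≡ true → φ₂ z ≡ φ₁ z) → ∀ i →
    absorbs φ₂ y i ≡ absorbs φ₁ y i
  absorbs-cong φ₁ φ₂ y same-y same (u , v) = cong₂ _∧_ (cong (e v) same-y) (every-cong V each)
    where
    every-cong : ∀ (xs : List (Fin n)) {f g : Fin n → Bool} → (∀ x → f x ≡ g x) → every xs f ≡ every xs g
    every-cong [] eq = refl
    every-cong (x ∷ xs) eq = cong₂ _∧_ (eq x) (every-cong xs eq)
    guard-cong : ∀ a {b c} → (a ≡ true → b ≡ c) → not a ∨ b ≡ not a ∨ c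
    guard-cong true q = q refl
    guard-cong false q = refl
    each : ∀ z → not (nbr y z) ∨ e u (φ₂ z) ≡ not (nbr y z) ∨ e u (φ₁ z)
    each z = guard-cong (nbr y z) (λ q → cong (e u) (same z q))

  score : (Fin n → Fin n) → List (Fin n) → Pair → ℕ
  score φ Ys i = ∑ Ys (λ y → ⟦ absorbs φ y i ⟧)

  score-≤ : ∀ φ Ys i → score φ Ys i ≤ length Ys
  score-≤ φ Ys i = ≤-trans (∑-mono Ys (λ y → ⟦⟧≤1 (absorbs φ y i))) (≤-reflexive (∑-1 Ys))

  -- `settled` protects absorbers from later placements, and `independent` protects them from the
  -- moves of other absorbers, so whether y serves a pair stays true until y itself is used.
  record Stage (D Ys : List (Fin n)) : Set where
    field
      unique : Unique Ys
      settled : ∀ y → y ∈ Ys → Settled D y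
      independent : ∀ y z → y ∈ Ys → z ∈ Ys → nbr y z ≡ false
      avoids-root : t ∉ Ys

  -- Restriction to one colour class makes the chosen absorbers pairwise non-adjacent, and
  -- `absorber-reward` rewards a single class anyway.
  record Choice (q : Fin n × List (Fin n)) : Set where
    field
      orient : Bool → Bool
      orient-not : ∀ b → orient (not b) ≡ not (orient b)
      chosen : List (Fin n)
      chosen-unique : Unique chosen
      chosen-≤ : length chosen ≤ size-of q
      chosen-absorber : ∀ y → y ∈ chosen → Absorber (proj₂ q) y
      chosen-colour : ∀ y → y ∈ chosen → orient (colour y) ≡ true

  open Choice public

  Choices : PieceList → Set
  Choices ps = All Choice ps

  chosen-total : ∀ {ps} → Choices ps → ℕ
  chosen-total [] = 0
  chosen-total (ch ∷ chs) = length (chosen ch) + chosen-total chs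

  build-par : ∀ {S xs} → Build S xs → ∀ {x} → x ∈ xs → par x ∈ S ⊎ par x ∈ xs
  build-par (p∈ ∷ _) (here refl) = inj₁ p∈
  build-par (_ ∷ bu) (there x∈) with build-par bu x∈
  ... | inj₁ (here eq) = inj₂ (here eq)
  ... | inj₁ (there q) = inj₁ q
  ... | inj₂ q = inj₂ (there q)

  extend-stage : ∀ {D p ys Ys} → t ∈ D → Piece D p ys → (ch : Choice (p , ys)) → Stage D Ys →
    Stage ((p ∷ ys) ʳ++ D) (chosen ch ++ Ys)
  extend-stage {D} {p} {ys} {Ys} t∈ piece ch sg = record
    { unique = Unique-++⁺ (chosen-unique ch) (Stage.unique sg) (λ { (y∈c , y∈Y) → fresh-∉ (fresh piece) (in-piece y∈c) (proj₁ (Stage.settled sg _ y∈Y)) })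
    ; settled = λ y y∈ → settled′ y (∈-++⁻ (chosen ch) y∈)
    ; independent = λ y z y∈ z∈ → indep y z (∈-++⁻ (chosen ch) y∈) (∈-++⁻ (chosen ch) z∈)
    ; avoids-root = λ t∈Y → avoid (∈-++⁻ (chosen ch) t∈Y)
    }
    where
    ab : ∀ {y} → y ∈ chosen ch → Absorber ys y
    ab = chosen-absorber ch _
    in-piece : ∀ {y} → y ∈ chosen ch → y ∈ p ∷ ys
    in-piece y∈ = there (inside (ab y∈))
    nbr-in-piece : ∀ {y z} → y ∈ chosen ch → nbr y z ≡ true → z ∈ p ∷ ys
    nbr-in-piece {y} {z} y∈ q with nbr-par y z q
    ... | inj₂ pz = there (child-inside (ab y∈) z pz)
    ... | inj₁ refl with build-par (build piece) (inside (ab y∈))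
    ... | inj₁ (here eq) = here eq
    ... | inj₂ r = there r
    avoid : t ∈ chosen ch ⊎ t ∈ Ys → ⊥
    avoid (inj₁ t∈c) = fresh-∉ (fresh piece) (in-piece t∈c) t∈
    avoid (inj₂ t∈Y) = Stage.avoids-root sg t∈Y
    settled′ : ∀ y → y ∈ chosen ch ⊎ y ∈ Ys → Settled ((p ∷ ys) ʳ++ D) y
    settled′ y (inj₁ y∈) = ∈-ʳ++ˡ D (in-piece y∈) , λ z q → ∈-ʳ++ˡ D (nbr-in-piece y∈ q)
    settled′ y (inj₂ y∈) = ∈-ʳ++ʳ (p ∷ ys) (proj₁ (Stage.settled sg y y∈)) , λ z q → ∈-ʳ++ʳ (p ∷ ys) (proj₂ (Stage.settled sg y y∈) z q)
    f≢ : ∀ {y z} → y ∈ chosen ch → z ∈ chosen ch → y ≢ par z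
    f≢ {y} {z} y∈ z∈ refl = case trans (sym (chosen-colour ch z z∈)) (trans (cong (orient ch) (alternate piece z (inside (ab z∈))))
      (trans (orient-not ch _) (cong not (chosen-colour ch y y∈)))) of λ ()
    not-true : ∀ {b} → b ≢ true → b ≡ false
    not-true {true} q = ⊥-elim (q refl)
    not-true {false} q = refl
    indep : ∀ y z → y ∈ chosen ch ⊎ y ∈ Ys → z ∈ chosen ch ⊎ z ∈ Ys → nbr y z ≡ false
    indep y z (inj₁ y∈) (inj₁ z∈) = not-true λ q → case nbr-par y z q of λ { (inj₁ eq) → f≢ z∈ y∈ eq ; (inj₂ eq) → f≢ y∈ z∈ (sym eq) }
    indep y z (inj₁ y∈) (inj₂ z∈) = not-true λ q → fresh-∉ (fresh piece) (nbr-in-piece y∈ q) (proj₁ (Stage.settled sg z z∈))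
    indep y z (inj₂ y∈) (inj₁ z∈) = not-true λ q → fresh-∉ (fresh piece) (in-piece z∈) (proj₂ (Stage.settled sg y y∈) z q)
    indep y z (inj₂ y∈) (inj₂ z∈) = Stage.independent sg y z y∈ z∈

  far-mono : ∀ U v → far U v ≤ far (λ _ → true) v
  far-mono U v = #-mono {P = λ u → U u ∧ not (e v u)} {Q = λ u → true ∧ not (e v u)} (λ u q → ∧-r {U u} q)

  module Rewards (j k κ Z S m₁ : ℕ) (is : List Pair) (i₀ : Pair) (i₀∈ : i₀ ∈ is) (1≤k : 1 ≤ k) (κ≡ : κ ≡ 512 * (k * (k * k)))
    (sparse : ∀ v → 2 * k * far (λ _ → true) v + 2 * m₁ ≤ k * m₁)
    (room : 8 * k * S ≤ m₁) (m₁>0 : 0 < m₁) (Z-big : 4 * suc j * S ≤ Z) (Z>0 : 0 < Z) (κ>0 : 0 < κ) where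

    Λ X : ℕ
    Λ = suc j
    X = 2 * (Z * κ)

    -- Shrinking U does not increase `far`, so a bound relative to m₁ persists as long as m₁
    -- vertices are free. The first phase therefore needs no balance potential.
    still-sparse : ∀ U → m₁ ≤ # U → ∀ v → 2 * k * far U v + 2 * # U ≤ k * # U
    still-sparse U m₁≤ v = subst (λ m → 2 * k * far U v + 2 * m ≤ k * m) (m+[n∸m]≡n m₁≤)
      (cert 0 (+-mono-≤ (≤-trans (+-monoˡ-≤ (2 * m₁) (*-monoʳ-≤ (2 * k) (far-mono U v))) (sparse v)) (*-monoˡ-≤ (# U ∸ m₁) 2≤k))
        (eq (2 * k * far U v) (# U ∸ m₁) m₁ k))
      where
      2≤k : 2 ≤ k
      2≤k = *-cancelʳ-≤ 2 k m₁ {{>-nonZero m₁>0}} (≤-trans (m≤n+m (2 * m₁) (2 * k * far (λ _ → true) v)) (sparse v))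
      eq : ∀ F d m₁ k → F + 2 * (m₁ + d) + (k * m₁ + k * d) + 0 ≡ k * (m₁ + d) + (F + 2 * m₁ + 2 * d)
      eq = solve-∀

    still-dense : ∀ U → m₁ ≤ # U → Dense k U
    still-dense U m₁≤ v = subst (λ m → suc k * m ≤ 2 * k * # (N∩ U v)) (near+far U v)
      (cert (a + b) (subst (λ m → 2 * k * b + 2 * m ≤ k * m) (sym (near+far U v)) (still-sparse U m₁≤ v)) (eq k a b))
      where
      a b : ℕ
      a = # (N∩ U v)
      b = far U v
      eq : ∀ k a b → (1 + k) * (a + b) + k * (a + b) + (a + b) ≡ 2 * k * a + (2 * k * b + 2 * (a + b))
      eq = solve-∀

    deficit : (Fin n → Fin n) → List (Fin n) → ℕ
    deficit φ Ys = ∑ is (λ i → (Z ∸ score φ Ys i) ^ Λ)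

    -- The deficits behave as if all of them had shrunk by X / (X + |Ys|). An absorber serves a
    -- proportion 1/κ of the weight, a deficit is at most Z, and the linearisation at c = 1 loses a
    -- factor 2, whence X = 2 Z κ.
    Rewarded : (Fin n → Fin n) → List (Fin n) → Set
    Rewarded φ Ys = deficit φ Ys * (X + length Ys) ^ Λ ≤ length is * (Z * X) ^ Λ

    X>0 : 0 < X
    X>0 = *-mono-≤ {1} {2} (s≤s z≤n) (*-mono-≤ Z>0 κ>0)

    module _ {D} (st : State D) (p : Fin n) (ys Ys : List (Fin n)) (piece : Piece D p ys) (ch : Choice (p , ys)) (sg : Stage D Ys)
      (m₁≤ : m₁ ≤ # (U st)) (s≤S : suc (length ys) ≤ S) (Ys-small : 2 * (length Ys + length (chosen ch)) ≤ Z) where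

      private
        sc wt : Pair → ℕ
        sc i = score (φ st) Ys i
        wt i = (Z ∸ sc i) ^ j
        Yc : List (Fin n)
        Yc = chosen ch
        y₀ W : ℕ
        y₀ = length Yc
        W = ∑ is wt

        -- At most Z / 2 absorbers are chosen in all, so no truncated subtraction hits 0, weights
        -- stay positive and one piece is a small relative change.
        half≤ : ∀ i → Z ≤ 2 * (Z ∸ sc i)
        half≤ i = +-cancelʳ-≤ (2 * sc i) _ _ (≤-trans (+-monoʳ-≤ Z (≤-trans (*-monoʳ-≤ 2 (≤-trans (score-≤ (φ st) Ys i) (m≤m+n _ _))) Ys-small))
          (≤-reflexive (trans (eq₁ Z) (trans (cong (2 *_) (sym (m∸n+n≡m (sc≤Z)))) (*-distribˡ-+ 2 (Z ∸ sc i) (sc i))))))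
          where
          eq₁ : ∀ Z → Z + Z ≡ 2 * Z
          eq₁ = solve-∀
          sc≤Z : sc i ≤ Z
          sc≤Z = ≤-trans (score-≤ (φ st) Ys i) (≤-trans (m≤m+n _ (length Yc)) (≤-trans (m≤m+n _ _) Ys-small))

        W>0 : 0 < W
        W>0 = <-≤-trans (pos (Z ∸ sc i₀) (half≤ i₀)) (∑-≥ wt i₀∈)
          where
          pos : ∀ b → Z ≤ 2 * b → 0 < b ^ j
          pos zero le = ⊥-elim (<⇒≱ Z>0 le)
          pos (suc b) le = m^n>0 (suc b) j

      -- Settled absorbers keep their scores, so the deficits drop exactly by the scores of the new
      -- absorbers; `shift` turns the factor 1 - y₀ / X into the quotient of the invariant.
      reward-drop : (E : Ext st (p ∷ ys)) →
        (∀ y → Absorber ys y → orient ch (colour y) ≡ true → W ≤ κ * ∑ is (λ i → wt i * ⟦ absorbs (φ (st′ E)) y i ⟧)) →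
        Rewarded (φ st) Ys → Rewarded (φ (st′ E)) (Yc ++ Ys)
      reward-drop E rew inv = cancel-pow Λ X X>0 (begin
        X ^ Λ * (deficit φ′ (Yc ++ Ys) * (X + length (Yc ++ Ys)) ^ Λ) ≡⟨ cong₂ (λ a b → X ^ Λ * (a * (X + b) ^ Λ)) new-deficit (length-++ Yc) ⟩
        X ^ Λ * (Ψ′ * (X + (y₀ + length Ys)) ^ Λ)    ≡⟨ sym (*-assoc (X ^ Λ) Ψ′ _) ⟩
        X ^ Λ * Ψ′ * (X + (y₀ + length Ys)) ^ Λ      ≤⟨ *-monoˡ-≤ _ (multiplicative-weights is C R 1 j y₀ (Z * κ) (X ∸ y₀) small avg YEq) ⟩
        (X ∸ y₀) ^ Λ * Ψ″ * (X + (y₀ + length Ys)) ^ Λ ≡⟨ cong (λ z → (X ∸ y₀) ^ Λ * z * (X + (y₀ + length Ys)) ^ Λ) old-deficit ⟩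
        (X ∸ y₀) ^ Λ * Ψ * (X + (y₀ + length Ys)) ^ Λ ≡⟨ e₁ ((X ∸ y₀) ^ Λ) Ψ ((X + (y₀ + length Ys)) ^ Λ) ⟩
        Ψ * ((X ∸ y₀) ^ Λ * (X + (y₀ + length Ys)) ^ Λ) ≡⟨ cong (Ψ *_) (sym (*-pow (X ∸ y₀) (X + (y₀ + length Ys)) Λ)) ⟩
        Ψ * ((X ∸ y₀) * (X + (y₀ + length Ys))) ^ Λ  ≤⟨ *-monoʳ-≤ Ψ (^-monoˡ-≤ Λ (shift (X ∸ y₀) y₀ (length Ys) X (m∸n+n≡m y₀≤X))) ⟩
        Ψ * (X * (X + length Ys)) ^ Λ                ≡⟨ cong (Ψ *_) (*-pow X (X + length Ys) Λ) ⟩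
        Ψ * (X ^ Λ * (X + length Ys) ^ Λ)            ≡⟨ *-left-comm Ψ (X ^ Λ) _ ⟩
        X ^ Λ * (Ψ * (X + length Ys) ^ Λ)            ≤⟨ *-monoʳ-≤ (X ^ Λ) inv ⟩
        X ^ Λ * (length is * (Z * X) ^ Λ)            ∎)
        where
        open ≤-Reasoning
        φ′ : Fin n → Fin n
        φ′ = φ (st′ E)
        R C : Pair → ℕ
        R i = score φ′ Yc i
        C i = Z ∸ (R i + sc i)
        Ψ Ψ′ Ψ″ : ℕ
        Ψ = deficit (φ st) Ys
        Ψ′ = ∑ is (λ i → C i ^ Λ)
        Ψ″ = ∑ is (λ i → (C i + R i) ^ Λ)
        R≤ : ∀ i → R i ≤ y₀
        R≤ i = score-≤ φ′ Yc i
        C+R : ∀ i → C i + R i ≡ Z ∸ sc i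
        C+R i = trans (cong (_+ R i) (trans (cong (Z ∸_) (+-comm (R i) (sc i))) (sym (∸-+-assoc Z (sc i) (R i)))))
          (m∸n+n≡m (m+n≤o⇒m≤o∸n (R i) (≤-trans (+-mono-≤ (R≤ i) (score-≤ (φ st) Ys i)) (≤-trans (≤-reflexive (+-comm y₀ (length Ys))) (≤-trans (m≤m+n _ _) Ys-small)))))
        stable : ∀ i → score φ′ Ys i ≡ sc i
        stable i = ∑-cong∈ Ys (λ y y∈ → cong ⟦_⟧ (absorbs-cong (φ st) φ′ y (agree E y (proj₁ (Stage.settled sg y y∈))) (λ z q → agree E z (proj₂ (Stage.settled sg y y∈) z q)) i))
        new-deficit : deficit φ′ (Yc ++ Ys) ≡ Ψ′
        new-deficit = ∑-cong is (λ i → cong (λ z → (Z ∸ z) ^ Λ) (trans (∑-++ Yc Ys (λ y → ⟦ absorbs φ′ y i ⟧)) (cong (R i +_) (stable i))))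
        old-deficit : Ψ″ ≡ Ψ
        old-deficit = ∑-cong is (λ i → cong (_^ Λ) (C+R i))
        y₀≤Z : y₀ ≤ Z
        y₀≤Z = ≤-trans (m≤n+m y₀ (length Ys)) (≤-trans (m≤m+n _ _) Ys-small)
        y₀≤X : y₀ ≤ X
        y₀≤X = ≤-trans y₀≤Z (≤-trans (≤-trans (m≤m*n Z κ {{>-nonZero κ>0}}) (m≤m+n _ _)) ≤-refl)
        YEq : X ∸ y₀ + 1 * y₀ ≡ 2 * (Z * κ)
        YEq = trans (cong (X ∸ y₀ +_) (*-identityˡ y₀)) (m∸n+n≡m y₀≤X)
        y₀≤S : y₀ ≤ S
        y₀≤S = ≤-trans (chosen-≤ ch) s≤S
        small : ∀ i → 2 * suc j * R i ≤ C i + R i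
        small i = *-cancelˡ-≤ 2 (≤-trans (≤-trans (*-monoʳ-≤ 2 (*-monoʳ-≤ (2 * suc j) (≤-trans (R≤ i) y₀≤S))) (≤-reflexive (e₃ (suc j) S)))
          (≤-trans Z-big (≤-trans (half≤ i) (≤-reflexive (cong (2 *_) (sym (C+R i)))))))
          where
          e₃ : ∀ j S → 2 * (2 * j * S) ≡ 4 * j * S
          e₃ = solve-∀
        rewards : y₀ * W ≤ κ * ∑ is (λ i → R i * wt i)
        rewards = begin
          y₀ * W ≡⟨ sym (∑-const Yc W) ⟩
          ∑ Yc (λ _ → W) ≤⟨ ∑-mono∈ Yc (λ y y∈ → rew y (chosen-absorber ch y y∈) (chosen-colour ch y y∈)) ⟩
          ∑ Yc (λ y → κ * ∑ is (λ i → wt i * ⟦ absorbs φ′ y i ⟧)) ≡⟨ ∑-*ˡ Yc κ _ ⟩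
          κ * ∑ Yc (λ y → ∑ is (λ i → wt i * ⟦ absorbs φ′ y i ⟧)) ≡⟨ cong (κ *_) (∑-swap Yc is (λ y i → wt i * ⟦ absorbs φ′ y i ⟧)) ⟩
          κ * ∑ is (λ i → ∑ Yc (λ y → wt i * ⟦ absorbs φ′ y i ⟧)) ≡⟨ cong (κ *_) (∑-cong is (λ i → trans (∑-*ˡ Yc (wt i) (λ y → ⟦ absorbs φ′ y i ⟧)) (*-comm (wt i) (R i)))) ⟩
          κ * ∑ is (λ i → R i * wt i) ∎
        avg : y₀ * Ψ″ ≤ Z * κ * ∑ is (λ i → R i * (C i + R i) ^ j)
        avg = begin
          y₀ * Ψ″ ≡⟨ cong (y₀ *_) old-deficit ⟩
          y₀ * Ψ ≤⟨ *-monoʳ-≤ y₀ (≤-trans (∑-mono is (λ i → *-monoˡ-≤ (wt i) (m∸n≤m Z (sc i)))) (≤-reflexive (∑-*ˡ is Z wt))) ⟩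
          y₀ * (Z * W) ≡⟨ *-left-comm y₀ Z W ⟩
          Z * (y₀ * W) ≤⟨ *-monoʳ-≤ Z rewards ⟩
          Z * (κ * ∑ is (λ i → R i * wt i)) ≡⟨ sym (*-assoc Z κ _) ⟩
          Z * κ * ∑ is (λ i → R i * wt i) ≡⟨ cong (Z * κ *_) (∑-cong is (λ i → cong (λ z → R i * z ^ j) (sym (C+R i)))) ⟩
          Z * κ * ∑ is (λ i → R i * (C i + R i) ^ j) ∎
        e₁ : ∀ a b c → a * b * c ≡ b * (a * c)
        e₁ = solve-∀
        shift : ∀ d y l X → d + y ≡ X → d * (X + (y + l)) ≤ X * (X + l)
        shift d y l .(d + y) refl = ≤-by (y * y + y * l) (eq d y l)
          where
          eq : ∀ d y l → d * ((d + y) + (y + l)) + (y * y + y * l) ≡ (d + y) * ((d + y) + l)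
          eq = solve-∀

      reward-step : Rewarded (φ st) Ys → Σ (Ext st (p ∷ ys)) λ E → Rewarded (φ (st′ E)) (Yc ++ Ys)
      reward-step inv =
        let E , rew = absorber-reward k κ is wt κ≡ st p ys (orient ch) (orient-not ch) piece (still-dense (U st) m₁≤) 1≤k (<-≤-trans m₁>0 m₁≤)
              (≤-trans (*-monoʳ-≤ (8 * k) s≤S) (≤-trans room m₁≤)) W>0
        in E , reward-drop E rew inv

    record Prepared {D} (st : State D) {ps} (chs : Choices ps) (l : ℕ) : Set where
      field
        final : State (flat ps D)
        extends : Extends st final
        absorbers : List (Fin n)
        stage : Stage (flat ps D) absorbers
        rewarded : Rewarded (φ final) absorbers
        count : length absorbers ≡ l + chosen-total chs

    phase₁ : ∀ ps {D} (st : State D) Ys → Pieces D ps → (chs : Choices ps) → (∀ q → q ∈ ps → size-of q ≤ S) → Stage D Ys →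
      Rewarded (φ st) Ys → m₁ + total ps ≤ # (U st) → 2 * (length Ys + chosen-total chs) ≤ Z → Prepared st chs (length Ys)
    phase₁ [] st Ys _ [] _ sg inv _ _ = record
      { final = st ; extends = λ _ _ → refl ; absorbers = Ys ; stage = sg ; rewarded = inv ; count = sym (+-identityʳ _) }
    phase₁ ((p , ys) ∷ ps) {D} st Ys (piece ∷ pcs) (ch ∷ chs) sizes sg inv room₁ small = continue
      (reward-step st p ys Ys piece ch sg (≤-trans (m≤m+n m₁ _) room₁) (sizes _ (here refl))
        (≤-trans (*-monoʳ-≤ 2 (+-monoʳ-≤ (length Ys) (m≤m+n _ (chosen-total chs)))) small) inv)
      where
      len : length (chosen ch ++ Ys) + chosen-total chs ≡ length Ys + (length (chosen ch) + chosen-total chs)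
      len = trans (cong (_+ chosen-total chs) (length-++ (chosen ch))) (eq (length (chosen ch)) (length Ys) (chosen-total chs))
        where
        eq : ∀ a b c → a + b + c ≡ b + (a + c)
        eq = solve-∀
      continue : (Σ (Ext st (p ∷ ys)) λ E → Rewarded (φ (st′ E)) (chosen ch ++ Ys)) → Prepared st (ch ∷ chs) (length Ys)
      continue (E , inv′) = record
        { final = Prepared.final rest
        ; extends = λ y y∈ → trans (Prepared.extends rest y (∈-ʳ++ʳ (p ∷ ys) y∈)) (agree E y y∈)
        ; absorbers = Prepared.absorbers rest
        ; stage = Prepared.stage rest
        ; rewarded = Prepared.rewarded rest
        ; count = trans (Prepared.count rest) len
        }
        where
        room₂ : m₁ + total ps ≤ # (U (st′ E))
        room₂ = +-cancelˡ-≤ (suc (length ys)) _ _ (≤-trans (≤-reflexive (+-left-comm (suc (length ys)) m₁ (total ps))) (≤-trans room₁ (≤-reflexive (count-ext E))))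
        rest : Prepared (st′ E) chs (length (chosen ch ++ Ys))
        rest = phase₁ ps (st′ E) (chosen ch ++ Ys) pcs chs (λ q q∈ → sizes q (there q∈))
          (extend-stage (root st) piece ch sg) inv′ room₂ (≤-trans (≤-reflexive (cong (2 *_) len)) small)

    -- A score below Z / (2J) would leave a deficit above (1 - 1/(2J)) Z, while |Ys| ≥ Z / y₀ makes
    -- (X + |Ys|) / X at least 1 + 1/J. The product is at least 1 + 1/(4J), and its power with
    -- exponent Λ = 4 J j₂ outgrows the number of pairs.
    reward-enough : ∀ φ Ys y₀ J j₂ → J ≡ 2 * κ * y₀ → Λ ≡ 4 * J * j₂ → length is < 2 ^ j₂ → 2 ≤ J → Z ≤ y₀ * length Ys →
      Rewarded φ Ys → ∀ i → i ∈ is → Z ≤ 2 * J * score φ Ys i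
    reward-enough φ Ys y₀ J j₂ J≡ Λ≡ is< 2≤J Z≤ inv i i∈ = ≮⇒≥ λ lt →
      growth-contradiction (4 * J) j₂ Λ (length is) (2 * J * J * (Z * Z)) Λ≡ is< (*-mono-≤ {1} {4} (s≤s z≤n) J>0)
        (*-mono-≤ {1} {2 * J * J} (*-mono-≤ {1} {2 * J} (*-mono-≤ {1} {2} (s≤s z≤n) J>0) J>0) (*-mono-≤ Z>0 Z>0)) (begin
        (2 * J * J * (Z * Z) * (4 * J + 1)) ^ Λ          ≡⟨ cong (_^ Λ) (e₁ (2 * J * J) (Z * Z) (4 * J + 1)) ⟩
        (2 * J * J * (4 * J + 1) * (Z * Z)) ^ Λ          ≤⟨ ^-monoˡ-≤ Λ (*-monoˡ-≤ (Z * Z) (reward-gap J e₀ 2≤J e₀≡)) ⟩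
        (4 * J * (e₀ * (J + 1)) * (Z * Z)) ^ Λ           ≡⟨ cong (_^ Λ) (e₂ (4 * J) e₀ (J + 1) Z) ⟩
        (4 * J * ((e₀ * Z) * ((J + 1) * Z))) ^ Λ         ≤⟨ ^-monoˡ-≤ Λ (*-monoʳ-≤ (4 * J) (*-mono-≤ (low lt) high)) ⟩
        (4 * J * (2 * J * B * (y₀ * (X + length Ys)))) ^ Λ ≡⟨ cong (_^ Λ) (e₃ (4 * J) (2 * J) B y₀ (X + length Ys)) ⟩
        (4 * J * (2 * J * y₀) * (B * (X + length Ys))) ^ Λ ≡⟨ trans (*-pow (4 * J * (2 * J * y₀)) (B * (X + length Ys)) Λ) (cong ((4 * J * (2 * J * y₀)) ^ Λ *_) (*-pow B (X + length Ys) Λ)) ⟩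
        (4 * J * (2 * J * y₀)) ^ Λ * (B ^ Λ * (X + length Ys) ^ Λ) ≤⟨ *-monoʳ-≤ ((4 * J * (2 * J * y₀)) ^ Λ) (*-monoˡ-≤ ((X + length Ys) ^ Λ) (∑-≥ (λ i → (Z ∸ score φ Ys i) ^ Λ) i∈)) ⟩
        (4 * J * (2 * J * y₀)) ^ Λ * (deficit φ Ys * (X + length Ys) ^ Λ) ≤⟨ *-monoʳ-≤ ((4 * J * (2 * J * y₀)) ^ Λ) inv ⟩
        (4 * J * (2 * J * y₀)) ^ Λ * (length is * (Z * X) ^ Λ) ≡⟨ *-left-comm ((4 * J * (2 * J * y₀)) ^ Λ) (length is) ((Z * X) ^ Λ) ⟩
        length is * ((4 * J * (2 * J * y₀)) ^ Λ * (Z * X) ^ Λ) ≡⟨ cong (length is *_) (sym (*-pow (4 * J * (2 * J * y₀)) (Z * X) Λ)) ⟩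
        length is * (4 * J * (2 * J * y₀) * (Z * X)) ^ Λ ≡⟨ cong (λ z → length is * z ^ Λ) (trans (e₄ J y₀ Z κ) (cong (λ z → 2 * J * z * (Z * Z) * (4 * J)) (sym J≡))) ⟩
        length is * (2 * J * J * (Z * Z) * (4 * J)) ^ Λ ∎)
      where
      open ≤-Reasoning
      B e₀ : ℕ
      B = Z ∸ score φ Ys i
      e₀ = pred (2 * J)
      J>0 : 0 < J
      J>0 = ≤-trans (s≤s z≤n) 2≤J
      e₀≡ : suc e₀ ≡ 2 * J
      e₀≡ = suc-pred (2 * J) {{>-nonZero (*-mono-≤ {1} {2} (s≤s z≤n) J>0)}}
      low : 2 * J * score φ Ys i < Z → e₀ * Z ≤ 2 * J * B
      low lt = cert 0 (+-mono-≤ (*-monoʳ-≤ (2 * J) (m≤m∸n+n Z (score φ Ys i))) (+-mono-≤ (<⇒≤ lt) (*-monoʳ-≤ Z (≤-reflexive e₀≡)))) (eq e₀ Z J B (score φ Ys i))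
        where
        m≤m∸n+n : ∀ m n → m ≤ m ∸ n + n
        m≤m∸n+n m n = ≤-trans (m≤n+m∸n m n) (≤-reflexive (+-comm n (m ∸ n)))
        eq : ∀ e Z J B sc → e * Z + (2 * J * (B + sc) + (Z + Z * (2 * J))) + 0 ≡ 2 * J * B + (2 * J * Z + (2 * J * sc + Z * (1 + e)))
        eq = solve-∀
      high : (J + 1) * Z ≤ y₀ * (X + length Ys)
      high = cert 0 (+-mono-≤ Z≤ (*-monoʳ-≤ Z (≤-reflexive J≡))) (eq J Z y₀ κ (length Ys))
        where
        eq : ∀ J Z y κ l → (J + 1) * Z + (y * l + Z * (2 * κ * y)) + 0 ≡ y * (2 * (Z * κ) + l) + (Z + Z * J)
        eq = solve-∀
      e₁ : ∀ a b c → a * b * c ≡ a * c * b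
      e₁ = solve-∀
      e₂ : ∀ a e q Z → a * (e * q) * (Z * Z) ≡ a * ((e * Z) * (q * Z))
      e₂ = solve-∀
      e₃ : ∀ a b B y x → a * (b * B * (y * x)) ≡ a * (b * y) * (B * x)
      e₃ = solve-∀
      e₄ : ∀ J y Z κ → 4 * J * (2 * J * y) * (Z * (2 * (Z * κ))) ≡ 2 * J * (2 * κ * y) * (Z * Z) * (4 * J)
      e₄ = solve-∀

  -- Absorbing the leftover vertices.

  relocate : ∀ {D} (st : State D) y u → y ∈ D → y ≢ t → nbr y y ≡ false → U st u ≡ true →
    (∀ z → nbr y z ≡ true → e u (φ st z) ≡ true) →
    Σ (State D) λ st₁ → φ st₁ ≡ upd (φ st) y u × U st₁ (φ st y) ≡ true
  relocate {D} st y u y∈ y≢t irr Uu joined = record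
    { φ = φ₁
    ; U = U₁
    ; used = used′
    ; inj = inj′
    ; edge = edge′
    ; closed = closed st
    ; root = root st
    ; size = trans (cong (_+ length D) card) (size st)
    } , refl , ∨-l (==-refl w)
    where
    w : Fin n
    w = φ st y
    φ₁ : Fin n → Fin n
    φ₁ = upd (φ st) y u
    U₁ : Fin n → Bool
    U₁ z = (z == w) ∨ (U st ⊖ u) z
    Uw : U st w ≡ false
    Uw = used st y y∈
    old : ∀ {z} → z ≢ y → φ₁ z ≡ φ st z
    old ne = upd-other (φ st) u ne
    new : φ₁ y ≡ u
    new = upd-same (φ st) y u
    u≢ : ∀ {z} → z ∈ D → φ st z ≢ u
    u≢ {z} z∈ eq = case trans (sym (used st z z∈)) (subst (λ q → U st q ≡ true) (sym eq) Uu) of λ ()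
    U₁-false : ∀ z → z ≢ w → U st z ∧ not (z == u) ≡ false → U₁ z ≡ false
    U₁-false z ne q rewrite ==-≢ ne = q
    used′ : ∀ z → z ∈ D → U₁ (φ₁ z) ≡ false
    used′ z z∈ with z FinP.≟ y
    ... | yes refl = U₁-false u (λ eq → u≢ y∈ (sym eq)) (trans (cong (λ b → U st u ∧ not b) (==-refl u)) (∧-zeroʳ (U st u)))
    ... | no ne = U₁-false (φ st z) (λ eq → ne (inj st z y z∈ y∈ eq)) (cong (_∧ not (φ st z == u)) (used st z z∈))
    inj′ : ∀ a b → a ∈ D → b ∈ D → φ₁ a ≡ φ₁ b → a ≡ b
    inj′ a b a∈ b∈ eq with a FinP.≟ y | b FinP.≟ y
    ... | yes refl | yes refl = refl
    ... | yes refl | no _ = ⊥-elim (u≢ b∈ (sym eq))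
    ... | no _ | yes refl = ⊥-elim (u≢ a∈ eq)
    ... | no _ | no _ = inj st a b a∈ b∈ eq
    par≢ : ∀ z → z ≢ t → par z ≡ y → z ≢ y
    par≢ z z≢t pz refl = case trans (sym irr) (subst (λ q → nbr z q ≡ true) pz (par-nbr z z≢t)) of λ ()
    edge′ : ∀ z → z ∈ D → z ≢ t → e (φ₁ z) (φ₁ (par z)) ≡ true
    edge′ z z∈ z≢t = by (z FinP.≟ y) (par z FinP.≟ y)
      where
      by : Dec (z ≡ y) → Dec (par z ≡ y) → e (φ₁ z) (φ₁ (par z)) ≡ true
      by (yes refl) (yes pz) = ⊥-elim (par≢ z z≢t pz refl)
      by (yes refl) (no ne) = subst₂ (λ a b → e a b ≡ true) (sym new) (sym (old ne)) (joined (par z) (par-nbr z z≢t))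
      by (no ne) (yes refl) = subst₂ (λ a b → e a b ≡ true) (sym (old ne)) (sym new) (trans (e-sym _ u) (joined z (trans (nbr-sym (par z) z) (par-nbr z z≢t))))
      by (no ne) (no ne′) = subst₂ (λ a b → e a b ≡ true) (sym (old ne)) (sym (old ne′)) (edge st z z∈ z≢t)
    card : # U₁ ≡ # (U st)
    card = trans (#-⊖ U₁ w (∨-l (==-refl w))) (trans (cong suc (∑-cong (allFin n) (λ z → cong ⟦_⟧ (pt z)))) (sym (#-⊖ (U st) u Uu)))
      where
      pt : ∀ z → (U₁ ⊖ w) z ≡ (U st ⊖ u) z
      pt z with z FinP.≟ w
      ... | yes refl rewrite Uw = refl
      ... | no _ = ∧-identityʳ ((U st ⊖ u) z)

  -- Each leftover vertex consumes one absorber and lowers every score by at most 1, so one absorber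
  -- per leftover vertex and pair suffices. Scores are known for all pairs, hence any free u will
  -- do.
  phase₃ : ∀ xs {D} (st : State D) Ys → Build D xs → Fresh D xs → Stage D Ys → length xs + length D ≡ n →
    (∀ i → length xs ≤ score (φ st) Ys i) → Σ (State (xs ʳ++ D)) λ st″ → φ st″ t ≡ φ st t
  phase₃ [] st Ys _ _ _ _ _ = st , refl
  phase₃ (x ∷ xs) {D} st Ys (px∈ ∷ bu) (x∉ ∷ fr) sg len enough-scores = step-u (#-∃ (U st) free)
    where
    free : 0 < # (U st)
    free = subst (0 <_) (sym (+-cancelʳ-≡ (length D) (# (U st)) (suc (length xs)) (trans (size st) (sym len)))) (s≤s z≤n)
    x≢t : x ≢ t
    x≢t refl = x∉ (root st)
    v : Fin n
    v = φ st (par x)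
    Result : Set
    Result = Σ (State (xs ʳ++ (x ∷ D))) λ st″ → φ st″ t ≡ φ st t
    step-y : ∀ u → U st u ≡ true → ∀ y → y ∈ Ys → absorbs (φ st) y (u , v) ≡ true → Result
    step-y u Uu y y∈ ab = go (relocate st y u (proj₁ settled-y) y≢t (Stage.independent sg y y y∈ y∈) Uu joined)
      where
      settled-y : Settled D y
      settled-y = Stage.settled sg y y∈
      y≢t : y ≢ t
      y≢t refl = Stage.avoids-root sg y∈
      -- All neighbours of y are placed and x is not, so moving y leaves the image v of the parent
      -- of x where it is.
      y≢px : par x ≢ y
      y≢px refl = x∉ (proj₂ settled-y x (trans (nbr-sym (par x) x) (par-nbr x x≢t)))
      joined : ∀ z → nbr y z ≡ true → e u (φ st z) ≡ true
      joined z q = use (every-e {xs = V} (∧-r {e v (φ st y)} ab) (∈-allFin z))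
        where
        use : not (nbr y z) ∨ e u (φ st z) ≡ true → e u (φ st z) ≡ true
        use r rewrite q = r
      go : (Σ (State D) λ st₁ → φ st₁ ≡ upd (φ st) y u × U st₁ (φ st y) ≡ true) → Result
      go (st₁ , φ₁≡ , U₁w) =
        let st₃ , eq = phase₃ xs st₂ (remove y∈) bu fr sg′ (trans (+-suc (length xs) (length D)) len) scores
        in st₃ , trans eq (trans (upd-other (φ st₁) (φ st y) (∈≢ (root st) x∉)) (trans (cong (λ ψ → ψ t) φ₁≡) (upd-other (φ st) u (λ q → y≢t (sym q)))))
        where
        φ₁-other : ∀ {z} → z ≢ y → φ st₁ z ≡ φ st z
        φ₁-other {z} ne = trans (cong (λ ψ → ψ z) φ₁≡) (upd-other (φ st) u ne)
        st₂ : State (x ∷ D)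
        st₂ = place st₁ x (φ st y) x∉ px∈ U₁w (subst (λ q → e (φ st y) q ≡ true) (sym (φ₁-other y≢px)) (trans (e-sym _ v) (∧-l ab)))
        φ₂-other : ∀ {z} → z ∈ D → z ≢ y → φ st₂ z ≡ φ st z
        φ₂-other z∈ ne = trans (upd-other (φ st₁) (φ st y) (∈≢ z∈ x∉)) (φ₁-other ne)
        sg′ : Stage (x ∷ D) (remove y∈)
        sg′ = record
          { unique = unique-remove y∈ (Stage.unique sg)
          ; settled = λ z z∈ → let a , b = Stage.settled sg z (∈-remove y∈ z∈) in there a , λ q r → there (b q r)
          ; independent = λ a b a∈ b∈ → Stage.independent sg a b (∈-remove y∈ a∈) (∈-remove y∈ b∈)
          ; avoids-root = Stage.avoids-root sg ∘ ∈-remove y∈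
          }
        same-score : ∀ i → score (φ st₂) (remove y∈) i ≡ score (φ st) (remove y∈) i
        same-score i = ∑-cong∈ (remove y∈) (λ z z∈ → cong ⟦_⟧ (absorbs-cong (φ st) (φ st₂) z
          (φ₂-other (proj₁ (Stage.settled sg z (∈-remove y∈ z∈))) (remove-≢ y∈ (Stage.unique sg) z∈))
          (λ q r → φ₂-other (proj₂ (Stage.settled sg z (∈-remove y∈ z∈)) q r)
            (λ { refl → case trans (sym (Stage.independent sg z q (∈-remove y∈ z∈) y∈)) r of λ () })) i))
        scores : ∀ i → length xs ≤ score (φ st₂) (remove y∈) i
        scores i = ≤-trans (≤-pred (≤-trans (enough-scores i) (≤-trans (≤-reflexive (∑-remove y∈ (λ z → ⟦ absorbs (φ st) z i ⟧)))
          (+-monoˡ-≤ _ (⟦⟧≤1 (absorbs (φ st) y i)))))) (≤-reflexive (sym (same-score i)))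
    step-u : (∃ λ u → U st u ≡ true) → Result
    step-u (u , Uu) =
      let y , y∈ , lt = ∑-<-∃ Ys (λ _ → 0) (λ y → ⟦ absorbs (φ st) y (u , v) ⟧)
            (subst (_< score (φ st) Ys (u , v)) (sym (∑-0 Ys)) (<-≤-trans (s≤s z≤n) (enough-scores (u , v))))
      in step-y u Uu y y∈ (⟦⟧-pos lt)

  -- Cutting the tree into pieces.

  verts : PieceList → List (Fin n)
  verts [] = []
  verts ((p , ys) ∷ ps) = p ∷ (ys ++ verts ps)

  mass : PieceList → (Fin n → ℕ) → ℕ
  mass ps f = ∑ ps (λ q → f (proj₁ q) + ∑ (proj₂ q) f)

  ∑-verts : ∀ ps f → ∑ (verts ps) f ≡ mass ps f
  ∑-verts [] f = refl
  ∑-verts ((p , ys) ∷ ps) f = trans (cong (f p +_) (trans (∑-++ ys (verts ps) f) (cong (∑ ys f +_) (∑-verts ps f)))) (sym (+-assoc (f p) _ _))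

  mass-1 : ∀ ps → mass ps (λ _ → 1) ≡ total ps
  mass-1 ps = ∑-cong ps (λ q → cong suc (∑-1 (proj₂ q)))

  data Ordered (S : List (Fin n)) : PieceList → Set where
    [] : Ordered S []
    _∷_ : ∀ {p ys ps} → par p ∈ S → Ordered ((p ∷ ys) ʳ++ S) ps → Ordered S ((p , ys) ∷ ps)

  _⊆_ : List (Fin n) → List (Fin n) → Set
  S ⊆ S′ = ∀ {x} → x ∈ S → x ∈ S′

  ʳ++-⊆ : ∀ xs {S S′} → S ⊆ S′ → (xs ʳ++ S) ⊆ (xs ʳ++ S′)
  ʳ++-⊆ [] sub = sub
  ʳ++-⊆ (x ∷ xs) sub = ʳ++-⊆ xs (λ { (here q) → here q ; (there q) → there (sub q) })

  ordered-mono : ∀ {S S′ ps} → S ⊆ S′ → Ordered S ps → Ordered S′ ps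
  ordered-mono sub [] = []
  ordered-mono sub (_∷_ {p} {ys} p∈ o) = sub p∈ ∷ ordered-mono (ʳ++-⊆ (p ∷ ys) sub) o

  build-mono : ∀ {S S′ xs} → S ⊆ S′ → Build S xs → Build S′ xs
  build-mono sub [] = []
  build-mono sub (p∈ ∷ b) = sub p∈ ∷ build-mono (λ { (here q) → here q ; (there q) → there (sub q) }) b

  build-++ : ∀ {S} xs {ys} → Build S xs → Build (xs ʳ++ S) ys → Build S (xs ++ ys)
  build-++ [] [] b = b
  build-++ (x ∷ xs) (p∈ ∷ a) b = p∈ ∷ build-++ xs a b

  verts-⊆ : ∀ {ps q x} → q ∈ ps → x ∈ proj₁ q ∷ proj₂ q → x ∈ verts ps
  verts-⊆ (here refl) (here eq) = here eq
  verts-⊆ (here refl) (there x∈) = there (∈-++⁺ˡ x∈)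
  verts-⊆ {(p , ys) ∷ ps} (there q∈) x∈ = there (∈-++⁺ʳ ys (verts-⊆ q∈ x∈))

  verts-e : ∀ ps {x} → x ∈ verts ps → ∃ λ q → q ∈ ps × x ∈ proj₁ q ∷ proj₂ q
  verts-e ((p , ys) ∷ ps) (here eq) = (p , ys) , here refl , here eq
  verts-e ((p , ys) ∷ ps) (there x∈) with ∈-++⁻ ys x∈
  ... | inj₁ y∈ = (p , ys) , here refl , there y∈
  ... | inj₂ r = let q , q∈ , xq = verts-e ps r in q , there q∈ , xq

  Good : Fin n × List (Fin n) → Set
  Good q = Build (proj₁ q ∷ []) (proj₂ q) × size-of q ≤ suc s₁

  -- op: parts whose root has its parent still in D; cl: finished pieces.
  record Partial (D : List (Fin n)) (op cl : PieceList) : Set where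
    field
      sums : ∀ (f : Fin n → ℕ) → ∑ D f + (mass op f + mass cl f) ≡ ∑ V f
      op-good : ∀ q → q ∈ op → Good q
      op-par : ∀ q → q ∈ op → proj₁ q ≢ t × par (proj₁ q) ∈ D
      cl-good : ∀ q → q ∈ cl → Good q
      ordered : Ordered (verts op) cl
      count : length cl * s₁ ≤ Δ * total cl

  -- `sums` expresses that the root and the pieces partition the vertices: indicators of points give
  -- multiplicity one, and f = 1 gives the sizes.
  record Decomposition : Set where
    field
      pieces : PieceList
      sums : ∀ (f : Fin n → ℕ) → f t + mass pieces f ≡ ∑ V f
      good : ∀ q → q ∈ pieces → Good q
      ordered : Ordered (t ∷ []) pieces
      count : length pieces * s₁ ≤ Δ * (s₁ + n)

  -- The roots of these parts are neighbours of x, and `sums` at the indicator of N(x) counts none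
  -- of them twice.
  few-children : ∀ {D op cl} → Partial D op cl → ∀ x → length (select (λ q → par (proj₁ q) == x) op) ≤ Δ
  few-children {D} {op} {cl} pt x = begin
    length (select (λ q → par (proj₁ q) == x) op) ≡⟨ length-select _ op ⟩
    ∑ op (λ q → ⟦ par (proj₁ q) == x ⟧) ≤⟨ ∑-mono∈ op (λ q q∈ → ≤-trans (⟦⟧-mono (λ r → child q q∈ (==⇒≡ r))) (m≤m+n ⟦ nbr x (proj₁ q) ⟧ _)) ⟩
    mass op f ≤⟨ ≤-trans (m≤m+n (mass op f) (mass cl f)) (m≤n+m _ (∑ D f)) ⟩
    ∑ D f + (mass op f + mass cl f) ≡⟨ Partial.sums pt f ⟩
    # (nbr x) ≤⟨ deg≤ x ⟩
    Δ ∎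
    where
    open ≤-Reasoning
    f : Fin n → ℕ
    f z = ⟦ nbr x z ⟧
    child : ∀ q → q ∈ op → par (proj₁ q) ≡ x → nbr x (proj₁ q) ≡ true
    child q q∈ refl = trans (nbr-sym _ _) (par-nbr (proj₁ q) (proj₁ (Partial.op-par pt q q∈)))

  children-build : ∀ {S x} → x ∈ S → ∀ ks → (∀ q → q ∈ ks → par (proj₁ q) ≡ x × Build (proj₁ q ∷ []) (proj₂ q)) → Build S (verts ks)
  children-build x∈ [] ok = []
  children-build {S} {x} x∈ ((p , ys) ∷ ks) ok =
    subst (_∈ S) (sym (proj₁ (ok (p , ys) (here refl)))) x∈ ∷
    build-++ ys (build-mono (λ { (here q) → here q }) (proj₂ (ok (p , ys) (here refl))))
      (children-build (∈-ʳ++ʳ ys (there x∈)) ks (λ q q∈ → ok q (there q∈)))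

  -- Pieces are closed bottom-up but placed top-down, so newly closed ones go in front; older ones
  -- hang from vertices in `ks` or in parts still open.
  ordered-after : ∀ {x S₀ cl} ks {S} → (∀ q → q ∈ ks → par (proj₁ q) ≡ x) → x ∈ S → (∀ {z} → z ∈ S₀ → z ∈ verts ks ⊎ z ∈ S) →
    Ordered S₀ cl → Ordered S (ks ++ cl)
  ordered-after [] ok x∈ sub o = ordered-mono (λ z∈ → case sub z∈ of λ { (inj₂ r) → r }) o
  ordered-after ((p , ys) ∷ ks) {S} ok x∈ sub o = subst (_∈ S) (sym (ok _ (here refl))) x∈ ∷
    ordered-after ks (λ q q∈ → ok q (there q∈)) (∈-ʳ++ʳ (p ∷ ys) x∈) (λ z∈ → shift (sub z∈)) o
    where
    shift : ∀ {z} → z ∈ verts ((p , ys) ∷ ks) ⊎ z ∈ S → z ∈ verts ks ⊎ z ∈ (p ∷ ys) ʳ++ S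
    shift (inj₂ r) = inj₂ (∈-ʳ++ʳ (p ∷ ys) r)
    shift (inj₁ (here refl)) = inj₂ (∈-ʳ++ˡ {xs = p ∷ ys} S (here refl))
    shift (inj₁ (there r)) with ∈-++⁻ ys r
    ... | inj₁ q = inj₂ (∈-ʳ++ˡ {xs = p ∷ ys} S (there q))
    ... | inj₂ q = inj₁ q

  module _ {x : Fin n} {D : List (Fin n)} {op cl : PieceList} (px∈ : par x ∈ D) (x≢t : x ≢ t) (pt : Partial (x ∷ D) op cl) where

    private
      isKid : Fin n × List (Fin n) → Bool
      isKid q = par (proj₁ q) == x
      kids rest : PieceList
      kids = select isKid op
      rest = select (not ∘ isKid) op

      split : ∀ f → mass kids f + mass rest f ≡ mass op f
      split f = ∑-select-split isKid op (λ q → f (proj₁ q) + ∑ (proj₂ q) f)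

      rest-par : ∀ q → q ∈ rest → proj₁ q ≢ t × par (proj₁ q) ∈ D
      rest-par q q∈ with ∈-select (not ∘ isKid) q∈
      ... | q∈op , nk with Partial.op-par pt q q∈op
      ... | ne , there r = ne , r
      ... | ne , here eq = ⊥-elim (case trans (sym nk) (cong not (trans (cong (_== x) eq) (==-refl x))) of λ ())

      rest-good : ∀ q → q ∈ rest → Good q
      rest-good q q∈ = Partial.op-good pt q (proj₁ (∈-select (not ∘ isKid) q∈))

      kid-good : ∀ q → q ∈ kids → par (proj₁ q) ≡ x × Build (proj₁ q ∷ []) (proj₂ q)
      kid-good q q∈ = let q∈op , k = ∈-select isKid q∈ in ==⇒≡ k , proj₁ (Partial.op-good pt q q∈op)

      reorder : ∀ {op′ cl′} → (∀ f → mass op′ f + mass cl′ f ≡ f x + (mass op f + mass cl f)) →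
        ∀ f → ∑ D f + (mass op′ f + mass cl′ f) ≡ ∑ V f
      reorder eq f = trans (cong (∑ D f +_) (eq f)) (trans (+-left-assoc (∑ D f) (f x) (mass op f + mass cl f)) (Partial.sums pt f))

      kid-verts : ∀ {z} → z ∈ verts op → z ∈ verts kids ⊎ z ∈ verts rest
      kid-verts {z} z∈ with verts-e op z∈
      ... | q , q∈ , zq = by (bool-split (isKid q))
        where
        in-select : ∀ (P : Fin n × List (Fin n) → Bool) {xs} → q ∈ xs → P q ≡ true → q ∈ select P xs
        in-select P (here refl) Pq rewrite Pq = here refl
        in-select P {y ∷ xs} (there r) Pq with P y
        ... | true = there (in-select P r Pq)
        ... | false = in-select P r Pq
        by : isKid q ≡ true ⊎ isKid q ≡ false → z ∈ verts kids ⊎ z ∈ verts rest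
        by (inj₁ k) = inj₁ (verts-⊆ (in-select isKid q∈ k) zq)
        by (inj₂ k) = inj₂ (verts-⊆ (in-select (not ∘ isKid) q∈ (cong not k)) zq)

    join : total kids ≤ s₁ → Partial D ((x , verts kids) ∷ rest) cl
    join le = record
      { sums = reorder {(x , verts kids) ∷ rest} {cl} (λ f → trans (cong (λ z → f x + z + mass rest f + mass cl f) (∑-verts kids f))
          (trans (eq (f x) (mass kids f) (mass rest f) (mass cl f)) (cong (λ z → f x + (z + mass cl f)) (split f))))
      ; op-good = λ { q (here refl) → children-build (here refl) kids kid-good , s≤s (≤-trans (≤-reflexive (trans (sym (∑-1 (verts kids))) (trans (∑-verts kids (λ _ → 1)) (mass-1 kids)))) le)
                    ; q (there q∈) → rest-good q q∈ }
      ; op-par = λ { q (here refl) → x≢t , px∈ ; q (there q∈) → rest-par q q∈ }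
      ; cl-good = Partial.cl-good pt
      ; ordered = ordered-mono sub (Partial.ordered pt)
      ; count = Partial.count pt
      }
      where
      eq : ∀ a b c d → a + b + c + d ≡ a + (b + c + d)
      eq = solve-∀
      sub : verts op ⊆ verts ((x , verts kids) ∷ rest)
      sub z∈ with kid-verts z∈
      ... | inj₁ r = there (∈-++⁺ˡ r)
      ... | inj₂ r = there (∈-++⁺ʳ (verts kids) r)

    -- At most Δ pieces are closed here and together they have more than s₁ vertices, so each cut
    -- satisfies `count` by itself.
    cut : s₁ < total kids → Partial D ((x , []) ∷ rest) (kids ++ cl)
    cut lt = record
      { sums = reorder {(x , []) ∷ rest} {kids ++ cl} (λ f → trans (cong (f x + 0 + mass rest f +_) (∑-++ kids cl (λ q → f (proj₁ q) + ∑ (proj₂ q) f)))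
          (trans (eq (f x) (mass kids f) (mass rest f) (mass cl f)) (cong (λ z → f x + (z + mass cl f)) (split f))))
      ; op-good = λ { q (here refl) → [] , s≤s z≤n ; q (there q∈) → rest-good q q∈ }
      ; op-par = λ { q (here refl) → x≢t , px∈ ; q (there q∈) → rest-par q q∈ }
      ; cl-good = λ q q∈ → cl-good′ q (∈-++⁻ kids q∈)
      ; ordered = ordered-after kids (λ q q∈ → proj₁ (kid-good q q∈)) (here refl) sub (Partial.ordered pt)
      ; count = count′
      }
      where
      eq : ∀ a b c d → a + 0 + c + (b + d) ≡ a + (b + c + d)
      eq = solve-∀
      cl-good′ : ∀ q → q ∈ kids ⊎ q ∈ cl → Good q
      cl-good′ q (inj₁ q∈) = Partial.op-good pt q (proj₁ (∈-select isKid q∈))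
      cl-good′ q (inj₂ q∈) = Partial.cl-good pt q q∈
      sub : ∀ {z} → z ∈ verts op → z ∈ verts kids ⊎ z ∈ x ∷ verts rest
      sub z∈ with kid-verts z∈
      ... | inj₁ r = inj₁ r
      ... | inj₂ r = inj₂ (there r)
      count′ : length (kids ++ cl) * s₁ ≤ Δ * total (kids ++ cl)
      count′ = begin
        length (kids ++ cl) * s₁ ≡⟨ trans (cong (_* s₁) (length-++ kids)) (*-distribʳ-+ s₁ (length kids) (length cl)) ⟩
        length kids * s₁ + length cl * s₁ ≤⟨ +-mono-≤ (*-mono-≤ (few-children pt x) (<⇒≤ lt)) (Partial.count pt) ⟩
        Δ * total kids + Δ * total cl ≡⟨ trans (sym (*-distribˡ-+ Δ (total kids) (total cl))) (cong (Δ *_) (sym (∑-++ kids cl size-of))) ⟩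
        Δ * total (kids ++ cl) ∎
        where open ≤-Reasoning

    advance : ∃ λ op′ → ∃ λ cl′ → Partial D op′ cl′
    advance with total kids ≤? s₁
    ... | yes le = _ , _ , join le
    ... | no nle = _ , _ , cut (≰⇒> nle)

  finish : ∀ {op cl} → Partial (t ∷ []) op cl → Decomposition
  finish {op} {cl} pt = record
    { pieces = op ++ cl
    ; sums = λ f → trans (cong (f t +_) (∑-++ op cl (λ q → f (proj₁ q) + ∑ (proj₂ q) f))) (trans (cong (_+ (mass op f + mass cl f)) (sym (+-identityʳ (f t)))) (Partial.sums pt f))
    ; good = λ q q∈ → good′ q (∈-++⁻ op q∈)
    ; ordered = ordered-after op below-root (here refl) inj₁ (Partial.ordered pt)
    ; count = count′
    }
    where
    below-root : ∀ q → q ∈ op → par (proj₁ q) ≡ t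
    below-root q q∈ with proj₂ (Partial.op-par pt q q∈)
    ... | here eq = eq
    good′ : ∀ q → q ∈ op ⊎ q ∈ cl → Good q
    good′ q (inj₁ q∈) = Partial.op-good pt q q∈
    good′ q (inj₂ q∈) = Partial.cl-good pt q q∈
    few : length op ≤ Δ
    few = ≤-trans (≤-reflexive (trans (sym (∑-1 op)) (trans (∑-cong∈ op (λ q q∈ → cong ⟦_⟧ (sym (trans (cong (_== t) (below-root q q∈)) (==-refl t))))) (sym (length-select (λ q → par (proj₁ q) == t) op))))) (few-children pt t)
    total≤ : total cl ≤ n
    total≤ = ≤-trans (≤-trans (≤-trans (≤-reflexive (sym (mass-1 cl))) (m≤n+m (mass cl (λ _ → 1)) (mass op (λ _ → 1)))) (m≤n+m _ (∑ (t ∷ []) (λ _ → 1))))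
      (≤-reflexive (trans (Partial.sums pt (λ _ → 1)) (trans (∑-1 V) (length-allFin n))))
    count′ : length (op ++ cl) * s₁ ≤ Δ * (s₁ + n)
    count′ = begin
      length (op ++ cl) * s₁ ≡⟨ trans (cong (_* s₁) (length-++ op)) (*-distribʳ-+ s₁ (length op) (length cl)) ⟩
      length op * s₁ + length cl * s₁ ≤⟨ +-mono-≤ (*-monoˡ-≤ s₁ few) (≤-trans (Partial.count pt) (*-monoʳ-≤ Δ total≤)) ⟩
      Δ * s₁ + Δ * n ≡⟨ sym (*-distribˡ-+ Δ s₁ n) ⟩
      Δ * (s₁ + n) ∎
      where open ≤-Reasoning

  decompose : ∀ {D op cl} → Grown t par D → Partial D op cl → Decomposition
  decompose seed pt = finish pt
  decompose (sprout px∈ x≢t g) pt = let _ , _ , pt′ = advance px∈ x≢t pt in decompose g pt′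

  to-pieces : ∀ ps D → t ∈ D → Ordered D ps → (∀ q → q ∈ ps → Good q) → (∀ x → mult D x + mult (verts ps) x ≤ 1) → Pieces D ps
  to-pieces [] D t∈ [] good le = []
  to-pieces ((p , ys) ∷ ps) D t∈ (p∈ ∷ o) good le = record
      { attached = p∈
      ; build = proj₁ (good (p , ys) (here refl))
      ; fresh = fr
      ; alternate = λ x x∈ → alternates x (λ { refl → fresh-∉ fr (there x∈) t∈ })
      } ∷ to-pieces ps ((p ∷ ys) ʳ++ D) (∈-ʳ++ʳ (p ∷ ys) t∈) o (λ q q∈ → good q (there q∈))
        (λ x → ≤-trans (≤-reflexive (trans (cong (_+ mult (verts ps) x) (∑-ʳ++ (p ∷ ys) D (λ y → ⟦ y == x ⟧)))
          (trans (eq ⟦ p == x ⟧ (mult ys x) (mult D x) (mult (verts ps) x)) (cong (λ z → mult D x + (⟦ p == x ⟧ + z)) (sym (∑-++ ys (verts ps) (λ y → ⟦ y == x ⟧))))))) (le x))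
    where
    eq : ∀ a b c d → a + b + c + d ≡ c + (a + (b + d))
    eq = solve-∀
    fr : Fresh D (p ∷ ys)
    fr = mult-fresh D (p ∷ ys) (λ x → ≤-trans (+-monoʳ-≤ (mult D x) (+-monoʳ-≤ ⟦ p == x ⟧ (≤-trans (m≤m+n (mult ys x) (mult (verts ps) x)) (≤-reflexive (sym (∑-++ ys (verts ps) (λ y → ⟦ y == x ⟧))))))) (le x))

  -- Finding absorbers inside the pieces.

  module _ (ps : PieceList) (sums : ∀ (f : Fin n → ℕ) → f t + mass ps f ≡ ∑ V f) (good : ∀ q → q ∈ ps → Good q) where

    once : ∀ x → ⟦ t == x ⟧ + mass ps (λ y → ⟦ y == x ⟧) ≡ 1
    once x = trans (sums (λ y → ⟦ y == x ⟧)) (mult-all x)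

    mass≤1 : ∀ x → mass ps (λ y → ⟦ y == x ⟧) ≤ 1
    mass≤1 x = ≤-trans (m≤n+m _ ⟦ t == x ⟧) (≤-reflexive (once x))

    piece-mult : ∀ {q} → q ∈ ps → ∀ x → mult (proj₂ q) x ≤ 1
    piece-mult {q} q∈ x = ≤-trans (m≤n+m (mult (proj₂ q) x) ⟦ proj₁ q == x ⟧) (≤-trans (∑-≥ (λ r → ⟦ proj₁ r == x ⟧ + mult (proj₂ r) x) q∈) (mass≤1 x))

    located : ∀ x → x ≢ t → ∃ λ q → q ∈ ps × x ∈ proj₁ q ∷ proj₂ q
    located x x≢t with x ∈? verts ps
    ... | yes x∈ = verts-e ps x∈
    ... | no x∉ = ⊥-elim (1+n≢0 (trans (sym (once x)) (cong₂ _+_ (cong ⟦_⟧ (==-≢ (λ q → x≢t (sym q)))) (trans (sym (∑-verts ps _)) (mult-zero (verts ps) x x∉)))))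

    same-piece : ∀ {q r x} → q ∈ ps → r ∈ ps → x ∈ proj₁ q ∷ proj₂ q → x ∈ proj₁ r ∷ proj₂ r → q ≡ r
    same-piece {q} {r} {x} q∈ r∈ xq xr with two-members (λ s → ⟦ proj₁ s == x ⟧ + mult (proj₂ s) x) q∈ r∈
    ... | inj₁ eq = eq
    ... | inj₂ le = ⊥-elim (<⇒≱ (≤-trans (+-mono-≤ (mult-∈ xq) (mult-∈ xr)) le) (mass≤1 x))

    outside : Fin n → ℕ
    outside y = ∑ ps (λ r → ⟦ y == par (proj₁ r) ⟧)

    inner : List (Fin n) → Fin n → ℕ
    inner ys y = ∑ ys (λ z → ⟦ y == par z ⟧)

    thin : List (Fin n) → Fin n → Bool
    thin ys y = (inner ys y ≤ᵇ 1) ∧ (outside y ≤ᵇ 0)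

    -- Every y contributes at least 2 to 2 [thin] + 2 outside + inner, and the inner terms sum to at
    -- most |ys|, as each vertex has one parent.
    many-thin : ∀ {q} → q ∈ ps → length (proj₂ q) ≤ 2 * ∑ (proj₂ q) (λ y → ⟦ thin (proj₂ q) y ⟧) + 2 * ∑ (proj₂ q) outside
    many-thin {q} q∈ = +-cancelʳ-≤ (length ys) _ _ (begin
      length ys + length ys ≡⟨ trans (cong₂ _+_ (sym (∑-1 ys)) (sym (∑-1 ys))) (sym (∑-+ ys (λ _ → 1) (λ _ → 1))) ⟩
      ∑ ys (λ _ → 2) ≤⟨ ∑-mono ys (λ y → pt (inner ys y) (outside y)) ⟩
      ∑ ys (λ y → 2 * ⟦ thin ys y ⟧ + 2 * outside y + inner ys y) ≡⟨ trans (∑-+ ys _ (inner ys)) (cong (_+ ∑ ys (inner ys)) (trans (∑-+ ys _ _) (cong₂ _+_ (∑-*ˡ ys 2 _) (∑-*ˡ ys 2 outside)))) ⟩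
      2 * ∑ ys (λ y → ⟦ thin ys y ⟧) + 2 * ∑ ys outside + ∑ ys (inner ys) ≤⟨ +-monoʳ-≤ _ inner-total ⟩
      2 * ∑ ys (λ y → ⟦ thin ys y ⟧) + 2 * ∑ ys outside + length ys ∎)
      where
      open ≤-Reasoning
      ys : List (Fin n)
      ys = proj₂ q
      pt : ∀ a b → 2 ≤ 2 * ⟦ (a ≤ᵇ 1) ∧ (b ≤ᵇ 0) ⟧ + 2 * b + a
      pt zero zero = dec≤
      pt (suc zero) zero = dec≤
      pt (suc (suc a)) b = ≤-trans (s≤s (s≤s z≤n)) (m≤n+m _ _)
      pt zero (suc b) = ≤-trans (*-monoʳ-≤ 2 (s≤s {0} {b} z≤n)) (m≤m+n _ 0)
      pt (suc zero) (suc b) = ≤-trans (*-monoʳ-≤ 2 (s≤s {0} {b} z≤n)) (m≤m+n _ 1)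
      inner-total : ∑ ys (inner ys) ≤ length ys
      inner-total = ≤-trans (≤-reflexive (∑-swap ys ys (λ y z → ⟦ y == par z ⟧))) (≤-trans (∑-mono ys (λ z → piece-mult q∈ (par z))) (≤-reflexive (∑-1 ys)))

    thin-absorber : ∀ {q y} → q ∈ ps → y ∈ proj₂ q → y ≢ t → thin (proj₂ q) y ≡ true → Absorber (proj₂ q) y
    thin-absorber {q} {y} q∈ y∈ y≢t th = record
      { inside = y∈
      ; only-child = only
      ; child-inside = child
      }
      where
      ys : List (Fin n)
      ys = proj₂ q
      child : ∀ z → par z ≡ y → z ∈ ys
      child z pz = by (located z (λ { refl → y≢t (trans (sym pz) par-t) }))
        where
        by : (∃ λ r → r ∈ ps × z ∈ proj₁ r ∷ proj₂ r) → z ∈ ys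
        by (r , r∈ , here refl) = ⊥-elim (<⇒≱ (≤-trans (≤-reflexive (cong ⟦_⟧ (sym (trans (cong (y ==_) pz) (==-refl y))))) (∑-≥ (λ r → ⟦ y == par (proj₁ r) ⟧) r∈))
          (≤ᵇ-≤ {outside y} (∧-r {inner ys y ≤ᵇ 1} th)))
        by (r , r∈ , there z∈) = subst (λ s → z ∈ proj₂ s) (same-piece r∈ q∈ y∈r (there y∈)) z∈
          where
          y∈r : y ∈ proj₁ r ∷ proj₂ r
          y∈r with build-par (proj₁ (good r r∈)) z∈
          ... | inj₁ (here eq) = here (trans (sym pz) eq)
          ... | inj₂ p∈ = there (subst (_∈ proj₂ r) pz p∈)
      only : ∀ z z′ → par z ≡ y → par z′ ≡ y → z ≡ z′
      only z z′ pz pz′ with two-members (λ w → ⟦ y == par w ⟧) (child z pz) (child z′ pz′)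
      ... | inj₁ eq = eq
      ... | inj₂ le = ⊥-elim (<⇒≱ (≤-trans (+-mono-≤ (one pz) (one pz′)) le) (≤ᵇ-≤ {inner ys y} (∧-l th)))
        where
        one : ∀ {w} → par w ≡ y → 1 ≤ ⟦ y == par w ⟧
        one {w} pw = ≤-reflexive (cong ⟦_⟧ (sym (trans (cong (y ==_) pw) (==-refl y))))

    -- One factor 2 comes from `many-thin`, the other from passing to the larger colour class of the
    -- thin vertices.
    choose : ∀ {q} → q ∈ ps → Σ (Choice q) λ ch → length (proj₂ q) ≤ 4 * length (chosen ch) + 2 * ∑ (proj₂ q) outside
    choose {q} q∈ = with-colour (majority (select (thin ys) ys) colour)
      where
      ys : List (Fin n)
      ys = proj₂ q
      ≢t : ∀ {y} → y ∈ ys → y ≢ t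
      ≢t {y} y∈ refl = <⇒≱ (+-mono-≤ (≤-reflexive (cong ⟦_⟧ (sym (==-refl t)))) (≤-trans (≤-trans (mult-∈ y∈) (m≤n+m (mult ys t) ⟦ proj₁ q == t ⟧)) (∑-≥ (λ r → ⟦ proj₁ r == t ⟧ + mult (proj₂ r) t) q∈)))
        (≤-reflexive (once t))
      with-colour : (∃ λ (f : Bool → Bool) → (∀ b → f (not b) ≡ not (f b)) ×
          ∑ (select (thin ys) ys) (λ x → ⟦ not (f (colour x)) ⟧) ≤ ∑ (select (thin ys) ys) (λ x → ⟦ f (colour x) ⟧)) →
        Σ (Choice q) λ ch → length ys ≤ 4 * length (chosen ch) + 2 * ∑ ys outside
      with-colour (f , f-not , f-maj) = record
        { orient = f
        ; orient-not = f-not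
        ; chosen = select P ys
        ; chosen-unique = mult-unique (select P ys) (λ x → ≤-trans (≤-trans (≤-reflexive (∑-select P ys (λ y → ⟦ y == x ⟧))) (∑-mono ys (λ y → ≤-trans (*-monoˡ-≤ ⟦ y == x ⟧ (⟦⟧≤1 (P y))) (≤-reflexive (*-identityˡ _))))) (piece-mult q∈ x))
        ; chosen-≤ = ≤-trans (≤-trans (≤-reflexive (length-select P ys)) (≤-trans (∑-mono ys (λ y → ⟦⟧≤1 (P y))) (≤-reflexive (∑-1 ys)))) (n≤1+n _)
        ; chosen-absorber = λ y y∈ → let y∈ys , Py = ∈-select P {ys} y∈ in thin-absorber q∈ y∈ys (≢t y∈ys) (∧-l Py)
        ; chosen-colour = λ y y∈ → ∧-r {thin ys y} (proj₂ (∈-select P {ys} y∈))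
        } , bound
        where
        P : Fin n → Bool
        P y = thin ys y ∧ f (colour y)
        thins : List (Fin n)
        thins = select (thin ys) ys
        count : ∑ thins (λ x → ⟦ f (colour x) ⟧) ≡ length (select P ys)
        count = trans (∑-select (thin ys) ys (λ x → ⟦ f (colour x) ⟧)) (trans (∑-cong ys (λ y → sym (⟦∧⟧ (thin ys y) (f (colour y))))) (sym (length-select P ys)))
        thins≤ : ∑ ys (λ y → ⟦ thin ys y ⟧) ≤ 2 * length (select P ys)
        thins≤ = begin
          ∑ ys (λ y → ⟦ thin ys y ⟧) ≡⟨ trans (sym (length-select (thin ys) ys)) (sym (∑-indicator-split thins (λ x → f (colour x)))) ⟩
          ∑ thins (λ x → ⟦ f (colour x) ⟧) + ∑ thins (λ x → ⟦ not (f (colour x)) ⟧) ≤⟨ +-monoʳ-≤ _ f-maj ⟩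
          ∑ thins (λ x → ⟦ f (colour x) ⟧) + ∑ thins (λ x → ⟦ f (colour x) ⟧) ≡⟨ cong₂ _+_ count (trans count (sym (+-identityʳ _))) ⟩
          2 * length (select P ys) ∎
          where open ≤-Reasoning
        bound : length ys ≤ 4 * length (select P ys) + 2 * ∑ ys outside
        bound = ≤-trans (many-thin q∈) (+-monoˡ-≤ _ (≤-trans (*-monoʳ-≤ 2 thins≤) (≤-reflexive (sym (*-assoc 2 2 (length (select P ys)))))))

    -- Each piece hangs from a single vertex, and that vertex lies in at most one piece.
    outside-total : ∑ ps (λ q → ∑ (proj₂ q) outside) ≤ length ps
    outside-total = begin
      ∑ ps (λ q → ∑ (proj₂ q) outside) ≡⟨ ∑-cong ps (λ q → ∑-swap (proj₂ q) ps (λ y r → ⟦ y == par (proj₁ r) ⟧)) ⟩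
      ∑ ps (λ q → ∑ ps (λ r → mult (proj₂ q) (par (proj₁ r)))) ≡⟨ ∑-swap ps ps (λ q r → mult (proj₂ q) (par (proj₁ r))) ⟩
      ∑ ps (λ r → ∑ ps (λ q → mult (proj₂ q) (par (proj₁ r)))) ≤⟨ ∑-mono ps (λ r → ≤-trans (∑-mono ps (λ q → m≤n+m _ ⟦ proj₁ q == par (proj₁ r) ⟧)) (mass≤1 (par (proj₁ r)))) ⟩
      ∑ ps (λ _ → 1) ≡⟨ ∑-1 ps ⟩
      length ps ∎
      where open ≤-Reasoning

    choices : ∀ P → (∀ q → q ∈ P → q ∈ ps) → Σ (Choices P) λ chs → total P ≤ length P + (4 * chosen-total chs + 2 * ∑ P (λ q → ∑ (proj₂ q) outside))
    choices [] sub = [] , z≤n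
    choices (q ∷ P) sub =
      let ch , le = choose (sub q (here refl))
          chs , le′ = choices P (λ r r∈ → sub r (there r∈))
      in ch ∷ chs , ≤-trans (+-mono-≤ (s≤s le) le′) (≤-reflexive (eq (length (chosen ch)) (∑ (proj₂ q) outside) (length P) (chosen-total chs) (∑ P (λ q → ∑ (proj₂ q) outside))))
      where
      eq : ∀ a b l c d → 1 + (4 * a + 2 * b) + (l + (4 * c + 2 * d)) ≡ 1 + l + (4 * (a + c) + 2 * (b + d))
      eq = solve-∀

  -- Running the three phases.

  split : ∀ S ps θ → (∀ q → q ∈ ps → size-of q ≤ S) → θ ≤ total ps →
    ∃ λ P → ∃ λ Q → ps ≡ P ++ Q × θ ≤ total P × total P ≤ θ + S
  split S ps zero _ _ = [] , ps , refl , z≤n , z≤n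
  split S [] (suc θ) _ ()
  split S (q ∷ ps) (suc θ) sizes le with suc θ ≤? size-of q
  ... | yes fits = q ∷ [] , ps , refl , ≤-trans fits (m≤m+n _ 0) ,
    ≤-trans (≤-reflexive (+-identityʳ (size-of q))) (≤-trans (sizes q (here refl)) (m≤n+m S (suc θ)))
  ... | no big with split S ps (suc θ ∸ size-of q) (λ r r∈ → sizes r (there r∈)) (m≤n+o⇒m∸n≤o (suc θ) (size-of q) le)
  ... | P , Q , eq , lo , hi = q ∷ P , Q , cong (q ∷_) eq ,
    ≤-trans (m≤n+m∸n (suc θ) (size-of q)) (+-monoʳ-≤ (size-of q) lo) ,
    ≤-trans (+-monoʳ-≤ (size-of q) hi) (≤-reflexive (trans (sym (+-assoc (size-of q) _ S)) (cong (_+ S) (m+[n∸m]≡n (<⇒≤ (≰⇒> big))))))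

  pieces-++ : ∀ P {Q D} → Pieces D (P ++ Q) → Pieces D P × Pieces (flat P D) Q
  pieces-++ [] pcs = [] , pcs
  pieces-++ (q ∷ P) (pc ∷ pcs) = let a , b = pieces-++ P pcs in pc ∷ a , b

  ∑-flat : ∀ P D f → ∑ (flat P D) f ≡ mass P f + ∑ D f
  ∑-flat [] D f = refl
  ∑-flat ((p , ys) ∷ P) D f = trans (∑-flat P ((p ∷ ys) ʳ++ D) f) (trans (cong (mass P f +_) (∑-ʳ++ (p ∷ ys) D f)) (+-left-assoc (mass P f) (∑ (p ∷ ys) f) (∑ D f)))

  length-flat : ∀ P D → length (flat P D) ≡ total P + length D
  length-flat P D = trans (sym (∑-1 (flat P D))) (trans (∑-flat P D (λ _ → 1)) (cong₂ _+_ (mass-1 P) (∑-1 D)))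

  flat-⊆ : ∀ P {D x} → x ∈ D → x ∈ flat P D
  flat-⊆ [] x∈ = x∈
  flat-⊆ ((p , ys) ∷ P) x∈ = flat-⊆ P (∈-ʳ++ʳ (p ∷ ys) x∈)

  pieces-build : ∀ {P D} → Pieces D P → Build D (verts P)
  pieces-build [] = []
  pieces-build (_∷_ {p} {ys} pc pcs) = attached pc ∷ build-++ ys (build-mono (λ { (here q) → here q }) (build pc)) (pieces-build pcs)

  fresh-++ : ∀ {D : List (Fin n)} xs {ys} → Fresh D xs → Fresh (xs ʳ++ D) ys → Fresh D (xs ++ ys)
  fresh-++ [] [] b = b
  fresh-++ (x ∷ xs) (x∉ ∷ a) b = x∉ ∷ fresh-++ xs a b

  pieces-fresh : ∀ {P D} → Pieces D P → Fresh D (verts P)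
  pieces-fresh [] = []
  pieces-fresh (_∷_ {p} {ys} pc pcs) = fresh-++ (p ∷ ys) (fresh pc) (pieces-fresh pcs)

  chosen-total-≤ : ∀ {P} (chs : Choices P) → chosen-total chs ≤ total P
  chosen-total-≤ [] = z≤n
  chosen-total-≤ (ch ∷ chs) = +-mono-≤ (chosen-≤ ch) (chosen-total-≤ chs)

  initial-state : Fin n → State (t ∷ [])
  initial-state v = record
    { φ = λ _ → v
    ; U = (λ _ → true) ⊖ v
    ; used = λ x _ → cong not (==-refl v)
    ; inj = λ { x y (here refl) (here refl) _ → refl }
    ; edge = λ { x (here refl) ne → ⊥-elim (ne refl) }
    ; closed = λ { x (here refl) → here par-t }
    ; root = here refl
    ; size = trans (+-comm (# ((λ _ → true) ⊖ v)) 1) (trans (sym (#-⊖ (λ _ → true) v refl)) (trans (∑-1 V) (length-allFin n)))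
    }

  record Embedded (v : Fin n) : Set where
    field
      ψ : Fin n → Fin n
      ψ-injective : ∀ x y → ψ x ≡ ψ y → x ≡ y
      ψ-edge : ∀ x → x ≢ t → e (ψ x) (ψ (par x)) ≡ true
      ψ-root : ψ t ≡ v

  -- The absorbers lie in the first θ vertices or so; the balanced phase stops when about m₀ vertices are left.
  record Constants (len : ℕ) : Set where
    field
      k κ J j₁ j₂ θ m₁ : ℕ
      1≤k : 1 ≤ k
      κ≡ : κ ≡ 512 * (k * (k * k))
      κ>0 : 0 < κ
      J≡ : J ≡ 2 * κ * 64
      2≤J : 2 ≤ J
      j₁≡ : suc j₁ ≡ 4 * J * j₂
      n²< : n * n < 2 ^ j₂
      θ>0 : 0 < θ
      m₁>0 : 0 < m₁
      sparse : ∀ v → 2 * k * far (λ _ → true) v + 2 * m₁ ≤ k * m₁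
      room₁ : 8 * k * suc s₁ ≤ m₁
      steps₁ : 4 * suc j₁ * suc s₁ ≤ 8 * θ
      fits₁ : m₁ + (θ + suc s₁) + 1 ≤ n
      S≤ : suc s₁ ≤ 3 * θ
      few : 6 * len ≤ θ
      c j j₀ c₂ ē m₀ X₀ : ℕ
      c₂≡ : c₂ + 2 ≡ 3 * k
      j≡ : suc j ≡ 6 * k * j₀
      n< : n < 2 ^ j₀
      n≤ : n ≤ ē * m₀
      big : 16 * suc c * k * k * suc s₁ < m₀
      small : suc c * suc j * (2 * suc s₁) ≤ m₀
      X₀-big : 6 * k * (suc c * n) ≤ 6 * k * X₀ + suc c * n
      budget : X₀ + ē * (suc c * len + 2 * n) ≤ suc c * n
      fits₂ : m₀ + suc s₁ + (θ + suc s₁) + 1 ≤ n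
      absorb : 2 * J * (m₀ + suc s₁) ≤ 8 * θ

  module _ (d : Decomposition) (C : Constants (length (Decomposition.pieces d))) (v : Fin n) where

    open Decomposition d
    open Constants C

    private
      S Z : ℕ
      S = suc s₁
      Z = 8 * θ

      sizes : ∀ q → q ∈ pieces → size-of q ≤ S
      sizes q q∈ = proj₂ (good q q∈)

      all-pieces : Pieces (t ∷ []) pieces
      all-pieces = to-pieces pieces (t ∷ []) (here refl) ordered good
        (λ x → ≤-reflexive (trans (cong₂ _+_ (+-identityʳ _) (∑-verts pieces (λ y → ⟦ y == x ⟧))) (once pieces sums good x)))

      total-n : suc (total pieces) ≡ n
      total-n = trans (cong suc (sym (mass-1 pieces))) (trans (sums (λ _ → 1)) (trans (∑-1 V) (length-allFin n)))

      is : List Pair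
      is = cartesianProduct V V

      ∈is : ∀ i → i ∈ is
      ∈is (a , b) = ∈-cartesianProduct⁺ (∈-allFin a) (∈-allFin b)

      length-is : length is ≡ n * n
      length-is = trans (length-product V) (cong₂ _*_ (length-allFin n) (length-allFin n))
        where
        length-product : ∀ (xs : List (Fin n)) → length (cartesianProduct xs V) ≡ length xs * length V
        length-product [] = refl
        length-product (x ∷ xs) = trans (length-++ (map (x ,_) V)) (cong₂ _+_ (length-map (x ,_) V) (length-product xs))

      open Rewards j₁ k κ Z S m₁ is (t , t) (∈is (t , t)) 1≤k κ≡ sparse room₁ m₁>0 steps₁ (*-mono-≤ {1} {8} (s≤s z≤n) θ>0) κ>0
      open Phase₂ c j k c₂ S ē j₀ m₀ X₀ 1≤k c₂≡ j≡ n< n≤ big small X₀-big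

      free-size : ∀ {D} (st : State D) l → length D + l ≡ n → # (U st) ≡ l
      free-size {D} st l eq = +-cancelʳ-≡ (length D) (# (U st)) l (trans (size st) (trans (sym eq) (+-comm (length D) l)))

      finish₃ : ∀ {D} (st : State D) Ys P₃ → Pieces D P₃ → Stage D Ys → total P₃ + length D ≡ n →
        (∀ f → mass P₃ f + ∑ D f ≡ f t + mass pieces f) → φ st t ≡ v → (∀ i → total P₃ ≤ score (φ st) Ys i) → Embedded v
      finish₃ {D} st Ys P₃ pcs sg len tot root-v scores = conclude
        (phase₃ (verts P₃) st Ys (pieces-build pcs) (pieces-fresh pcs) sg (trans (cong (_+ length D) verts-len) len)
          (λ i → ≤-trans (≤-reflexive verts-len) (scores i)))
        where
        verts-len : length (verts P₃) ≡ total P₃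
        verts-len = trans (sym (∑-1 (verts P₃))) (trans (∑-verts P₃ (λ _ → 1)) (mass-1 P₃))
        mult-1 : ∀ x → mult (verts P₃ ʳ++ D) x ≡ 1
        mult-1 x = trans (∑-ʳ++ (verts P₃) D δ) (trans (cong (_+ ∑ D δ) (∑-verts P₃ δ)) (trans (tot δ) (once pieces sums good x)))
          where
          δ : Fin n → ℕ
          δ y = ⟦ y == x ⟧
        conclude : (Σ (State (verts P₃ ʳ++ D)) λ st″ → φ st″ t ≡ φ st t) → Embedded v
        conclude (st₃ , eq) = record
          { ψ = φ st₃
          ; ψ-injective = λ x y → inj st₃ x y (cov x) (cov y)
          ; ψ-edge = λ x → edge st₃ x (cov x)
          ; ψ-root = trans eq root-v
          }
          where
          cov : ∀ x → x ∈ verts P₃ ʳ++ D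
          cov x with x ∈? (verts P₃ ʳ++ D)
          ... | yes x∈ = x∈
          ... | no x∉ = ⊥-elim (1+n≢0 (trans (sym (mult-1 x)) (mult-zero _ x x∉)))

      finish₂ : ∀ {D} (st : State D) Ys R → Pieces D R → (∀ q → q ∈ R → size-of q ≤ S) → length R ≤ length pieces → Stage D Ys → total R + length D ≡ n →
        (∀ f → mass R f + ∑ D f ≡ f t + mass pieces f) → φ st t ≡ v → m₁ ≤ # (U st) → m₀ + S ≤ total R → (∀ i → Z ≤ 2 * J * score (φ st) Ys i) → Embedded v
      finish₂ {D} st Ys R pcs sizesR lenR sg len tot root-v m₁≤ m₀S≤ scores = cutR (split S R (total R ∸ (m₀ + S)) sizesR (m∸n≤m (total R) (m₀ + S)))
        where
        open ≤-Reasoning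
        cutR : (∃ λ P → ∃ λ Q → R ≡ P ++ Q × total R ∸ (m₀ + S) ≤ total P × total P ≤ total R ∸ (m₀ + S) + S) → Embedded v
        cutR (P , Q , refl , lo , hi) = after (phase₂ P st (suc c * n) (proj₁ both) (λ q q∈ → sizesR q (∈-++⁺ˡ q∈)) balanced ≤-refl N>0 budget′ room′)
          where
          both : Pieces D P × Pieces (flat P D) Q
          both = pieces-++ P pcs
          tPQ : total R ≡ total P + total Q
          tPQ = ∑-++ P Q size-of
          Q-lo : m₀ ≤ total Q
          Q-lo = +-cancelˡ-≤ (total P) _ _ (begin
            total P + m₀ ≤⟨ +-monoˡ-≤ m₀ hi ⟩
            total R ∸ (m₀ + S) + S + m₀ ≡⟨ sw (total R ∸ (m₀ + S)) S m₀ ⟩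
            total R ∸ (m₀ + S) + (m₀ + S) ≡⟨ m∸n+n≡m m₀S≤ ⟩
            total R ≡⟨ tPQ ⟩
            total P + total Q ∎)
            where
            sw : ∀ a b c → a + b + c ≡ a + (c + b)
            sw = solve-∀
          Q-hi : total Q ≤ m₀ + S
          Q-hi = +-cancelˡ-≤ (total P) _ _ (begin
            total P + total Q ≡⟨ sym tPQ ⟩
            total R ≡⟨ sym (m∸n+n≡m m₀S≤) ⟩
            total R ∸ (m₀ + S) + (m₀ + S) ≤⟨ +-monoˡ-≤ (m₀ + S) lo ⟩
            total P + (m₀ + S) ∎)
          U≡ : # (U st) ≡ total R
          U≡ = free-size st (total R) (trans (+-comm (length D) (total R)) len)
          n>0 : 0 < n
          n>0 = ≤-trans (s≤s z≤n) (≤-reflexive total-n)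
          N>0 : 0 < suc c * n
          N>0 = *-mono-≤ {1} {suc c} (s≤s z≤n) n>0
          room′ : m₀ + total P ≤ # (U st)
          room′ = ≤-trans (+-monoˡ-≤ (total P) Q-lo) (≤-reflexive (trans (+-comm (total Q) (total P)) (trans (sym tPQ) (sym U≡))))
          -- `still-sparse` bounds each load by (3/2 - 1/k) # U, that is c₂ / (2k) times # U, so the
          -- budget starts in full.
          balanced : Balanced st (suc c * n)
          balanced = begin
            potential j (U st) * (2 * k * N) ^ suc j ≡⟨ sym (∑-*ʳ V ((2 * k * N) ^ suc j) _) ⟩
            ∑ V (λ w → load (U st) w ^ suc j * (2 * k * N) ^ suc j) ≤⟨ ∑-mono V (λ w → ≤-trans (≤-reflexive (sym (*-pow (load (U st) w) (2 * k * N) (suc j)))) (^-monoˡ-≤ (suc j) (load≤ w))) ⟩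
            ∑ V (λ _ → (c₂ * # (U st) * N) ^ suc j) ≡⟨ trans (∑-const V _) (cong (_* (c₂ * # (U st) * N) ^ suc j) (length-allFin n)) ⟩
            n * (c₂ * # (U st) * N) ^ suc j ∎
            where
            N : ℕ
            N = suc c * n
            load≤ : ∀ w → load (U st) w * (2 * k * N) ≤ c₂ * # (U st) * N
            load≤ w = ≤-trans (≤-reflexive (eq₁ (load (U st) w) (2 * k) N)) (*-monoˡ-≤ N (cert {2 * k * load (U st) w} {c₂ * # (U st)} 0 (+-mono-≤ (still-sparse (U st) m₁≤ w) (*-monoʳ-≤ (# (U st)) (≤-reflexive (sym c₂≡)))) (eq₂ k (# (U st)) (far (U st) w) c₂)))
              where
              eq₁ : ∀ a b c → a * (b * c) ≡ b * a * c
              eq₁ = solve-∀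
              eq₂ : ∀ k m f c → 2 * k * (m + f) + (k * m + m * (c + 2)) + 0 ≡ c * m + (2 * k * f + 2 * m + m * (3 * k))
              eq₂ = solve-∀
          charge≤ : charge P ≤ ē * (suc c * length pieces + 2 * n)
          charge≤ = begin
            charge P ≡⟨ trans (∑-*ˡ P ē _) (cong (ē *_) (trans (∑-+ P (λ _ → suc c) (λ q → 2 * size-of q)) (cong₂ _+_ (trans (∑-const P (suc c)) (*-comm (length P) (suc c))) (∑-*ˡ P 2 size-of)))) ⟩
            ē * (suc c * length P + 2 * total P) ≤⟨ *-monoʳ-≤ ē (+-mono-≤ (*-monoʳ-≤ (suc c) (≤-trans (≤-trans (m≤m+n (length P) (length Q)) (≤-reflexive (sym (length-++ P)))) lenR)) (*-monoʳ-≤ 2 total≤n)) ⟩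
            ē * (suc c * length pieces + 2 * n) ∎
            where
            total≤n : total P ≤ n
            total≤n = ≤-trans (≤-trans (m≤m+n (total P) (total Q)) (≤-reflexive (sym tPQ))) (≤-trans (m≤m+n (total R) (length D)) (≤-reflexive len))
          budget′ : X₀ + charge P ≤ suc c * n
          budget′ = ≤-trans (+-monoʳ-≤ X₀ charge≤) budget
          after : Σ (State (flat P D)) (Extends st) → Embedded v
          after (st₂ , ext) = finish₃ st₂ Ys Q (proj₂ both) sg₂
            (trans (cong (total Q +_) (length-flat P D)) (trans (+-left-assoc (total Q) (total P) (length D)) (trans (cong (_+ length D) (sym tPQ)) len)))
            (λ f → trans (cong (mass Q f +_) (∑-flat P D f)) (trans (+-left-assoc (mass Q f) (mass P f) (∑ D f)) (trans (cong (_+ ∑ D f) (sym (∑-++ P Q _))) (tot f))))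
            (trans (ext t (root st)) root-v)
            (λ i → *-cancelˡ-≤ (2 * J) {{>-nonZero (≤-trans (s≤s z≤n) (*-monoʳ-≤ 2 2≤J))}} (begin
              2 * J * total Q ≤⟨ *-monoʳ-≤ (2 * J) Q-hi ⟩
              2 * J * (m₀ + S) ≤⟨ absorb ⟩
              Z ≤⟨ scores i ⟩
              2 * J * score (φ st) Ys i ≡⟨ cong (2 * J *_) (sym (same i)) ⟩
              2 * J * score (φ st₂) Ys i ∎))
            where
            -- The balanced phase touches neither settled absorbers nor their neighbours.
            same : ∀ i → score (φ st₂) Ys i ≡ score (φ st) Ys i
            same i = ∑-cong∈ Ys (λ y y∈ → cong ⟦_⟧ (absorbs-cong (φ st) (φ st₂) y (ext y (proj₁ (Stage.settled sg y y∈))) (λ z q → ext z (proj₂ (Stage.settled sg y y∈) z q)) i))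
            sg₂ : Stage (flat P D) Ys
            sg₂ = record
              { unique = Stage.unique sg
              ; settled = λ y y∈ → let a , b = Stage.settled sg y y∈ in flat-⊆ P a , λ z q → flat-⊆ P (b z q)
              ; independent = Stage.independent sg
              ; avoids-root = Stage.avoids-root sg
              }

    embed : Embedded v
    embed = cutP (split S pieces θ sizes (≤-trans (≤-trans (m≤m+n θ S) (m≤n+m (θ + S) m₁)) (≤-pred (≤-trans (≤-reflexive (+-comm 1 _)) (≤-trans fits₁ (≤-reflexive (sym total-n)))))))
      where
      open ≤-Reasoning
      cutP : (∃ λ P → ∃ λ Q → pieces ≡ P ++ Q × θ ≤ total P × total P ≤ θ + S) → Embedded v
      cutP (P , R , eqPR , lo , hi) = run (choices pieces sums good P inP)
        where
        inP : ∀ q → q ∈ P → q ∈ pieces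
        inP q q∈ = subst (q ∈_) (sym eqPR) (∈-++⁺ˡ q∈)
        inR : ∀ q → q ∈ R → q ∈ pieces
        inR q q∈ = subst (q ∈_) (sym eqPR) (∈-++⁺ʳ P q∈)
        both : Pieces (t ∷ []) P × Pieces (flat P (t ∷ [])) R
        both = pieces-++ P (subst (Pieces (t ∷ [])) eqPR all-pieces)
        len : length pieces ≡ length P + length R
        len = trans (cong length eqPR) (length-++ P)
        ∑PR : ∀ (g : Fin n × List (Fin n) → ℕ) → ∑ pieces g ≡ ∑ P g + ∑ R g
        ∑PR g = trans (cong (λ z → ∑ z g) eqPR) (∑-++ P R g)
        n≡ : n ≡ suc (total P + total R)
        n≡ = trans (sym total-n) (cong suc (∑PR size-of))
        st₀ : State (t ∷ [])
        st₀ = initial-state v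
        U₀≡ : # (U st₀) ≡ total P + total R
        U₀≡ = free-size st₀ (total P + total R) (sym n≡)
        m₁≤R : m₁ ≤ total R
        m₁≤R = +-cancelʳ-≤ (suc (total P)) _ _ (begin
          m₁ + suc (total P) ≤⟨ +-monoʳ-≤ m₁ (s≤s hi) ⟩
          m₁ + suc (θ + S) ≡⟨ sw₁ m₁ (θ + S) ⟩
          m₁ + (θ + S) + 1 ≤⟨ fits₁ ⟩
          n ≡⟨ trans n≡ (sw₂ (total P) (total R)) ⟩
          total R + suc (total P) ∎)
          where
          sw₁ : ∀ a b → a + (1 + b) ≡ a + b + 1
          sw₁ = solve-∀
          sw₂ : ∀ a b → 1 + (a + b) ≡ b + (1 + a)
          sw₂ = solve-∀
        m₀≤R : m₀ + S ≤ total R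
        m₀≤R = +-cancelʳ-≤ (suc (total P)) _ _ (begin
          m₀ + S + suc (total P) ≤⟨ +-monoʳ-≤ (m₀ + S) (s≤s hi) ⟩
          m₀ + S + suc (θ + S) ≡⟨ sw₁ (m₀ + S) (θ + S) ⟩
          m₀ + S + (θ + S) + 1 ≤⟨ fits₂ ⟩
          n ≡⟨ trans n≡ (sw₂ (total P) (total R)) ⟩
          total R + suc (total P) ∎)
          where
          sw₁ : ∀ a b → a + (1 + b) ≡ a + b + 1
          sw₁ = solve-∀
          sw₂ : ∀ a b → 1 + (a + b) ≡ b + (1 + a)
          sw₂ = solve-∀
        run : (Σ (Choices P) λ chs → total P ≤ length P + (4 * chosen-total chs + 2 * ∑ P (λ q → ∑ (proj₂ q) (outside pieces sums good)))) → Embedded v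
        run (chs , bound) = after (phase₁ P st₀ [] (proj₁ both) chs (λ q q∈ → sizes q (inP q q∈)) stage₀ rewarded₀
            (≤-trans (+-monoˡ-≤ (total P) m₁≤R) (≤-reflexive (trans (+-comm (total R) (total P)) (sym U₀≡))))
            (≤-trans (*-monoʳ-≤ 2 (≤-trans (chosen-total-≤ chs) hi)) (cert 0 (*-monoʳ-≤ 2 S≤) (eq₀ θ S))))
          where
          eq₀ : ∀ θ S → 2 * (θ + S) + 2 * (3 * θ) + 0 ≡ 8 * θ + 2 * S
          eq₀ = solve-∀
          stage₀ : Stage (t ∷ []) []
          stage₀ = record { unique = [] ; settled = λ _ () ; independent = λ _ _ () ; avoids-root = λ () }
          rewarded₀ : Rewarded (φ st₀) []
          rewarded₀ = ≤-reflexive (trans (cong₂ (λ a b → a * b ^ suc j₁) (∑-const is (Z ^ suc j₁)) (+-identityʳ X))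
            (trans (*-assoc (length is) _ _) (cong (length is *_) (sym (*-pow Z X (suc j₁))))))
          outside≤ : ∑ P (λ q → ∑ (proj₂ q) (outside pieces sums good)) ≤ length pieces
          outside≤ = ≤-trans (≤-trans (m≤m+n _ (∑ R (λ q → ∑ (proj₂ q) (outside pieces sums good)))) (≤-reflexive (sym (∑PR _)))) (outside-total pieces sums good)
          -- P has at least θ vertices, and the losses sum to at most 3 `length pieces` ≤ θ / 2, so
          -- 4 `chosen-total chs` ≥ θ / 2.
          enough-chosen : Z ≤ 64 * chosen-total chs
          enough-chosen = cert 0 (+-mono-≤ (*-monoʳ-≤ 16 (≤-trans lo bound)) (+-mono-≤ (*-monoʳ-≤ 16 (≤-trans (m≤m+n (length P) (length R)) (≤-reflexive (sym len)))) (+-mono-≤ (*-monoʳ-≤ 32 outside≤) (*-monoʳ-≤ 8 few))))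
            (eq₁ θ (length P) (chosen-total chs) (∑ P (λ q → ∑ (proj₂ q) (outside pieces sums good))) (length pieces))
            where
            eq₁ : ∀ θ l c o L → 8 * θ + (16 * (l + (4 * c + 2 * o)) + (16 * L + (32 * L + 8 * θ))) + 0 ≡ 64 * c + (16 * θ + (16 * l + (32 * o + 8 * (6 * L))))
            eq₁ = solve-∀
          after : Prepared st₀ chs 0 → Embedded v
          after pr = finish₂ (Prepared.final pr) (Prepared.absorbers pr) R (proj₂ both) (λ q q∈ → sizes q (inR q q∈))
            (≤-trans (m≤n+m (length R) (length P)) (≤-reflexive (sym len))) (Prepared.stage pr)
            lenR
            (λ f → trans (cong (mass R f +_) (∑-flat P (t ∷ []) f)) (trans (sw₃ (mass R f) (mass P f) (f t)) (cong (f t +_) (sym (∑PR _)))))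
            (Prepared.extends pr t (here refl))
            (≤-trans m₁≤R (≤-reflexive (sym (free-size (Prepared.final pr) (total R) (trans (+-comm _ (total R)) lenR))))) m₀≤R
            (λ i → reward-enough (φ (Prepared.final pr)) (Prepared.absorbers pr) 64 J j₂ J≡ j₁≡ (subst (_< 2 ^ j₂) (sym length-is) n²<) 2≤J
              (≤-trans enough-chosen (≤-reflexive (cong (64 *_) (sym (Prepared.count pr))))) (Prepared.rewarded pr) i (∈is i))
            where
            sw₃ : ∀ a b c → a + (b + (c + 0)) ≡ c + (b + a)
            sw₃ = solve-∀
            lenR : total R + length (flat P (t ∷ [])) ≡ n
            lenR = trans (cong (total R +_) (length-flat P (t ∷ []))) (trans (sw₄ (total R) (total P)) (sym n≡))
              where
              sw₄ : ∀ a b → a + (b + 1) ≡ 1 + (b + a)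
              sw₄ = solve-∀

  -- Choice of the constants.

  -- ē = 4 J k brings the leftover, about n / ē vertices, below the final scores 8 θ / (2J) with θ
  -- about n/(2k). From s₁ = h Δ there are at most 2 n / h pieces, so the total charge is at most 4
  -- ē n, which h = 24 k ē makes a proportion 1/(6k) of the budget h n. One lower bound on n, linear
  -- in (ℓ + 1) (s₁ + 1), covers all remaining size conditions.
  constants : ∀ k κ J ē c ℓ len → 1 ≤ k → κ ≡ 512 * (k * (k * k)) → J ≡ 2 * κ * 64 → ē ≡ 4 * J * k → suc c ≡ 24 * k * ē →
    s₁ ≡ suc c * Δ → 1 ≤ Δ → n < 2 ^ suc ℓ → 16 * suc c * k * k * ē * J * (suc ℓ * suc s₁) ≤ n →
    (∀ v → 2 * k * far (λ _ → true) v + 4 * n ≤ k * n) → len * s₁ ≤ Δ * (s₁ + n) → Constants len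
  constants k κ J ē c ℓ len 1≤k κ≡ J≡ ē≡ h≡ s₁≡ 1≤Δ n< AQ≤ far≤ count =
    assemble (divide n (2 * k) (*-mono-≤ {1} {2} (s≤s z≤n) 1≤k)) (divide n ē 1≤ē)
    where
    h S j₀ : ℕ
    h = suc c
    S = suc s₁
    j₀ = suc ℓ
    1≤κ : 1 ≤ κ
    1≤κ = ≤-trans (*-mono-≤ {1} {512} (s≤s z≤n) (*-mono-≤ 1≤k (*-mono-≤ 1≤k 1≤k))) (≤-reflexive (sym κ≡))
    128≤J : 128 ≤ J
    128≤J = ≤-trans (cert 0 (*-monoʳ-≤ 128 1≤κ) (eq κ)) (≤-reflexive (sym J≡))
      where
      eq : ∀ κ → 128 + 128 * κ + 0 ≡ 2 * κ * 64 + 128 * 1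
      eq = solve-∀
    1≤J : 1 ≤ J
    1≤J = ≤-trans (s≤s z≤n) 128≤J
    8≤ē : 8 ≤ ē
    8≤ē = ≤-trans (*-mono-≤ {8} {4 * J} (≤-trans dec≤ (*-monoʳ-≤ 4 128≤J)) 1≤k) (≤-reflexive (sym ē≡))
    1≤ē : 1 ≤ ē
    1≤ē = ≤-trans (s≤s z≤n) 8≤ē
    b₁ : ē * (16 * h * k * k * S) ≤ n
    b₁ = ≤-trans (≤-trans (≤-reflexive (eq₁ ē h k S)) (*-monoʳ-≤ (16 * h * k * k * ē) (*-mono-≤ 1≤J (*-monoˡ-≤ S (s≤s {0} {ℓ} z≤n))))) (≤-trans (≤-reflexive (eq₂ (16 * h * k * k * ē) J (j₀ * S))) AQ≤)
      where
      eq₁ : ∀ ē h k S → ē * (16 * h * k * k * S) ≡ 16 * h * k * k * ē * (1 * (1 * S))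
      eq₁ = solve-∀
      eq₂ : ∀ a J q → a * (J * q) ≡ a * J * q
      eq₂ = solve-∀
    b₂ : ē * (h * (6 * k * j₀) * (2 * S)) ≤ n
    b₂ = ≤-trans (≤-trans (≤-reflexive (eq₁ ē h k j₀ S)) (≤-trans (*-monoˡ-≤ (h * k * ē * (j₀ * S)) {12} {16 * (1 * 1)} dec≤) (*-monoˡ-≤ (h * k * ē * (j₀ * S)) (*-monoʳ-≤ 16 (*-mono-≤ 1≤k 1≤J))))) (≤-trans (≤-reflexive (eq₂ ē h k J j₀ S)) AQ≤)
      where
      eq₁ : ∀ ē h k j S → ē * (h * (6 * k * j) * (2 * S)) ≡ 12 * (h * k * ē * (j * S))
      eq₁ = solve-∀
      eq₂ : ∀ ē h k J j S → 16 * (k * J) * (h * k * ē * (j * S)) ≡ 16 * h * k * k * ē * J * (j * S)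
      eq₂ = solve-∀
    b₃ : 16 * J * k * (j₀ * S) ≤ n
    b₃ = ≤-trans (≤-trans (≤-reflexive (eq₁ J k (j₀ * S))) (*-monoʳ-≤ (16 * J * k * (j₀ * S)) (*-mono-≤ {1} {h} (s≤s z≤n) (*-mono-≤ 1≤k 1≤ē)))) (≤-trans (≤-reflexive (eq₂ J k (j₀ * S) h ē)) AQ≤)
      where
      eq₁ : ∀ J k q → 16 * J * k * q ≡ 16 * J * k * q * (1 * (1 * 1))
      eq₁ = solve-∀
      eq₂ : ∀ J k q h ē → 16 * J * k * q * (h * (k * ē)) ≡ 16 * h * k * k * ē * J * q
      eq₂ = solve-∀
    b₄ : 16 * J * k * S ≤ n
    b₄ = ≤-trans (*-monoʳ-≤ (16 * J * k) (≤-trans (≤-reflexive (sym (*-identityˡ S))) (*-monoˡ-≤ S (s≤s {0} {ℓ} z≤n)))) b₃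
    b₅ : 64 * (k * S) ≤ n
    b₅ = ≤-trans (≤-trans (*-monoˡ-≤ (k * S) {64} {16 * J} (≤-trans dec≤ (*-monoʳ-≤ 16 128≤J))) (≤-reflexive (sym (*-assoc (16 * J) k S)))) b₄
    S≤kS : S ≤ k * S
    S≤kS = ≤-trans (≤-reflexive (sym (*-identityˡ S))) (*-monoˡ-≤ S 1≤k)
    k≤kS : k ≤ k * S
    k≤kS = m≤m*n k S
    1≤kS : 1 ≤ k * S
    1≤kS = ≤-trans (s≤s z≤n) S≤kS
    len≤ : len * h ≤ 2 * n
    len≤ = *-cancelʳ-≤ (len * h) (2 * n) Δ {{>-nonZero 1≤Δ}} (begin
      len * h * Δ ≡⟨ trans (*-assoc len h Δ) (cong (len *_) (sym s₁≡)) ⟩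
      len * s₁ ≤⟨ count ⟩
      Δ * (s₁ + n) ≤⟨ *-monoʳ-≤ Δ (+-monoˡ-≤ n s₁≤n) ⟩
      Δ * (n + n) ≡⟨ eq Δ n ⟩
      2 * n * Δ ∎)
      where
      open ≤-Reasoning
      s₁≤n : s₁ ≤ n
      s₁≤n = ≤-trans (n≤1+n s₁) (≤-trans S≤kS (≤-trans (m≤m+n (k * S) _) b₅))
      eq : ∀ Δ n → Δ * (n + n) ≡ 2 * n * Δ
      eq = solve-∀
    len≤′ : 12 * k * ē * len ≤ n
    len≤′ = *-cancelˡ-≤ 2 (≤-trans (≤-reflexive (trans (eq k ē len) (cong (len *_) (sym h≡)))) len≤)
      where
      eq : ∀ k ē l → 2 * (12 * k * ē * l) ≡ l * (24 * k * ē)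
      eq = solve-∀
    assemble : (∃ λ q → 2 * k * q ≤ n × n < 2 * k * suc q) → (∃ λ q → ē * q ≤ n × n < ē * suc q) → Constants len
    assemble (θ , θ≤ , <θ) (q , q≤ , <q) = record
      { k = k ; κ = κ ; J = J ; j₁ = pred (4 * J * j₂) ; j₂ = j₂ ; θ = θ ; m₁ = m₁
      ; 1≤k = 1≤k
      ; κ≡ = κ≡
      ; κ>0 = 1≤κ
      ; J≡ = J≡
      ; 2≤J = ≤-trans (s≤s (s≤s z≤n)) 128≤J
      ; j₁≡ = j₁≡
      ; n²< = <-≤-trans (*-mono-< n< n<) (≤-reflexive (sym (^-distribˡ-+-* 2 j₀ j₀)))
      ; θ>0 = θ>0
      ; m₁>0 = ≤-trans (≤-trans 1≤kS (m≤n*m (k * S) 8)) (≤-trans (≤-reflexive (sym (*-assoc 8 k S))) room₁)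
      ; sparse = sparse
      ; room₁ = room₁
      ; steps₁ = steps₁
      ; fits₁ = ≤-reflexive (trans (+-assoc m₁ (θ + S) 1) m₁+)
      ; S≤ = ≤-trans S≤θ (m≤m+n θ _)
      ; few = *-cancelˡ-≤ (4 * k) {{>-nonZero (*-mono-≤ {1} {4} (s≤s z≤n) 1≤k)}} (≤-trans few n≤4kθ)
      -- `m₀` is n / ē rounded up past the quotient, for n ≤ ē m₀; `X₀` is what the largest possible
      -- charge W leaves of the budget.
      ; c = c ; j = pred (6 * k * j₀) ; j₀ = j₀ ; c₂ = 3 * k ∸ 2 ; ē = ē ; m₀ = suc q ; X₀ = h * n ∸ W
      ; c₂≡ = m∸n+n≡m (≤-trans (s≤s (s≤s z≤n)) (*-monoʳ-≤ 3 1≤k))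
      ; j≡ = j≡
      ; n< = n<
      ; n≤ = <⇒≤ <q
      ; big = *-cancelˡ-< ē _ _ (≤-<-trans b₁ <q)
      ; small = *-cancelˡ-≤ ē {{>-nonZero 1≤ē}} (≤-trans (≤-reflexive (cong (λ z → ē * (h * z * (2 * S))) j≡)) (≤-trans b₂ (<⇒≤ <q)))
      ; X₀-big = X₀-big
      ; budget = ≤-reflexive (m∸n+n≡m W≤)
      ; fits₂ = fits₂
      ; absorb = absorb
      }
      where
      j₂ w m₁ W : ℕ
      -- Twice the logarithm, since the deficits run over n² pairs.
      j₂ = j₀ + j₀
      -- The absorber phase uses at most θ + S vertices besides the root.
      w = (θ + S) + 1
      m₁ = n ∸ w
      W = ē * (h * len + 2 * n)
      nz≥ : ∀ a b → 1 ≤ a → 1 ≤ b → 1 ≤ a * b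
      nz≥ a b p q = *-mono-≤ {1} {a} p q
      j₁≡ : suc (pred (4 * J * j₂)) ≡ 4 * J * j₂
      j₁≡ = suc-pred (4 * J * j₂) {{>-nonZero (nz≥ (4 * J) j₂ (nz≥ 4 J (s≤s z≤n) 1≤J) (s≤s z≤n))}}
      j≡ : suc (pred (6 * k * j₀)) ≡ 6 * k * j₀
      j≡ = suc-pred (6 * k * j₀) {{>-nonZero (nz≥ (6 * k) j₀ (nz≥ 6 k (s≤s z≤n) 1≤k) (s≤s z≤n))}}
      θ>0 : 0 < θ
      θ>0 = n≢0⇒n>0 λ { refl → <⇒≱ <θ (≤-trans (≤-reflexive (*-identityʳ (2 * k))) (≤-trans (*-mono-≤ {2} {64} (s≤s (s≤s z≤n)) k≤kS) b₅)) }
      n≤4kθ : n ≤ 4 * k * θ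
      n≤4kθ = ≤-trans (<⇒≤ <θ) (cert 0 (*-monoʳ-≤ (2 * k) θ>0) (eq k θ))
        where
        eq : ∀ k θ → 2 * k * (1 + θ) + 2 * k * θ + 0 ≡ 4 * k * θ + 2 * k * 1
        eq = solve-∀
      θ≤n : 2 * θ ≤ n
      θ≤n = ≤-trans (*-monoˡ-≤ θ (*-monoʳ-≤ 2 1≤k)) θ≤
      all : θ + S + 1 + 8 * k * S ≤ n
      all = *-cancelˡ-≤ 2 (cert (44 * (k * S)) (+-mono-≤ θ≤n (+-mono-≤ b₅ (+-mono-≤ (*-monoʳ-≤ 2 S≤kS) (*-monoʳ-≤ 2 1≤kS)))) (eq θ S k n))
        where
        eq : ∀ θ S k n → 2 * (θ + S + 1 + 8 * k * S) + (n + (n + (2 * (k * S) + 2 * (k * S)))) + 44 * (k * S) ≡ 2 * n + (2 * θ + (64 * (k * S) + (2 * S + 2 * 1)))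
        eq = solve-∀
      m₁+ : m₁ + w ≡ n
      m₁+ = m∸n+n≡m (≤-trans (m≤m+n w (8 * k * S)) all)
      room₁ : 8 * k * S ≤ m₁
      room₁ = +-cancelʳ-≤ w _ _ (≤-trans (≤-reflexive (+-comm (8 * k * S) w)) (≤-trans all (≤-reflexive (sym m₁+))))
      kw : k * w ≤ 2 * n
      kw = *-cancelˡ-≤ 2 (cert (60 * (k * S) + 2 * n) (+-mono-≤ θ≤ (+-mono-≤ b₅ (*-monoʳ-≤ 2 k≤kS))) (eq θ S k n))
        where
        eq : ∀ θ S k n → 2 * (k * ((θ + S) + 1)) + (n + (n + 2 * (k * S))) + (60 * (k * S) + 2 * n) ≡ 2 * (2 * n) + (2 * k * θ + (64 * (k * S) + 2 * k))
        eq = solve-∀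
      -- Losing w ≤ 2 n / k vertices costs half of the surplus 2/k.
      sparse : ∀ v → 2 * k * far (λ _ → true) v + 2 * m₁ ≤ k * m₁
      sparse v = cert (2 * w) (+-mono-≤ (subst (λ z → 2 * k * far (λ _ → true) v + 4 * z ≤ k * z) (sym m₁+) (far≤ v)) (subst (λ z → k * w ≤ 2 * z) (sym m₁+) kw))
        (eq (2 * k * far (λ _ → true) v) k m₁ w)
        where
        eq : ∀ F k m w → F + 2 * m + (k * (m + w) + 2 * (m + w)) + 2 * w ≡ k * m + (F + 4 * (m + w) + k * w)
        eq = solve-∀
      S≤θ : S ≤ θ
      S≤θ = *-cancelˡ-≤ (4 * k) {{>-nonZero (nz≥ 4 k (s≤s z≤n) 1≤k)}} (≤-trans (≤-trans (≤-reflexive (*-assoc 4 k S)) (*-monoˡ-≤ (k * S) {4} {64} dec≤)) (≤-trans b₅ n≤4kθ))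
      steps₁ : 4 * suc (pred (4 * J * j₂)) * S ≤ 8 * θ
      steps₁ = *-cancelˡ-≤ k {{>-nonZero 1≤k}} (≤-trans (≤-reflexive (trans (cong (λ z → k * (4 * z * S)) j₁≡) (eq₁ k J j₀ S))) (≤-trans (*-monoʳ-≤ 2 (≤-trans b₃ n≤4kθ)) (≤-reflexive (eq₂ k θ))))
        where
        eq₁ : ∀ k J j S → k * (4 * (4 * J * (j + j)) * S) ≡ 2 * (16 * J * k * (j * S))
        eq₁ = solve-∀
        eq₂ : ∀ k θ → 2 * (4 * k * θ) ≡ k * (8 * θ)
        eq₂ = solve-∀
      few : 4 * k * (6 * len) ≤ n
      few = ≤-trans (≤-trans (≤-reflexive (eq k len)) (*-monoˡ-≤ (k * len) {24} {12 * ē} (≤-trans dec≤ (*-monoʳ-≤ 12 8≤ē)))) (≤-trans (≤-reflexive (eq′ k ē len)) len≤′)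
        where
        eq : ∀ k l → 4 * k * (6 * l) ≡ 24 * (k * l)
        eq = solve-∀
        eq′ : ∀ k ē l → 12 * ē * (k * l) ≡ 12 * k * ē * l
        eq′ = solve-∀
      6kW : 6 * k * W ≤ h * n
      6kW = *-cancelˡ-≤ 2 (cert 0 (+-mono-≤ (*-monoʳ-≤ h len≤′) (*-monoʳ-≤ n (≤-reflexive (sym h≡)))) (eq k ē h len n))
        where
        eq : ∀ k ē h l n → 2 * (6 * k * (ē * (h * l + 2 * n))) + (h * n + n * h) + 0 ≡ 2 * (h * n) + (h * (12 * k * ē * l) + n * (24 * k * ē))
        eq = solve-∀
      W≤ : W ≤ h * n
      W≤ = ≤-trans (m≤n*m W (6 * k) {{>-nonZero (nz≥ 6 k (s≤s z≤n) 1≤k)}}) 6kW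
      X₀-big : 6 * k * (h * n) ≤ 6 * k * (h * n ∸ W) + h * n
      X₀-big = ≤-trans (≤-reflexive (trans (cong (6 * k *_) (sym (m∸n+n≡m W≤))) (*-distribˡ-+ (6 * k) (h * n ∸ W) W))) (+-monoʳ-≤ (6 * k * (h * n ∸ W)) 6kW)
      ēm₀ : ē * suc q ≤ 2 * n
      ēm₀ = ≤-trans (≤-reflexive (*-suc ē q)) (≤-trans (+-mono-≤ ē≤n q≤) (≤-reflexive (cong (n +_) (sym (+-identityʳ n)))))
        where
        ē≤n : ē ≤ n
        ē≤n = ≤-trans (m≤m*n ē (16 * h * k * k * S) {{>-nonZero (nz≥ (16 * h * k * k) S (nz≥ (16 * h * k) k (nz≥ (16 * h) k (nz≥ 16 h (s≤s z≤n) (s≤s z≤n)) 1≤k) 1≤k) (s≤s z≤n))}}) b₁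
      fits₂ : suc q + S + (θ + S) + 1 ≤ n
      fits₂ = *-cancelˡ-≤ 4 (cert (52 * (k * S)) (+-mono-≤ m₀≤ (+-mono-≤ (*-monoʳ-≤ 2 θ≤n) (+-mono-≤ b₅ (+-mono-≤ (*-monoʳ-≤ 8 S≤kS) (*-monoʳ-≤ 4 1≤kS))))) (eq (suc q) S θ k n))
        where
        m₀≤ : 4 * suc q ≤ n
        m₀≤ = *-cancelˡ-≤ 2 (≤-trans (≤-reflexive (sym (*-assoc 2 4 (suc q)))) (≤-trans (*-monoˡ-≤ (suc q) 8≤ē) ēm₀))
        eq : ∀ m S θ k n → 4 * (m + S + (θ + S) + 1) + (n + (2 * n + (n + (8 * (k * S) + 4 * (k * S))))) + 52 * (k * S)
          ≡ 4 * n + (4 * m + (2 * (2 * θ) + (64 * (k * S) + (8 * S + 4 * 1))))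
        eq = solve-∀
      absorb : 2 * J * (suc q + S) ≤ 8 * θ
      absorb = *-cancelˡ-≤ (2 * k) {{>-nonZero (nz≥ 2 k (s≤s z≤n) 1≤k)}} (cert (12 * J * k * S + n)
        (+-mono-≤ (≤-trans (≤-reflexive (cong (_* suc q) (sym ē≡))) ēm₀) (+-mono-≤ b₄ (*-monoʳ-≤ 4 n≤4kθ))) (eq k J (suc q) S θ n))
        where
        eq : ∀ k J m S θ n → 2 * k * (2 * J * (m + S)) + (2 * n + (n + 4 * (4 * k * θ))) + (12 * J * k * S + n)
          ≡ 2 * k * (8 * θ) + (4 * J * k * m + (16 * J * k * S + 4 * n))
        eq = solve-∀

-- Logarithms, the rational hypotheses and the theorem.

log₂-bounds : ∀ n → 1 ≤ n → ∃ λ ℓ → 2 ^ ℓ ≤ n × n < 2 ^ suc ℓ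
log₂-bounds (suc zero) _ = 0 , dec≤ , dec≤
log₂-bounds (suc (suc n)) _ with log₂-bounds (suc n) (s≤s z≤n)
... | ℓ , lo , hi with suc (suc n) <? 2 ^ suc ℓ
... | yes lt = ℓ , ≤-trans lo (n≤1+n _) , lt
... | no ge = suc ℓ , ≮⇒≥ ge , ≤-<-trans hi (^-monoʳ-< 2 (s≤s (s≤s z≤n)) (n<1+n (suc ℓ)))

pow-cancel : ∀ a b → 2 ^ a ≤ 2 ^ b → a ≤ b
pow-cancel a b le = ≮⇒≥ λ lt → <⇒≱ (^-monoʳ-< 2 (s≤s (s≤s z≤n)) lt) le

degree-# : ∀ {n} (G : Graph n) v → degree G v ≡ # (adj G v)
degree-# {n} G v = trans (sum-map (λ u → if adj G v u then 1 else 0) (allFin n)) (∑-cong (allFin n) (λ u → pt (adj G v u)))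
  where
  sum-map : ∀ {A : Set} (f : A → ℕ) xs → Data.Nat.ListAction.sum (map f xs) ≡ ∑ xs f
  sum-map f [] = refl
  sum-map f (x ∷ xs) = cong (f x +_) (sum-map f xs)
  pt : ∀ b → (if b then 1 else 0) ≡ ⟦ b ⟧
  pt true = refl
  pt false = refl

min-degree-ℕ : ∀ p d .(cop : Coprime p (suc d)) n δ → (½ ℚ.+ mkℚ (ℤ.+ p) d cop) ℚ.* (ℤ.+ n ℚ./ 1) ℚ.≤ ℤ.+ δ ℚ./ 1 →
  (suc d + p * 2) * n ≤ δ * (2 * suc d)
min-degree-ℕ p d cop n δ le = ℤ.drop‿+≤+ (subst₂ ℤ._≤_ left right (ℚᵘP.drop-*≤* ineq))
  where
  α : ℚ
  α = mkℚ (ℤ.+ p) d cop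
  ineq : (mkℚᵘ (ℤ.+ 1) 1 ℚᵘ.+ mkℚᵘ (ℤ.+ p) d) ℚᵘ.* mkℚᵘ (ℤ.+ n) 0 ℚᵘ.≤ mkℚᵘ (ℤ.+ δ) 0
  ineq = ℚᵘP.≤-respˡ-≃ (ℚᵘP.≃-trans (ℚP.toℚᵘ-homo-* (½ ℚ.+ α) (ℤ.+ n ℚ./ 1)) (ℚᵘP.*-cong (ℚP.toℚᵘ-homo-+ ½ α) (ℚP.toℚᵘ-fromℚᵘ (mkℚᵘ (ℤ.+ n) 0))))
    (ℚᵘP.≤-respʳ-≃ (ℚP.toℚᵘ-fromℚᵘ (mkℚᵘ (ℤ.+ δ) 0)) (ℚP.toℚᵘ-mono-≤ le))
  left : ((ℤ.+ 1 ℤ.* ℤ.+ suc d ℤ.+ ℤ.+ p ℤ.* ℤ.+ 2) ℤ.* ℤ.+ n) ℤ.* ℤ.+ 1 ≡ ℤ.+ ((suc d + p * 2) * n)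
  left = trans (ℤ.*-identityʳ _) (trans (cong (ℤ._* ℤ.+ n) (cong₂ ℤ._+_ (ℤ.*-identityˡ (ℤ.+ suc d)) (sym (ℤ.pos-* p 2)))) (sym (ℤ.pos-* (suc d + p * 2) n)))
  right : ℤ.+ δ ℤ.* ℤ.+ (2 * suc d * 1) ≡ ℤ.+ (δ * (2 * suc d))
  right = trans (sym (ℤ.pos-* δ _)) (cong (λ z → ℤ.+ (δ * z)) (*-identityʳ (2 * suc d)))

-- For c = p/q, replacing n by 2^ℓ in the base and comparing exponents gives ℓ d q ≤ p n. As c ≤
-- 1/(z+1) means p (z+1) ≤ q, the numerator p cancels.
degree-bound-ℕ : ∀ z c → 0ℚ ℚ.< c → c ℚ.≤ mkℚ (ℤ.+ 1) z (1-coprimeTo (suc z)) →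
  ∀ n ℓ d → 2 ^ ℓ ≤ n → DegBound c n d → ℓ * suc z * d ≤ n
degree-bound-ℕ z (mkℚ (ℤ.+ zero) q cop) (ℚ.*<* (ℤ.+<+ ())) _ n ℓ d lo db
degree-bound-ℕ z (mkℚ ℤ.-[1+ p ] q cop) (ℚ.*<* ()) _ n ℓ d lo db
degree-bound-ℕ z (mkℚ (ℤ.+ suc p) q cop) _ (ℚ.*≤* le) n ℓ d lo db = *-cancelˡ-≤ (suc p) (begin
  suc p * (ℓ * suc z * d) ≡⟨ eq (suc p) ℓ (suc z) d ⟩
  ℓ * (d * (suc p * suc z)) ≤⟨ *-monoʳ-≤ ℓ (*-monoʳ-≤ d pz) ⟩
  ℓ * (d * suc q) ≤⟨ pow-cancel _ _ (≤-trans (≤-trans (≤-reflexive (sym (^-*-assoc 2 ℓ (d * suc q)))) (^-monoˡ-≤ (d * suc q) lo)) db) ⟩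
  suc p * n ∎)
  where
  open ≤-Reasoning
  eq : ∀ p ℓ z d → p * (ℓ * z * d) ≡ ℓ * (d * (p * z))
  eq = solve-∀
  pz : suc p * suc z ≤ suc q
  pz = ≤-trans (ℤ.drop‿+≤+ le) (≤-reflexive (*-identityˡ (suc q)))

module _ {n : ℕ} (G T : Graph n) (tree : IsTree T) (t v : Fin n) where

  -- The last hypothesis says δ(G) ≥ (1/2 + 2/k) n.
  rooted-copy : ∀ k κ J ē c Z ℓ → 1 ≤ k → κ ≡ 512 * (k * (k * k)) → J ≡ 2 * κ * 64 → ē ≡ 4 * J * k → suc c ≡ 24 * k * ē →
    Z ≡ 4 * suc c * (16 * suc c * k * k * ē * J) → 1 ≤ Z → 1 ≤ ℓ → 2 ≤ n → n < 2 ^ suc ℓ →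
    (∀ x → ℓ * Z * # (adj T x) ≤ n) → (∀ u → k * n + 4 * n ≤ 2 * k * # (adj G u)) →
    Σ (Embedding T G) λ em → Embedding.φ em t ≡ v
  -- Δ is taken as the largest degree that the hypothesis permits, whatever the maximum degree of T
  -- is.
  rooted-copy k κ J ē c Z ℓ 1≤k κ≡ J≡ ē≡ h≡ Z≡ 1≤Z 1≤ℓ 2≤n n< degT degG = choose (divide n (ℓ * Z) (*-mono-≤ 1≤ℓ 1≤Z))
    where
    module TO = TreeOrder T (proj₁ tree) (proj₂ tree) t
    module FO = TO.FullOrder TO.full-order
    module O = TO.Order FO.order
    nbr-par : ∀ x y → adj T x y ≡ true → y ≡ O.par x ⊎ O.par y ≡ x
    nbr-par x y = O.nb-par x y (FO.covers x) (FO.covers y)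
    par-nbr : ∀ x → x ≢ t → adj T x (O.par x) ≡ true
    par-nbr x = O.par-nb x (FO.covers x)
    choose : (∃ λ Δ → ℓ * Z * Δ ≤ n × n < ℓ * Z * suc Δ) → Σ (Embedding T G) λ em → Embedding.φ em t ≡ v
    choose (Δ , Δ≤ , <Δ) = conclude (CC.embed d (CC.constants k κ J ē c ℓ (length (CC.Decomposition.pieces d)) 1≤k κ≡ J≡ ē≡ h≡ refl 1≤Δ n< AQ far≤ (CC.Decomposition.count d)) v)
      where
      deg≤ : ∀ x → # (adj T x) ≤ Δ
      deg≤ x = ≤-pred (*-cancelˡ-< (ℓ * Z) _ _ (≤-<-trans (degT x) <Δ))
      s₁ : ℕ
      s₁ = suc c * Δ
      module CC = RootedTree (adj G) (Graph.sym G) (adj T) (Graph.sym T) t O.par O.par-t par-nbr nbr-par O.colour (λ x → O.alternates x (FO.covers x)) s₁ Δ deg≤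
      -- With two vertices T has an edge, so the degree hypothesis itself forces ℓ Z ≤ n. This
      -- excludes small n and is why 2 can serve as n₀.
      1≤Δ : 1 ≤ Δ
      1≤Δ = ≤-trans (≤-trans (≤-reflexive (cong ⟦_⟧ (sym (par-nbr (proj₁ other) (proj₂ other))))) (∑-≥ (λ u → ⟦ adj T (proj₁ other) u ⟧) (∈-allFin (O.par (proj₁ other))))) (deg≤ (proj₁ other))
        where
        other : ∃ λ x → x ≢ t
        other = another n t 2≤n
          where
          another : ∀ m (s : Fin m) → 2 ≤ m → ∃ λ (x : Fin m) → x ≢ s
          another (suc zero) Fin.zero (s≤s ())
          another (suc (suc m)) Fin.zero _ = Fin.suc Fin.zero , λ ()
          another (suc (suc m)) (Fin.suc s) _ = Fin.zero , λ ()
      -- The factor 4 in Z covers ℓ + 1 ≤ 2 ℓ and s₁ + 1 ≤ 2 s₁; the factor `suc c` covers s₁ =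
      -- `suc c * Δ`.
      AQ : 16 * suc c * k * k * ē * J * (suc ℓ * suc s₁) ≤ n
      AQ = begin
        A * (suc ℓ * suc s₁) ≤⟨ *-monoʳ-≤ A (*-mono-≤ {suc ℓ} {ℓ + ℓ} {suc s₁} {s₁ + s₁} (+-monoˡ-≤ ℓ 1≤ℓ) (+-monoˡ-≤ s₁ (*-mono-≤ {1} {suc c} (s≤s z≤n) 1≤Δ))) ⟩
        A * ((ℓ + ℓ) * (s₁ + s₁)) ≡⟨ eq A ℓ (suc c) Δ ⟩
        ℓ * (4 * suc c * A) * Δ ≡⟨ cong (λ z → ℓ * z * Δ) (sym Z≡) ⟩
        ℓ * Z * Δ ≤⟨ Δ≤ ⟩
        n ∎
        where
        open ≤-Reasoning
        A : ℕ
        A = 16 * suc c * k * k * ē * J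
        eq : ∀ A ℓ h Δ → A * ((ℓ + ℓ) * (h * Δ + h * Δ)) ≡ ℓ * (4 * h * A) * Δ
        eq = solve-∀
      far≤ : ∀ u → 2 * k * CC.far (λ _ → true) u + 4 * n ≤ k * n
      far≤ u = subst (λ z → 2 * k * F + 4 * z ≤ k * z) a+F
        (cert 0 (subst (λ z → k * z + 4 * z ≤ 2 * k * # (adj G u)) (sym a+F) (degG u)) (eq k (# (adj G u)) F))
        where
        F : ℕ
        F = CC.far (λ _ → true) u
        a+F : # (adj G u) + F ≡ n
        a+F = trans (CC.near+far (λ _ → true) u) (trans (∑-1 (allFin n)) (length-allFin n))
        eq : ∀ k a F → 2 * k * F + 4 * (a + F) + 2 * k * a + 0 ≡ k * (a + F) + (k * (a + F) + 4 * (a + F))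
        eq = solve-∀
      d : CC.Decomposition
      d = CC.decompose {op = []} {cl = []} FO.grown record
        { sums = λ f → trans (+-identityʳ _) (∑-cover O.unique FO.covers f)
        ; op-good = λ _ () ; op-par = λ _ () ; cl-good = λ _ () ; ordered = CC.[] ; count = z≤n }
      conclude : CC.Embedded v → Σ (Embedding T G) λ em → Embedding.φ em t ≡ v
      conclude em = record
        { φ = ψ
        ; φ-inj = λ {x} {y} → ψ-injective x y
        ; φ-hom = hom
        } , ψ-root
        where
        open CC.Embedded em
        ≢t : ∀ {x} → adj T x (O.par x) ≡ true → x ≢ t
        ≢t {x} q refl = case trans (sym q) (trans (cong (adj T x) O.par-t) (irrefl T x)) of λ ()
        hom : ∀ x y → x ∼[ T ] y → ψ x ∼[ G ] ψ y
        hom x y xy = by (nbr-par x y xy)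
          where
          by : y ≡ O.par x ⊎ O.par y ≡ x → ψ x ∼[ G ] ψ y
          by (inj₁ refl) = ψ-edge x (≢t xy)
          by (inj₂ refl) = trans (Graph.sym G _ _) (ψ-edge y (≢t (trans (Graph.sym T _ _) xy)))

theorem4p4 : (α : ℚ) → 0ℚ ℚ.< α →
  Σ ℚ λ c₀ → 0ℚ ℚ.< c₀ ×
    ((c : ℚ) → 0ℚ ℚ.< c → c ℚ.≤ c₀ →
      Σ ℕ λ n₀ → (n : ℕ) → n ≥ n₀ →
        (G T : Graph n) →
        (∀ v → (½ ℚ.+ α) ℚ.* (ℤ.+ n ℚ./ 1) ℚ.≤ ℤ.+ degree G v ℚ./ 1) →
        IsTree T →
        (∀ x → DegBound c n (degree T x)) →
        (t v : Fin n) →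
        Σ (Embedding T G) λ e → Embedding.φ e t ≡ v)
theorem4p4 (mkℚ (ℤ.+ zero) q cop) (ℚ.*<* (ℤ.+<+ ()))
theorem4p4 (mkℚ ℤ.-[1+ p ] q cop) (ℚ.*<* ())
theorem4p4 (mkℚ (ℤ.+ suc p) q cop) _ = mkℚ (ℤ.+ 1) z (1-coprimeTo (suc z)) , ℚ.*<* (ℤ.+<+ (s≤s z≤n)) , λ c 0<c c≤ → 2 , λ n 2≤n G T degG tree degT t v →
    let ℓ , lo , hi = log₂-bounds n (≤-trans (s≤s z≤n) 2≤n) in
    rooted-copy G T tree t v k κ J ē h′ (suc z) ℓ (s≤s z≤n) refl refl refl h≡ Z≡ (s≤s z≤n) (ℓ>0 ℓ n 2≤n hi) 2≤n hi
      (λ x → degree-bound-ℕ z c 0<c c≤ n ℓ (# (adj T x)) lo (subst (DegBound c n) (degree-# T x) (degT x)))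
      (λ u → min-degree n (# (adj G u)) (subst (λ δ → (suc q + suc p * 2) * n ≤ δ * (2 * suc q)) (degree-# G u) (min-degree-ℕ (suc p) q cop n (degree G u) (degG u))))
  where
  -- α ≥ 1/(q+1) = 2/k
  k κ J ē h′ z : ℕ
  k = 2 * suc q
  κ = 512 * (k * (k * k))
  J = 2 * κ * 64
  ē = 4 * J * k
  h′ = pred (24 * k * ē)
  z = pred (4 * suc h′ * (16 * suc h′ * k * k * ē * J))
  pos : ∀ a b → 1 ≤ a → 1 ≤ b → 1 ≤ a * b
  pos a b p q = *-mono-≤ {1} {a} p q
  1≤k : 1 ≤ k
  1≤k = s≤s z≤n
  1≤κ : 1 ≤ κ
  1≤κ = pos 512 _ (s≤s z≤n) (pos k _ 1≤k (pos k k 1≤k 1≤k))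
  1≤J : 1 ≤ J
  1≤J = pos (2 * κ) 64 (pos 2 κ (s≤s z≤n) 1≤κ) (s≤s z≤n)
  1≤ē : 1 ≤ ē
  1≤ē = pos (4 * J) k (pos 4 J (s≤s z≤n) 1≤J) 1≤k
  h≡ : suc h′ ≡ 24 * k * ē
  h≡ = suc-pred (24 * k * ē) {{>-nonZero (pos (24 * k) ē (pos 24 k (s≤s z≤n) 1≤k) 1≤ē)}}
  Z≡ : suc z ≡ 4 * suc h′ * (16 * suc h′ * k * k * ē * J)
  Z≡ = suc-pred _ {{>-nonZero (pos (4 * suc h′) (16 * suc h′ * k * k * ē * J) (s≤s z≤n)
    (pos (16 * suc h′ * k * k * ē) J (pos (16 * suc h′ * k * k) ē (pos (16 * suc h′ * k) k (pos (16 * suc h′) k (s≤s z≤n) 1≤k) 1≤k) 1≤ē) 1≤J))}}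
  ℓ>0 : ∀ ℓ n → 2 ≤ n → n < 2 ^ suc ℓ → 1 ≤ ℓ
  ℓ>0 zero n 2≤n hi = ⊥-elim (<⇒≱ hi 2≤n)
  ℓ>0 (suc ℓ) n _ _ = s≤s z≤n
  min-degree : ∀ n δ → (suc q + suc p * 2) * n ≤ δ * (2 * suc q) → k * n + 4 * n ≤ 2 * k * δ
  min-degree n δ le = cert (4 * p * n) (*-monoʳ-≤ 2 le) (eq q p n δ)
    where
    eq : ∀ q p n δ → 2 * (1 + q) * n + 4 * n + 2 * (δ * (2 * (1 + q))) + 4 * p * n ≡ 2 * (2 * (1 + q)) * δ + 2 * (((1 + q) + (1 + p) * 2) * n)
    eq = solve-∀
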